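{- Let $m,n,k$ be non-negative integers with $k\le n$ and let $b_1<\dots<b_k$ be positive integers with $b_k\le m+k$. Then $\sum_G u^{\operatorname{inv}(G)}v^{\operatorname{inv}'(G)}$, summed over all $(m,n,k)$-Gog trapezoids $G$ with bottom row $(b_1,\dots,b_k)$, equals the constant term in $x_1,\dots,x_n$ of $$\prod_{i=1}^k(1+x_i)^{b_i}x_i^{ -n+1}\prod_{i=k+1}^n(1+x_i)^{m+i+1}(1+ux_i)^{k-i}x_i^{ -n+i-k}\prod_{1\le i<j\le n}(x_i-x_j)\bigl(1+(1-v)x_i+u(x_j+x_ix_j)\bigr).$$
   Context: For non-negative integers $m,n,k$ with $k\le n$, an $(m,n,k)$-Gog trapezoid is an array $(m_{i,j})$ of positive integers indexed by $1\le i\le n$, $1\le j\le\min(i,k)$ (the $k$ leftmost NE-diagonals of a triangular array with $n$ rows), such that $m_{i+1,j}\le m_{i,j}\le m_{i+1,j+1}$ whenever the entries exist, rows are strictly increasing, and $m_{i,j}\le m+n-i+j$. Bottom row: $(m_{n,1},\dots,m_{n,k})$. $\operatorname{inv}(G)=\#\{(i,j):m_{i,j}=m_{i+1,j+1}\text{ with both entries in }G\}$, $\operatorname{inv}'(G)=\#\{(i,j):m_{i,j}=m_{i+1,j}\text{ with both entries in }G\}$. $u,v$ are indeterminates; $(1+ux_i)^{k-i}$ is expanded as a power series in $x_i$. -}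

module Defs where

open import Data.Nat as ℕ using (ℕ; zero; suc; _+_; _∸_; _⊓_)
open import Data.Integer as ℤ using (ℤ; +_; -[1+_]; 0ℤ; 1ℤ; -1ℤ)
open import Data.List as List using (List; allFin; []; _∷_; [_]; map; concatMap; upTo; foldr; _++_; sum; length)
open import Data.List.Properties using (≡-dec)
open import Data.Vec as Vec using (Vec; lookup; tabulate; replicate; toList; zipWith)
open import Data.Fin as Fin using (Fin; toℕ)

open import Data.Bool using (Bool; true; false; _∧_; if_then_else_)
open import Data.Maybe using (Maybe; just; nothing)
open import Relation.Nullary.Decidable using (⌊_⌋)
open import Data.Product using (_×_; _,_)

choices : {A : Set} → List (List A) → List (List A)
choices []         = [] ∷ []
choices (xs ∷ xss) = concatMap (λ x → map (x ∷_) (choices xss)) xs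

at : {A : Set} → List A → ℕ → Maybe A
at []       _       = nothing
at (x ∷ xs) zero    = just x
at (x ∷ xs) (suc i) = at xs i

allB : {A : Set} → (A → Bool) → List A → Bool
allB p = foldr (λ x r → p x ∧ r) true

countB : {A : Set} → (A → Bool) → List A → ℕ
countB p = foldr (λ x r → if p x then suc r else r) 0

lastRow : List (List ℕ) → List ℕ
lastRow []             = []
lastRow (x ∷ [])       = x
lastRow (x ∷ y ∷ rest) = lastRow (y ∷ rest)

-- Gog trapezoids.
-- An array is a list of rows; row r (0-based, r = i-1) has min(i,k)
-- entries; entry c (0-based, c = j-1) is m_{i,j}.

rowLen : (k r : ℕ) → ℕ
rowLen k r = suc r ⊓ k

-- all candidate rows r: entries 1 ≤ m_{i,j} ≤ m+n-i+j  (= (m+n-r)+c)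
rowCands : (m n k r : ℕ) → List (List ℕ)
rowCands m n k r =
  choices (map (λ c → map suc (upTo ((m + n ∸ r) + c))) (upTo (rowLen k r)))

arrays : (m n k : ℕ) → List (List (List ℕ))
arrays m n k = choices (map (rowCands m n k) (upTo n))

entry : List (List ℕ) → ℕ → ℕ → Maybe ℕ
entry G r c with at G r
... | nothing  = nothing
... | just row = at row c

leM : Maybe ℕ → Maybe ℕ → Bool
leM (just x) (just y) = x ℕ.≤ᵇ y
leM _        _        = true

ltM : Maybe ℕ → Maybe ℕ → Bool
ltM (just x) (just y) = x ℕ.<ᵇ y
ltM _        _        = true

eqM : Maybe ℕ → Maybe ℕ → Bool
eqM (just x) (just y) = x ℕ.≡ᵇ y
eqM _        _        = false

positions : (n k : ℕ) → List (ℕ × ℕ)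
positions n k = concatMap (λ r → map (λ c → r , c) (upTo (rowLen k r))) (upTo n)

isGogWithBottom : (n k : ℕ) → List ℕ → List (List ℕ) → Bool
isGogWithBottom n k bottom G =
  allB (λ { (r , c) →
           leM (entry G (suc r) c) (entry G r c)
         ∧ leM (entry G r c) (entry G (suc r) (suc c))
         ∧ ltM (entry G r c) (entry G r (suc c)) })
       (positions n k)
  ∧ ⌊ ≡-dec ℕ._≟_ (lastRow G) bottom ⌋

inv : (n k : ℕ) → List (List ℕ) → ℕ
inv n k G = countB (λ { (r , c) → eqM (entry G r c) (entry G (suc r) (suc c)) }) (positions n k)

inv′ : (n k : ℕ) → List (List ℕ) → ℕ
inv′ n k G = countB (λ { (r , c) → eqM (entry G r c) (entry G (suc r) c) }) (positions n k)

-- Laurent polynomials in x_1..x_n with coefficients in ℤ[u,v],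
-- represented as (uncollected) finite sums of terms c·u^p·v^q·x^e.

record Term (n : ℕ) : Set where
  constructor term
  field
    coeff : ℤ
    uexp  : ℕ
    vexp  : ℕ
    xexp  : Vec ℤ n
open Term public

LPoly : ℕ → Set
LPoly n = List (Term n)

UV : Set
UV = LPoly 0

mulTerm : {n : ℕ} → Term n → Term n → Term n
mulTerm (term c p q e) (term c′ p′ q′ e′) =
  term (c ℤ.* c′) (p + p′) (q + q′) (zipWith ℤ._+_ e e′)

infixl 7 _⊗_
_⊗_ : {n : ℕ} → LPoly n → LPoly n → LPoly n
P ⊗ Q = concatMap (λ s → map (mulTerm s) Q) P

oneP : {n : ℕ} → LPoly n
oneP = term 1ℤ 0 0 (replicate _ 0ℤ) ∷ []

prodP : {n : ℕ} → List (LPoly n) → LPoly n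
prodP = foldr _⊗_ oneP

powP : {n : ℕ} → LPoly n → ℕ → LPoly n
powP P zero    = oneP
powP P (suc b) = P ⊗ powP P b

coeffUV : ℕ → ℕ → UV → ℤ
coeffUV a b P =
  foldr (λ t r → if (uexp t ℕ.≡ᵇ a) ∧ (vexp t ℕ.≡ᵇ b) then coeff t ℤ.+ r else r) 0ℤ P

xvec : {n : ℕ} → Fin n → ℤ → Vec ℤ n
xvec i e = tabulate (λ j → if ⌊ j Fin.≟ i ⌋ then e else 0ℤ)

mono : {n : ℕ} → ℤ → ℕ → ℕ → Fin n → ℤ → LPoly n
mono c p q i e = term c p q (xvec i e) ∷ []

Series : Set
Series = ℕ → UV

oneS : Series
oneS zero    = oneP
oneS (suc _) = []

_⋆_ : Series → Series → Series
(S ⋆ T) l = concatMap (λ j → S j ⊗ T (l ∸ j)) (upTo (suc l))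

invOnePlusUX : Series
invOnePlusUX l = term (-1ℤ ℤ.^ l) l 0 Vec.[] ∷ []


invOnePlusUXPow : ℕ → Series
invOnePlusUXPow zero    = oneS
invOnePlusUXPow (suc r) = invOnePlusUX ⋆ invOnePlusUXPow r

coeffAtNeg : Series → ℤ → UV
coeffAtNeg S (+ zero)    = S 0
coeffAtNeg S (+ suc _)   = []
coeffAtNeg S -[1+ l ]    = S (suc l)

-- Constant term in x_1..x_n of  P · ∏_i S_i(x_i),  P a Laurent polynomial
-- and S_i a power series in x_i: Σ_{c u^p v^q x^e ∈ P} c u^p v^q ∏_i [x_i^{-e_i}] S_i.
constTerm : {n : ℕ} → LPoly n → (Fin n → Series) → UV
constTerm {n} P S =
  concatMap (λ t → (term (coeff t) (uexp t) (vexp t) Vec.[] ∷ [])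
                   ⊗ prodP (map (λ i → coeffAtNeg (S i) (lookup (xexp t) i)) (allFin n)))
            P

gogGF : (m n k : ℕ) → Vec ℕ k → UV
gogGF m n k b =
  concatMap (λ G → if isGogWithBottom n k (toList b) G
                   then term 1ℤ (inv n k G) (inv′ n k G) Vec.[] ∷ []
                   else [])
            (arrays m n k)

-- b_i for 1-based index i (default 0 out of range; only used for i ≤ k)
bAt : {k : ℕ} → Vec ℕ k → ℕ → ℕ
bAt b i with at (toList b) i
... | just x  = x
... | nothing = 0

onePlusX : {n : ℕ} → Fin n → LPoly n
onePlusX i = oneP ++ mono 1ℤ 0 0 i 1ℤ

-- factor for index i (Fin n, 1-based index toℕ i + 1), Laurent polynomial part:
--   i ≤ k : (1+x_i)^{b_i} x_i^{-n+1}
--   i > k : (1+x_i)^{m+i+1} x_i^{-n+i-k}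
singleFactor : (m n k : ℕ) → Vec ℕ k → Fin n → LPoly n
singleFactor m n k b i =
  if toℕ i ℕ.<ᵇ k
  then powP (onePlusX i) (bAt b (toℕ i)) ⊗ mono 1ℤ 0 0 i (1ℤ ℤ.- + n)
  else powP (onePlusX i) (m + suc (toℕ i) + 1)
         ⊗ mono 1ℤ 0 0 i ((ℤ.- (+ n)) ℤ.+ + suc (toℕ i) ℤ.- + k)

pairFactor : {n : ℕ} → Fin n → Fin n → LPoly n
pairFactor i j =
  (mono 1ℤ 0 0 i 1ℤ ++ mono -1ℤ 0 0 j 1ℤ)
  ⊗ (oneP ++ mono 1ℤ 0 0 i 1ℤ ++ mono -1ℤ 0 1 i 1ℤ ++ mono 1ℤ 1 0 j 1ℤ
       ++ (mono 1ℤ 1 0 i 1ℤ ⊗ mono 1ℤ 0 0 j 1ℤ))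

pairs : (n : ℕ) → List (Fin n × Fin n)
pairs n = concatMap (λ i → concatMap (λ j → if toℕ i ℕ.<ᵇ toℕ j then (i , j) ∷ [] else [])
                                       (allFin n))
                    (allFin n)

integrandPoly : (m n k : ℕ) → Vec ℕ k → LPoly n
integrandPoly m n k b =
  prodP (map (singleFactor m n k b) (allFin n))
  ⊗ prodP (map (λ { (i , j) → pairFactor i j }) (pairs n))

integrandSeries : (n k : ℕ) → Fin n → Series
integrandSeries n k i =
  if toℕ i ℕ.<ᵇ k then oneS else invOnePlusUXPow (suc (toℕ i) ∸ k)

{-# OPTIONS --safe #-}
-- Write V for the product over i < j of (xᵢ - xⱼ) q(xᵢ, xⱼ), with q(x, y) = 1 + (1 - v) x + u (y + x y),
-- and C(g₁, …, gₙ) for the constant term of V ∏ gᵢ(xᵢ) xᵢ^(1 - n). Both sides of the identity satisfy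
-- the recursion that deletes the bottom row. The weighted sum of (1 + x)^a over one entry b ≤ a ≤ b′ is
-- (r (1 + x)^b′ - l (1 + x)^b) / x, where r = 1 + u x and l = 1 + (1 - v) x. In the expanded product of
-- these differences, a term that uses the same b′ twice, with r for the entry x on its left and l for
-- the entry y on its right, combines with the correction u v x y for the forbidden equality of the two
-- entries to q(y, x). Since q(y, x) V is x - y times a function symmetric in x and y, this vanishes. The
-- remaining terms form the alternating sum of C(l g₁ / x, …, l gᵢ₋₁ / x, r gᵢ₊₁ / x, …, r gₙ / x) gᵢ(0),
-- which is C(g₁, …, gₙ) by the Laplace expansion of the Vandermonde determinant, because a factor xᵢ^n
-- leaves only the value of the other factors at xᵢ = 0. The bound on the last entry of a truncated row
-- acts like one more entry with the series (1 + x)^b′ / (1 + u x), whence the variables of index i > k.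

module Submission where

open import Defs
open import Level using (0ℓ)
open import Algebra.Bundles using (CommutativeRing)
open import Algebra.Structures using (IsCommutativeMonoid)
import Algebra.Properties.AbelianGroup
import Algebra.Properties.Ring
import Algebra.Properties.Semiring.Mult.TCOptimised
import Algebra.Solver.Ring
open import Algebra.Solver.Ring.AlmostCommutativeRing using (fromCommutativeRing; _-Raw-AlmostCommutative⟶_)
open import Data.Bool using (Bool; true; false; _∧_; if_then_else_)
open import Data.Fin as Fin using (Fin; zero; suc; toℕ)
import Data.Fin.Properties as Finₚ
open import Data.Integer as ℤ using (ℤ; +_; -[1+_]; 0ℤ; 1ℤ; -1ℤ)
import Data.Integer.Properties as ℤₚ
open import Data.List as List using (List; []; _∷_; _++_; _∷ʳ_; length; upTo; applyUpTo; allFin; tabulate)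
import Data.List.Properties as Listₚ
open import Data.List.Membership.Propositional using (_∈_)
open import Data.List.Relation.Binary.Pointwise as LPW using ([]; _∷_)
open import Data.List.Relation.Unary.All as All using (All; []; _∷_)
import Data.List.Relation.Unary.All.Properties as Allₚ
open import Data.Maybe using (Maybe; just; nothing; fromMaybe)
open import Data.Nat as ℕ using (ℕ; zero; suc)
import Data.Nat.Properties as ℕₚ
open import Data.Product using (_×_; _,_; ∃; proj₁; proj₂)
open import Data.Sign as Sign using (Sign)
open import Data.Sum using (_⊎_; inj₁; inj₂)
open import Data.Unit using (⊤; tt)
open import Data.Vec as Vec using (Vec; []; _∷_; lookup; removeAt; insertAt; zipWith; replicate; head; tail; toList)
import Data.Vec.Properties as Vecₚ
open import Data.Vec.Relation.Binary.Pointwise.Inductive as PW using (Pointwise; []; _∷_)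
open import Function using (_∘_; id)
import Relation.Binary.Reasoning.Setoid
open import Relation.Binary.Definitions using (tri<; tri≈; tri>)
open import Relation.Binary.PropositionalEquality as ≡ using (_≡_; _≢_)
open import Relation.Nullary using (yes; no)
open import Relation.Nullary.Decidable using (dec-true; dec-false; ⌊_⌋; isYes≗does; does)
open import Relation.Nullary.Negation using (contradiction)

-- The cancellation is needed at every pair of adjacent slots, not just at the first two. Fixing a
-- series in the first slot and extracting the coefficient of its variable turns V(x₁, ..., xₙ) into
-- V(x₂, ..., xₙ) times a polynomial that is symmetric in the remaining variables, because x₁ meets
-- all of them through the same factor. The cancellation is therefore proved for S V with S
-- symmetric, a class that is closed under this step. Deleting the bottom row preserves m + n, so
-- the recursion raises m by one and the induction runs over all m at once. As soon as at most k
-- rows are left, each row is one entry shorter than the next; this triangular part is a second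
-- recursion with its own end of the chain of slots. The recursion never divides by x. It sums x (1
-- + x)^a and reads off the coefficient of xᵢ^n instead of xᵢ^(n - 1). Likewise the negative powers
-- of the statement and the infinite series are kept in the functional that is applied to a
-- polynomial, and equality of polynomials means equality under all functionals, so that terms need
-- not be collected.

Ring₀ : Set₁
Ring₀ = CommutativeRing 0ℓ 0ℓ

-- A ring solver with integer coefficients for any commutative ring.

module IntegerSolver (R : Ring₀) where
  open CommutativeRing R hiding (zero)
  open Algebra.Properties.Ring ring using (-‿distribˡ-*; -‿distribʳ-*; -‿involutive; -0#≈0#)
  open Algebra.Properties.AbelianGroup +-abelianGroup using (⁻¹-∙-comm)
  open Algebra.Properties.Semiring.Mult.TCOptimised semiring using (×-homo-+; ×1-homo-*; 1+×) renaming (_×_ to _·_)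
  open Relation.Binary.Reasoning.Setoid setoid

  natural : ℕ → Carrier
  natural n = n · 1#

  integer : ℤ → Carrier
  integer (+ n)    = natural n
  integer -[1+ n ] = - natural (suc n)

  sgn : Sign → Carrier → Carrier
  sgn Sign.+ x = x
  sgn Sign.- x = - x

  integer-◃ : ∀ s n → integer (s ℤ.◃ n) ≈ sgn s (natural n)
  integer-◃ Sign.+ zero    = refl
  integer-◃ Sign.- zero    = sym -0#≈0#
  integer-◃ Sign.+ (suc n) = refl
  integer-◃ Sign.- (suc n) = refl

  integer-sgn : ∀ i → integer i ≈ sgn (ℤ.sign i) (natural ℤ.∣ i ∣)
  integer-sgn (+ n)    = refl
  integer-sgn -[1+ n ] = refl

  sgn-cong : ∀ s {x y} → x ≈ y → sgn s x ≈ sgn s y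
  sgn-cong Sign.+ p = p
  sgn-cong Sign.- p = -‿cong p

  sgn-* : ∀ s t x y → sgn (s Sign.* t) (x * y) ≈ sgn s x * sgn t y
  sgn-* Sign.+ Sign.+ x y = refl
  sgn-* Sign.+ Sign.- x y = -‿distribʳ-* x y
  sgn-* Sign.- Sign.+ x y = -‿distribˡ-* x y
  sgn-* Sign.- Sign.- x y = begin
    x * y ≈⟨ -‿involutive (x * y) ⟨
    - - (x * y) ≈⟨ -‿cong (-‿distribʳ-* x y) ⟩
    - (x * - y) ≈⟨ -‿distribˡ-* x (- y) ⟩
    - x * - y ∎

  integer-* : ∀ i j → integer (i ℤ.* j) ≈ integer i * integer j
  integer-* i j = begin
    integer (i ℤ.* j) ≈⟨ integer-◃ (ℤ.sign i Sign.* ℤ.sign j) (ℤ.∣ i ∣ ℕ.* ℤ.∣ j ∣) ⟩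
    sgn (ℤ.sign i Sign.* ℤ.sign j) (natural (ℤ.∣ i ∣ ℕ.* ℤ.∣ j ∣))
      ≈⟨ sgn-cong (ℤ.sign i Sign.* ℤ.sign j) (×1-homo-* ℤ.∣ i ∣ ℤ.∣ j ∣) ⟩
    sgn (ℤ.sign i Sign.* ℤ.sign j) (natural ℤ.∣ i ∣ * natural ℤ.∣ j ∣) ≈⟨ sgn-* (ℤ.sign i) (ℤ.sign j) _ _ ⟩
    sgn (ℤ.sign i) (natural ℤ.∣ i ∣) * sgn (ℤ.sign j) (natural ℤ.∣ j ∣)
      ≈⟨ *-cong (integer-sgn i) (integer-sgn j) ⟨
    integer i * integer j ∎

  integer-⊖ : ∀ m n → integer (m ℤ.⊖ n) ≈ natural m + - natural n
  integer-⊖ m       zero    = sym (trans (+-congˡ -0#≈0#) (+-identityʳ _))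
  integer-⊖ zero    (suc n) = sym (+-identityˡ _)
  integer-⊖ (suc m) (suc n) = begin
    integer (suc m ℤ.⊖ suc n) ≡⟨ ≡.cong integer (ℤₚ.[1+m]⊖[1+n]≡m⊖n m n) ⟩
    integer (m ℤ.⊖ n) ≈⟨ integer-⊖ m n ⟩
    natural m + - natural n ≈⟨ +-congʳ (+-identityʳ _) ⟨
    natural m + 0# + - natural n ≈⟨ +-congʳ (+-congˡ (-‿inverseʳ 1#)) ⟨
    natural m + (1# + - 1#) + - natural n ≈⟨ +-congʳ (+-assoc _ _ _) ⟨
    natural m + 1# + - 1# + - natural n ≈⟨ +-assoc _ _ _ ⟩
    natural m + 1# + (- 1# + - natural n) ≈⟨ +-cong (+-comm _ _) (⁻¹-∙-comm _ _) ⟩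
    1# + natural m + - (1# + natural n) ≈⟨ +-cong (1+× m 1#) (-‿cong (1+× n 1#)) ⟨
    natural (suc m) + - natural (suc n) ∎

  integer-+ : ∀ i j → integer (i ℤ.+ j) ≈ integer i + integer j
  integer-+ (+ m)    (+ n)    = ×-homo-+ 1# m n
  integer-+ (+ m)    -[1+ n ] = integer-⊖ m (suc n)
  integer-+ -[1+ m ] (+ n)    = trans (integer-⊖ n (suc m)) (+-comm _ _)
  integer-+ -[1+ m ] -[1+ n ] = begin
    - natural (suc (suc (m ℕ.+ n))) ≡⟨ ≡.cong (λ k → - natural (suc k)) (ℕₚ.+-suc m n) ⟨
    - natural (suc m ℕ.+ suc n) ≈⟨ -‿cong (×-homo-+ 1# (suc m) (suc n)) ⟩
    - (natural (suc m) + natural (suc n)) ≈⟨ ⁻¹-∙-comm _ _ ⟨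
    - natural (suc m) + - natural (suc n) ∎

  integer-neg : ∀ i → integer (ℤ.- i) ≈ - integer i
  integer-neg (+ zero)  = sym -0#≈0#
  integer-neg (+ suc n) = refl
  integer-neg -[1+ n ]  = sym (-‿involutive _)

  morphism : CommutativeRing.rawRing ℤₚ.+-*-commutativeRing -Raw-AlmostCommutative⟶ fromCommutativeRing R
  morphism = record
    { ⟦_⟧    = integer
    ; +-homo = integer-+
    ; *-homo = integer-*
    ; -‿homo = integer-neg
    ; 0-homo = refl
    ; 1-homo = refl
    }

  -- Equality in R need not be decidable. Comparing the integer coefficients is enough for the
  -- solver to merge and cancel terms.
  coefficient≟ : ∀ i j → Maybe (integer i ≈ integer j)
  coefficient≟ i j with i ℤₚ.≟ j
  ... | yes p = just (reflexive (≡.cong integer p))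
  ... | no  _ = nothing

  open Algebra.Solver.Ring _ _ morphism coefficient≟ public
    using (solve; _:=_; _:+_; _:*_; _:-_; :-_; con; Polynomial)

  :1 : ∀ {n} → Polynomial n
  :1 = con 1ℤ

-- Finite sums, formal linear combinations and monoid algebras.

module Sums (R : Ring₀) where
  open CommutativeRing R hiding (zero)
  open Relation.Binary.Reasoning.Setoid setoid
  open IntegerSolver R
  open Algebra.Properties.Ring ring using (-0#≈0#)
  open Algebra.Properties.AbelianGroup +-abelianGroup using (⁻¹-∙-comm)

  private variable
    I J : Set

  ∑ : List I → (I → Carrier) → Carrier
  ∑ []       f = 0#
  ∑ (x ∷ xs) f = f x + ∑ xs f

  ∑-cong : ∀ (xs : List I) {f g : I → Carrier} → (∀ x → f x ≈ g x) → ∑ xs f ≈ ∑ xs g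
  ∑-cong []       p = refl
  ∑-cong (x ∷ xs) p = +-cong (p x) (∑-cong xs p)

  ∑-zero : ∀ (xs : List I) {f : I → Carrier} → (∀ x → f x ≈ 0#) → ∑ xs f ≈ 0#
  ∑-zero []       p = refl
  ∑-zero (x ∷ xs) p = trans (+-cong (p x) (∑-zero xs p)) (+-identityˡ 0#)

  ∑-++ : ∀ (xs ys : List I) (f : I → Carrier) → ∑ (xs ++ ys) f ≈ ∑ xs f + ∑ ys f
  ∑-++ []       ys f = sym (+-identityˡ _)
  ∑-++ (x ∷ xs) ys f = trans (+-congˡ (∑-++ xs ys f)) (sym (+-assoc _ _ _))

  ∑-map : ∀ (h : I → J) (xs : List I) (f : J → Carrier) → ∑ (List.map h xs) f ≈ ∑ xs (λ x → f (h x))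
  ∑-map h []       f = refl
  ∑-map h (x ∷ xs) f = +-congˡ (∑-map h xs f)

  ∑-concatMap : ∀ (h : I → List J) (xs : List I) (f : J → Carrier) →
                ∑ (List.concatMap h xs) f ≈ ∑ xs (λ x → ∑ (h x) f)
  ∑-concatMap h []       f = refl
  ∑-concatMap h (x ∷ xs) f = trans (∑-++ (h x) _ f) (+-congˡ (∑-concatMap h xs f))

  ∑-*ˡ : ∀ (xs : List I) c (f : I → Carrier) → ∑ xs (λ x → c * f x) ≈ c * ∑ xs f
  ∑-*ˡ []       c f = sym (zeroʳ c)
  ∑-*ˡ (x ∷ xs) c f = trans (+-congˡ (∑-*ˡ xs c f)) (sym (distribˡ _ _ _))

  ∑-neg : ∀ (xs : List I) (f : I → Carrier) → ∑ xs (λ x → - f x) ≈ - ∑ xs f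
  ∑-neg []       f = sym -0#≈0#
  ∑-neg (x ∷ xs) f = trans (+-congˡ (∑-neg xs f)) (⁻¹-∙-comm _ _)

  ∑-+ : ∀ (xs : List I) (f g : I → Carrier) → ∑ xs (λ x → f x + g x) ≈ ∑ xs f + ∑ xs g
  ∑-+ []       f g = sym (+-identityˡ 0#)
  ∑-+ (x ∷ xs) f g = trans (+-congˡ (∑-+ xs f g))
    (solve 4 (λ a b c d → (a :+ b) :+ (c :+ d) := (a :+ c) :+ (b :+ d)) refl _ _ _ _)

  ∑-swap : ∀ (xs : List I) (ys : List J) (f : I → J → Carrier) →
           ∑ xs (λ x → ∑ ys (f x)) ≈ ∑ ys (λ y → ∑ xs (λ x → f x y))
  ∑-swap []       ys f = sym (∑-zero ys (λ _ → refl))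
  ∑-swap (x ∷ xs) ys f = trans (+-congˡ (∑-swap xs ys f)) (sym (∑-+ ys _ _))

  Combination : Set → Set
  Combination I = List (Carrier × I)

  opaque
    ⟨_,_⟩ : Combination I → (I → Carrier) → Carrier
    ⟨ P , ψ ⟩ = ∑ P (λ { (c , m) → c * ψ m })

    ⟨⟩-cong : ∀ (P : Combination I) {ψ χ : I → Carrier} → (∀ m → ψ m ≈ χ m) → ⟨ P , ψ ⟩ ≈ ⟨ P , χ ⟩
    ⟨⟩-cong P p = ∑-cong P (λ { (c , m) → *-congˡ (p m) })

    ⟨⟩-+ : ∀ (P : Combination I) (ψ χ : I → Carrier) → ⟨ P , (λ m → ψ m + χ m) ⟩ ≈ ⟨ P , ψ ⟩ + ⟨ P , χ ⟩
    ⟨⟩-+ P ψ χ = trans (∑-cong P (λ { (c , m) → distribˡ _ _ _ })) (∑-+ P _ _)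

    ⟨⟩-* : ∀ (P : Combination I) c (ψ : I → Carrier) → ⟨ P , (λ m → c * ψ m) ⟩ ≈ c * ⟨ P , ψ ⟩
    ⟨⟩-* P c ψ = trans (∑-cong P (λ { (d , m) → solve 3 (λ x y z → x :* (y :* z) := y :* (x :* z)) refl d c (ψ m) }))
            (∑-*ˡ P c _)

    -- The exchange of two finite sums; the commutativity of the product in the monoid algebra rests
    -- on it.
    ⟨⟩-swap : ∀ (P : Combination I) (Q : Combination J) (ψ : I → J → Carrier) →
              ⟨ P , (λ m → ⟨ Q , ψ m ⟩) ⟩ ≈ ⟨ Q , (λ n → ⟨ P , (λ m → ψ m n) ⟩) ⟩
    ⟨⟩-swap P Q ψ = begin
      ⟨ P , (λ m → ⟨ Q , ψ m ⟩) ⟩ ≈⟨ ∑-cong P (λ { (c , m) → ∑-*ˡ Q c _ }) ⟨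
      ∑ P (λ { (c , m) → ∑ Q (λ { (d , n) → c * (d * ψ m n) }) }) ≈⟨ ∑-swap P Q _ ⟩
      ∑ Q (λ { (d , n) → ∑ P (λ { (c , m) → c * (d * ψ m n) }) }) ≈⟨ ∑-cong Q (λ { (d , n) → ⟨⟩-* P d _ }) ⟩
      ⟨ Q , (λ n → ⟨ P , (λ m → ψ m n) ⟩) ⟩ ∎

-- The monoid algebra K[M] on uncollected formal linear combinations: two of them are equal
-- when every K-valued function on M pairs with them in the same way.
module MonoidAlgebra (K : Ring₀) {M : Set} {_∙_ : M → M → M} {ε : M}
            (isCM : IsCommutativeMonoid _≡_ _∙_ ε) where
  open CommutativeRing K hiding (zero)
  open Relation.Binary.Reasoning.Setoid setoid
  open Sums K
  open IntegerSolver K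
  private module CM = IsCommutativeMonoid isCM

  Comb : Set
  Comb = Combination M

  infix 4 _≋_
  record _≋_ (P Q : Comb) : Set where
    constructor pairing≈
    field pair : ∀ ψ → ⟨ P , ψ ⟩ ≈ ⟨ Q , ψ ⟩
  open _≋_ public

  infixl 7 _⊠_
  infixl 6 _⊞_
  opaque
    unfolding ⟨_,_⟩

    none : Comb
    none = []

    _⊞_ _⊠_ : Comb → Comb → Comb
    P ⊞ Q = P ++ Q
    P ⊠ Q = List.concatMap (λ { (c , m) → List.map (λ { (d , n) → c * d , (m ∙ n) }) Q }) P

    scale : Carrier → Comb → Comb
    scale a = List.map (λ { (c , m) → a * c , m })

    monomial : Carrier → M → Comb
    monomial c m = (c , m) ∷ []

    ⟨⟩-none : ∀ ψ → ⟨ none , ψ ⟩ ≈ 0#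
    ⟨⟩-none ψ = refl

    ⟨⟩-⊞ : ∀ P Q ψ → ⟨ P ⊞ Q , ψ ⟩ ≈ ⟨ P , ψ ⟩ + ⟨ Q , ψ ⟩
    ⟨⟩-⊞ P Q ψ = ∑-++ P Q _

    ⟨⟩-⊠ : ∀ P Q ψ → ⟨ P ⊠ Q , ψ ⟩ ≈ ⟨ P , (λ m → ⟨ Q , (λ n → ψ (m ∙ n)) ⟩) ⟩
    ⟨⟩-⊠ P Q ψ = trans (∑-concatMap _ P _) (∑-cong P (λ { (c , m) →
      trans (∑-map _ Q _) (trans (∑-cong Q (λ { (d , n) → *-assoc c d _ })) (∑-*ˡ Q c _)) }))

    ⟨⟩-scale : ∀ a P ψ → ⟨ scale a P , ψ ⟩ ≈ a * ⟨ P , ψ ⟩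
    ⟨⟩-scale a P ψ = trans (∑-map _ P _) (trans (∑-cong P (λ { (c , m) → *-assoc a c _ })) (∑-*ˡ P a _))

    ⟨⟩-monomial : ∀ c m ψ → ⟨ monomial c m , ψ ⟩ ≈ c * ψ m
    ⟨⟩-monomial c m ψ = +-identityʳ _

  ⟨⟩-unit : ∀ m ψ → ⟨ monomial 1# m , ψ ⟩ ≈ ψ m
  ⟨⟩-unit m ψ = trans (⟨⟩-monomial 1# m ψ) (*-identityˡ _)

  -- Each law is checked after pairing with an arbitrary ψ, where a product becomes an iterated
  -- pairing. Associativity and the unit laws then come from the monoid, commutativity from the
  -- monoid and the exchange of sums.
  algebra : Ring₀
  algebra = record
    { Carrier = Comb
    ; _≈_ = _≋_
    ; _+_ = _⊞_
    ; _*_ = _⊠_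
    ; -_ = scale (- 1#)
    ; 0# = none
    ; 1# = monomial 1# ε
    ; isCommutativeRing = record
      { isRing = record
        { +-isAbelianGroup = record
          { isGroup = record
            { isMonoid = record
              { isSemigroup = record
                { isMagma = record
            { isEquivalence = record
            { refl = pairing≈ (λ ψ → refl)
            ; sym = λ p → pairing≈ (λ ψ → sym (pair p ψ))
            ; trans = λ p q → pairing≈ (λ ψ → trans (pair p ψ) (pair q ψ)) }
            ; ∙-cong = λ {P} {P′} {Q} {Q′} p q → pairing≈ (λ ψ →
            trans (⟨⟩-⊞ P Q _) (trans (+-cong (pair p ψ) (pair q ψ)) (sym (⟨⟩-⊞ P′ Q′ _)))) }
                ; assoc = λ P Q S → pairing≈ (λ ψ → begin
            ⟨ (P ⊞ Q) ⊞ S , ψ ⟩ ≈⟨ ⟨⟩-⊞ (P ⊞ Q) S _ ⟩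
            ⟨ P ⊞ Q , ψ ⟩ + ⟨ S , ψ ⟩ ≈⟨ +-congʳ (⟨⟩-⊞ P Q _) ⟩
            ⟨ P , ψ ⟩ + ⟨ Q , ψ ⟩ + ⟨ S , ψ ⟩ ≈⟨ +-assoc _ _ _ ⟩
            ⟨ P , ψ ⟩ + (⟨ Q , ψ ⟩ + ⟨ S , ψ ⟩) ≈⟨ +-congˡ (⟨⟩-⊞ Q S _) ⟨
            ⟨ P , ψ ⟩ + ⟨ Q ⊞ S , ψ ⟩ ≈⟨ ⟨⟩-⊞ P (Q ⊞ S) _ ⟨
            ⟨ P ⊞ (Q ⊞ S) , ψ ⟩ ∎) }
              ; identity = (λ P → pairing≈ (λ ψ → trans (⟨⟩-⊞ none P ψ) (trans (+-congʳ (⟨⟩-none ψ)) (+-identityˡ _))))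
            , (λ P → pairing≈ (λ ψ → trans (⟨⟩-⊞ P none ψ) (trans (+-congˡ (⟨⟩-none ψ)) (+-identityʳ _)))) }
            ; inverse = (λ P → pairing≈ (λ ψ → trans (⟨⟩-⊞ (scale (- 1#) P) P _) (trans (+-congʳ (⟨⟩-scale (- 1#) P ψ))
            (trans (solve 1 (λ a → (:- :1) :* a :+ a := con 0ℤ) refl ⟨ P , ψ ⟩) (sym (⟨⟩-none ψ))))))
            , (λ P → pairing≈ (λ ψ → trans (⟨⟩-⊞ P (scale (- 1#) P) _) (trans (+-congˡ (⟨⟩-scale (- 1#) P ψ))
            (trans (solve 1 (λ a → a :+ (:- :1) :* a := con 0ℤ) refl ⟨ P , ψ ⟩) (sym (⟨⟩-none ψ))))))
            ; ⁻¹-cong = λ {P} {Q} p → pairing≈ (λ ψ →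
                trans (⟨⟩-scale _ P ψ) (trans (*-congˡ (pair p ψ)) (sym (⟨⟩-scale _ Q ψ)))) }
          ; comm = λ P Q → pairing≈ (λ ψ → trans (⟨⟩-⊞ P Q _) (trans (+-comm _ _) (sym (⟨⟩-⊞ Q P _)))) }
        ; *-cong = λ {P} {P′} {Q} {Q′} p q → pairing≈ (λ ψ →
            trans (⟨⟩-⊠ P Q ψ) (trans (⟨⟩-cong P (λ m → pair q _)) (trans (pair p _) (sym (⟨⟩-⊠ P′ Q′ ψ)))))
        ; *-assoc = λ P Q S → pairing≈ (λ ψ → begin
            ⟨ (P ⊠ Q) ⊠ S , ψ ⟩
              ≈⟨ ⟨⟩-⊠ (P ⊠ Q) S ψ ⟩
            ⟨ P ⊠ Q , (λ m → ⟨ S , (λ n → ψ (m ∙ n)) ⟩) ⟩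
              ≈⟨ ⟨⟩-⊠ P Q _ ⟩
            ⟨ P , (λ a → ⟨ Q , (λ b → ⟨ S , (λ n → ψ ((a ∙ b) ∙ n)) ⟩) ⟩) ⟩
              ≈⟨ ⟨⟩-cong P (λ a → ⟨⟩-cong Q (λ b → ⟨⟩-cong S (λ n → reflexive (≡.cong ψ (CM.assoc a b n))))) ⟩
            ⟨ P , (λ a → ⟨ Q , (λ b → ⟨ S , (λ n → ψ (a ∙ (b ∙ n))) ⟩) ⟩) ⟩
              ≈⟨ ⟨⟩-cong P (λ a → ⟨⟩-⊠ Q S _) ⟨
            ⟨ P , (λ a → ⟨ Q ⊠ S , (λ n → ψ (a ∙ n)) ⟩) ⟩
              ≈⟨ ⟨⟩-⊠ P (Q ⊠ S) ψ ⟨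
            ⟨ P ⊠ (Q ⊠ S) , ψ ⟩ ∎)
        ; *-identity = (λ P → pairing≈ (λ ψ → trans (⟨⟩-⊠ (monomial 1# ε) P ψ) (trans (⟨⟩-unit ε (λ n → ⟨ P , (λ m → ψ (n ∙ m)) ⟩))
            (⟨⟩-cong P (λ m → reflexive (≡.cong ψ (CM.identityˡ m)))))))
            , (λ P → pairing≈ (λ ψ → trans (⟨⟩-⊠ P (monomial 1# ε) ψ)
            (⟨⟩-cong P (λ m → trans (⟨⟩-unit ε (λ n → ψ (m ∙ n))) (reflexive (≡.cong ψ (CM.identityʳ m)))))))
        ; distrib = (λ P Q S → pairing≈ (λ ψ → begin
              ⟨ P ⊠ (Q ⊞ S) , ψ ⟩ ≈⟨ ⟨⟩-⊠ P (Q ⊞ S) ψ ⟩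
              ⟨ P , (λ m → ⟨ Q ⊞ S , (λ n → ψ (m ∙ n)) ⟩) ⟩ ≈⟨ ⟨⟩-cong P (λ m → ⟨⟩-⊞ Q S _) ⟩
              ⟨ P , (λ m → ⟨ Q , (λ n → ψ (m ∙ n)) ⟩ + ⟨ S , (λ n → ψ (m ∙ n)) ⟩) ⟩ ≈⟨ ⟨⟩-+ P _ _ ⟩
              _ ≈⟨ +-cong (⟨⟩-⊠ P Q ψ) (⟨⟩-⊠ P S ψ) ⟨
              ⟨ P ⊠ Q , ψ ⟩ + ⟨ P ⊠ S , ψ ⟩ ≈⟨ ⟨⟩-⊞ (P ⊠ Q) (P ⊠ S) _ ⟨
              ⟨ P ⊠ Q ⊞ P ⊠ S , ψ ⟩ ∎))
          , (λ P Q S → pairing≈ (λ ψ → begin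
              ⟨ (Q ⊞ S) ⊠ P , ψ ⟩ ≈⟨ ⟨⟩-⊠ (Q ⊞ S) P ψ ⟩
              ⟨ Q ⊞ S , (λ m → ⟨ P , (λ n → ψ (m ∙ n)) ⟩) ⟩ ≈⟨ ⟨⟩-⊞ Q S _ ⟩
              _ ≈⟨ +-cong (⟨⟩-⊠ Q P ψ) (⟨⟩-⊠ S P ψ) ⟨
              ⟨ Q ⊠ P , ψ ⟩ + ⟨ S ⊠ P , ψ ⟩ ≈⟨ ⟨⟩-⊞ (Q ⊠ P) (S ⊠ P) _ ⟨
              ⟨ Q ⊠ P ⊞ S ⊠ P , ψ ⟩ ∎)) }
      ; *-comm = λ P Q → pairing≈ (λ ψ → begin
          ⟨ P ⊠ Q , ψ ⟩ ≈⟨ ⟨⟩-⊠ P Q ψ ⟩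
          ⟨ P , (λ m → ⟨ Q , (λ n → ψ (m ∙ n)) ⟩) ⟩ ≈⟨ ⟨⟩-swap P Q _ ⟩
          ⟨ Q , (λ n → ⟨ P , (λ m → ψ (m ∙ n)) ⟩) ⟩
            ≈⟨ ⟨⟩-cong Q (λ n → ⟨⟩-cong P (λ m → reflexive (≡.cong ψ (CM.comm m n)))) ⟩
          ⟨ Q , (λ n → ⟨ P , (λ m → ψ (n ∙ m)) ⟩) ⟩ ≈⟨ ⟨⟩-⊠ Q P ψ ⟨
          ⟨ Q ⊠ P , ψ ⟩ ∎)
      }
    }

-- Alternating sums and the Vandermonde determinant.

module AlternatingSums (A : Ring₀) where
  open CommutativeRing A hiding (zero)
  open IntegerSolver A using (solve; _:=_; _:+_; _:*_; _:-_; :-_; con; :1)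

  alternating : ∀ {n} → (Fin n → Carrier) → Carrier
  alternating {zero}  f = 0#
  alternating {suc n} f = f zero - alternating (λ i → f (suc i))

  alternating-cong : ∀ {n} {f g : Fin n → Carrier} → (∀ i → f i ≈ g i) → alternating f ≈ alternating g
  alternating-cong {zero}  p = refl
  alternating-cong {suc n} p = +-cong (p zero) (-‿cong (alternating-cong (λ i → p (suc i))))

  alternating-+ : ∀ {n} (f g : Fin n → Carrier) → alternating (λ i → f i + g i) ≈ alternating f + alternating g
  alternating-+ {zero}  f g = sym (+-identityˡ 0#)
  alternating-+ {suc n} f g = trans (+-congˡ (-‿cong (alternating-+ (λ i → f (suc i)) (λ i → g (suc i)))))
    (solve 4 (λ a b c d → (a :+ b) :- (c :+ d) := (a :- c) :+ (b :- d)) refl _ _ _ _)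

  alternating-* : ∀ {n} c (f : Fin n → Carrier) → alternating (λ i → c * f i) ≈ c * alternating f
  alternating-* {zero}  c f = sym (zeroʳ c)
  alternating-* {suc n} c f = trans (+-congˡ (-‿cong (alternating-* c (λ i → f (suc i)))))
    (solve 3 (λ a b c → c :* a :- c :* b := c :* (a :- b)) refl _ _ c)

module Products (A : Ring₀) where
  open CommutativeRing A hiding (zero)
  open IntegerSolver A using (solve; _:=_; _:+_; _:*_; _:-_; :-_; con; :1)
  open AlternatingSums A
  open Relation.Binary.Reasoning.Setoid setoid

  infixr 8 _^_
  _^_ : Carrier → ℕ → Carrier
  x ^ zero  = 1#
  x ^ suc n = x * x ^ n

  ∏ : ∀ {n} {I : Set} → (I → Carrier) → Vec I n → Carrier
  ∏ f []       = 1#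
  ∏ f (x ∷ xs) = f x * ∏ f xs

  pairProduct : ∀ {n} → (Carrier → Carrier → Carrier) → Vec Carrier n → Carrier
  pairProduct f []       = 1#
  pairProduct f (x ∷ xs) = ∏ (f x) xs * pairProduct f xs

  ∏-cong : ∀ {n} {f g : Carrier → Carrier} {xs ys : Vec Carrier n} → (∀ {x y} → x ≈ y → f x ≈ g y) →
           Pointwise _≈_ xs ys → ∏ f xs ≈ ∏ g ys
  ∏-cong p []       = refl
  ∏-cong p (q ∷ qs) = *-cong (p q) (∏-cong p qs)

  ∏-* : ∀ {n} {I : Set} (f g : I → Carrier) (xs : Vec I n) → ∏ (λ x → f x * g x) xs ≈ ∏ f xs * ∏ g xs
  ∏-* f g []       = sym (*-identityˡ 1#)
  ∏-* f g (x ∷ xs) = trans (*-congˡ (∏-* f g xs))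
    (solve 4 (λ a b c d → (a :* b) :* (c :* d) := (a :* c) :* (b :* d)) refl _ _ _ _)

  ∏-map : ∀ {n} {I J : Set} (f : J → Carrier) (h : I → J) (xs : Vec I n) → ∏ f (Vec.map h xs) ≈ ∏ (λ x → f (h x)) xs
  ∏-map f h []       = refl
  ∏-map f h (x ∷ xs) = *-congˡ (∏-map f h xs)

  ∏-removeAt : ∀ {n} (f : Carrier → Carrier) (xs : Vec Carrier (suc n)) i →
               f (lookup xs i) * ∏ f (removeAt xs i) ≈ ∏ f xs
  ∏-removeAt f (x ∷ xs)     zero    = refl
  ∏-removeAt f (x ∷ y ∷ xs) (suc i) = trans
    (solve 3 (λ a b c → a :* (b :* c) := b :* (a :* c)) refl _ _ _)
    (*-congˡ (∏-removeAt f (y ∷ xs) i))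

  pairProduct-cong : ∀ {n} {f : Carrier → Carrier → Carrier} → (∀ {x x′ y y′} → x ≈ x′ → y ≈ y′ → f x y ≈ f x′ y′) →
            {xs ys : Vec Carrier n} → Pointwise _≈_ xs ys → pairProduct f xs ≈ pairProduct f ys
  pairProduct-cong p []       = refl
  pairProduct-cong p (q ∷ qs) = *-cong (∏-cong (p q) qs) (pairProduct-cong p qs)

  pairProduct-* : ∀ {n} (f g : Carrier → Carrier → Carrier) (xs : Vec Carrier n) →
            pairProduct (λ x y → f x y * g x y) xs ≈ pairProduct f xs * pairProduct g xs
  pairProduct-* f g []       = sym (*-identityˡ 1#)
  pairProduct-* f g (x ∷ xs) = trans (*-cong (∏-* (f x) (g x) xs) (pairProduct-* f g xs))
    (solve 4 (λ a b c d → (a :* b) :* (c :* d) := (a :* c) :* (b :* d)) refl _ _ _ _)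

  vandermonde : ∀ {n} → Vec Carrier n → Carrier
  vandermonde = pairProduct _-_

  -- The determinant of the Vandermonde matrix with its last column replaced by (x ^ r).
  expansion : ∀ {n} → ℕ → Vec Carrier (suc n) → Carrier
  expansion r xs = alternating (λ i → lookup xs i ^ r * vandermonde (removeAt xs i))

  private
    without : ∀ {n} → Carrier → Vec Carrier (suc n) → Fin (suc n) → Carrier
    without y xs i = ∏ (_-_ y) (removeAt xs i)

  vandermonde-removeAt : ∀ {n} y (xs : Vec Carrier (suc n)) i →
    vandermonde (removeAt (y ∷ xs) (suc i)) ≈ without y xs i * vandermonde (removeAt xs i)
  vandermonde-removeAt y (x ∷ xs) i = refl

  -- Since x · x ^ r = y · x ^ r - (y - x) · x ^ r, every summand splits in two, and the factor y -
  -- x completes the product over the other entries to the product over all of `xs`.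
  expansion-suc : ∀ {n} r y (xs : Vec Carrier (suc n)) →
    expansion (suc r) (y ∷ xs) ≈ y * expansion r (y ∷ xs) + ∏ (_-_ y) xs * expansion r xs
  expansion-suc r y xs = begin
    (y * y ^ r) * V - alternating (λ i → (x i * x i ^ r) * vandermonde (removeAt (y ∷ xs) (suc i)))
      ≈⟨ +-congˡ (-‿cong (alternating-cong (λ i → trans (*-congˡ {x i * x i ^ r} (vandermonde-removeAt y xs i)) (step i)))) ⟩
    (y * y ^ r) * V - alternating (λ i → y * t i + (- P) * s i)
      ≈⟨ +-congˡ (-‿cong (trans (alternating-+ (λ i → y * t i) (λ i → (- P) * s i)) (+-cong (alternating-* y t) (alternating-* (- P) s)))) ⟩
    (y * y ^ r) * V - (y * alternating t + (- P) * alternating s)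
      ≈⟨ solve 6 (λ y z v t P s → (y :* z) :* v :- (y :* t :+ (:- P) :* s) := y :* (z :* v :- t) :+ P :* s)
           refl y (y ^ r) V (alternating t) P (alternating s) ⟩
    y * (y ^ r * V - alternating t) + P * alternating s
      ≈⟨ +-congʳ (*-congˡ (+-congˡ (-‿cong (alternating-cong (λ i → *-congˡ {x i ^ r} (vandermonde-removeAt y xs i)))))) ⟨
    y * expansion r (y ∷ xs) + P * expansion r xs ∎
    where
    V = vandermonde xs
    P = ∏ (_-_ y) xs
    x = lookup xs
    w : Fin _ → Carrier
    w i = vandermonde (removeAt xs i)
    t s : Fin _ → Carrier
    t i = x i ^ r * (without y xs i * w i)
    s i = x i ^ r * w i
    step : ∀ i → (x i * x i ^ r) * (without y xs i * w i) ≈ y * t i + (- P) * s i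
    step i = begin
      (x i * x i ^ r) * (without y xs i * w i)
        ≈⟨ solve 5 (λ a b c d y → (a :* b) :* (c :* d) := y :* (b :* (c :* d)) :+ (:- ((y :- a) :* c)) :* (b :* d))
             refl (x i) (x i ^ r) (without y xs i) (w i) y ⟩
      y * t i + (- ((y - x i) * without y xs i)) * s i
        ≈⟨ +-congˡ (*-congʳ (-‿cong (∏-removeAt (_-_ y) xs i))) ⟩
      y * t i + (- P) * s i ∎

  -- From y - z = (y - x) - (z - x): each difference fills the gap at x in one of the two products
  -- over the other entries.
  expansion-zero₂ : ∀ {n} y z (xs : Vec Carrier n) →
    expansion 0 (y ∷ z ∷ xs) ≈ ∏ (_-_ z) xs * expansion 0 (y ∷ xs) - ∏ (_-_ y) xs * expansion 0 (z ∷ xs)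
  expansion-zero₂ y z []           = solve 0 (:1 :* (:1 :* :1) :- (:1 :* (:1 :* :1) :- con 0ℤ)
    := :1 :* (:1 :* :1 :- con 0ℤ) :- :1 :* (:1 :* :1 :- con 0ℤ)) refl
  expansion-zero₂ y z xs@(x₀ ∷ xs′) = begin
    1# * (Z * V) - (1# * (Y * V) - alternating (λ i → 1# * (((y - z) * without y xs i) * (without z xs i * w i))))
      ≈⟨ +-congˡ (-‿cong (+-congˡ (-‿cong (trans (alternating-cong step)
           (trans (alternating-+ (λ i → Y * t z i) (λ i → (- Z) * t y i))
             (+-cong (alternating-* Y (t z)) (alternating-* (- Z) (t y)))))))) ⟩
    1# * (Z * V) - (1# * (Y * V) - (Y * a z + (- Z) * a y))
      ≈⟨ solve 5 (λ Y Z V y z → :1 :* (Z :* V) :- (:1 :* (Y :* V) :- (Y :* z :+ (:- Z) :* y))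
            := Z :* (:1 :* V :- y) :- Y :* (:1 :* V :- z)) refl Y Z V (a y) (a z) ⟩
    Z * expansion 0 (y ∷ xs) - Y * expansion 0 (z ∷ xs) ∎
    where
    V = vandermonde xs
    Y = ∏ (_-_ y) xs
    Z = ∏ (_-_ z) xs
    w : Fin _ → Carrier
    w i = vandermonde (removeAt xs i)
    t : Carrier → Fin _ → Carrier
    t y i = 1# * (without y xs i * w i)
    a : Carrier → Carrier
    a y = alternating (t y)
    step : ∀ i → 1# * (((y - z) * without y xs i) * (without z xs i * w i))
            ≈ Y * t z i + (- Z) * t y i
    step i = trans
      (solve 6 (λ y z x p q w → :1 :* (((y :- z) :* p) :* (q :* w))
          := ((y :- x) :* p) :* (:1 :* (q :* w)) :+ (:- ((z :- x) :* q)) :* (:1 :* (p :* w)))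
        refl y z (lookup xs i) (without y xs i) (without z xs i) (w i))
      (+-cong (*-congʳ (∏-removeAt (_-_ y) xs i)) (*-congʳ (-‿cong (∏-removeAt (_-_ z) xs i))))

  expansion-zero : ∀ {n} (xs : Vec Carrier (suc (suc n))) → expansion 0 xs ≈ 0#
  expansion-zero (y ∷ z ∷ [])     = solve 0 (:1 :* (:1 :* :1) :- (:1 :* (:1 :* :1) :- con 0ℤ) := con 0ℤ) refl
  expansion-zero (y ∷ z ∷ x ∷ xs) = trans (expansion-zero₂ y z (x ∷ xs))
    (trans (+-cong (*-congˡ (expansion-zero (y ∷ x ∷ xs))) (-‿cong (*-congˡ (expansion-zero (z ∷ x ∷ xs)))))
      (solve 2 (λ a b → a :* con 0ℤ :- b :* con 0ℤ := con 0ℤ) refl _ _))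

  -- For r < n the column (x ^ r) occurs twice in the matrix. The two recursions above take the
  -- place of a theory of determinants.
  expansion-low : ∀ {n} r (xs : Vec Carrier (suc n)) → r ℕ.< n → expansion r xs ≈ 0#
  expansion-low zero    (y ∷ x ∷ xs) _           = expansion-zero (y ∷ x ∷ xs)
  expansion-low (suc r) (y ∷ x ∷ xs) (ℕ.s≤s r<n) = trans (expansion-suc r y (x ∷ xs))
    (trans (+-cong (*-congˡ (expansion-low r (y ∷ x ∷ xs) (ℕₚ.m<n⇒m<1+n r<n))) (*-congˡ (expansion-low r (x ∷ xs) r<n)))
      (solve 2 (λ a b → a :* con 0ℤ :+ b :* con 0ℤ := con 0ℤ) refl _ _))

  -- In `expansion-suc` the first summand has exponent n on n + 2 entries and vanishes; the second
  -- is the recursive formula for the Vandermonde product.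
  laplace : ∀ {n} (xs : Vec Carrier (suc n)) → expansion n xs ≈ vandermonde xs
  laplace (y ∷ [])     = solve 0 (:1 :* :1 :- con 0ℤ := :1 :* :1) refl
  laplace {suc n} (y ∷ x ∷ xs) = trans (expansion-suc n y (x ∷ xs))
    (trans (+-cong (*-congˡ (expansion-low n (y ∷ x ∷ xs) (ℕₚ.n<1+n n))) (*-congˡ (laplace (x ∷ xs))))
      (solve 2 (λ a b → a :* con 0ℤ :+ b := b) refl _ _))

  -- Of the product of all entries, xᵢ joins the power xᵢ ^ n and the other entries stay with the
  -- minor. The exponent suc n is the one that `Λ (suc n)` exhausts.
  ∏*vandermonde : ∀ {n} (xs : Vec Carrier (suc n)) →
    ∏ (λ x → x) xs * vandermonde xs ≈
    alternating (λ i → lookup xs i ^ suc n * (∏ (λ x → x) (removeAt xs i) * vandermonde (removeAt xs i)))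
  ∏*vandermonde {n} xs = begin
    ∏ (λ x → x) xs * vandermonde xs
      ≈⟨ *-congˡ (laplace xs) ⟨
    ∏ (λ x → x) xs * expansion n xs
      ≈⟨ alternating-* (∏ (λ x → x) xs) (λ i → lookup xs i ^ n * vandermonde (removeAt xs i)) ⟨
    alternating (λ i → ∏ (λ x → x) xs * (lookup xs i ^ n * vandermonde (removeAt xs i)))
      ≈⟨ alternating-cong (λ i → trans (*-congʳ (sym (∏-removeAt (λ x → x) xs i)))
           (solve 4 (λ x p q w → (x :* p) :* (q :* w) := (x :* q) :* (p :* w)) refl
             (lookup xs i) (∏ (λ x → x) (removeAt xs i)) (lookup xs i ^ n) (vandermonde (removeAt xs i)))) ⟩
    alternating (λ i → lookup xs i ^ suc n * (∏ (λ x → x) (removeAt xs i) * vandermonde (removeAt xs i))) ∎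

-- The factor attached to a pair of variables.

module PairFactors (A : Ring₀) (u v : CommutativeRing.Carrier A) where
  open CommutativeRing A hiding (zero)
  open IntegerSolver A using (solve; _:=_; _:+_; _:*_; _:-_; :-_; con; :1)
  open Products A
  open Relation.Binary.Reasoning.Setoid setoid

  q pairFactor′ : Carrier → Carrier → Carrier
  q x y = 1# + (1# - v) * x + u * (y + x * y)
  pairFactor′ x y = (x - y) * q x y

  q-cong : ∀ {x x′ y y′} → x ≈ x′ → y ≈ y′ → q x y ≈ q x′ y′
  q-cong p r = +-cong (+-congˡ (*-congˡ p)) (*-congˡ (+-cong r (*-cong p r)))

  pairFactor′-cong : ∀ {x x′ y y′} → x ≈ x′ → y ≈ y′ → pairFactor′ x y ≈ pairFactor′ x′ y′
  pairFactor′-cong p r = *-cong (+-cong p (-‿cong r)) (q-cong p r)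

  V : ∀ {n} → Vec Carrier n → Carrier
  V = pairProduct pairFactor′

  V-split : ∀ {n} (xs : Vec Carrier n) → V xs ≈ vandermonde xs * pairProduct q xs
  V-split = pairProduct-* _-_ q

  -- A variable set to 0 leaves 1 + u y for each variable y on its right, the multiplier of `r`;
  -- `q-zeroʳ` gives that of `l` for the variables on its left.
  q-zeroˡ : ∀ y → q 0# y ≈ 1# + u * y
  q-zeroˡ y = solve 3 (λ u v y → :1 :+ (:1 :- v) :* con 0ℤ :+ u :* (y :+ con 0ℤ :* y) := :1 :+ u :* y) refl u v y

  q-zeroʳ : ∀ x → q x 0# ≈ 1# + (1# - v) * x
  q-zeroʳ x = solve 3 (λ u v x → :1 :+ (:1 :- v) :* x :+ u :* (con 0ℤ :+ x :* con 0ℤ) := :1 :+ (:1 :- v) :* x) refl u v x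

  -- The extra q y x is the mirror image of the factor q x y inside V. For symmetric S, everything
  -- on the right except x - y is therefore invariant under the exchange of x and y.
  antisymmetric-part : ∀ {n} S x y (zs : Vec Carrier n) →
    q y x * (S * V (x ∷ y ∷ zs))
    ≈ (x - y) * ((q y x * q x y) * ((∏ (pairFactor′ x) zs * ∏ (pairFactor′ y) zs) * (V zs * S)))
  antisymmetric-part S x y zs =
    solve 8 (λ a b x y p r w s → a :* (s :* ((((x :- y) :* b) :* p) :* (r :* w)))
            := (x :- y) :* ((a :* b) :* ((p :* r) :* (w :* s))))
      refl (q y x) (q x y) x y (∏ (pairFactor′ x) zs) (∏ (pairFactor′ y) zs) (V zs) S

  affine : ∀ {n} → Vec Carrier n → Vec Carrier n → Carrier
  affine []       []       = 1#
  affine (c ∷ cs) (y ∷ ys) = (1# + c * y) * affine cs ys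

  slopes : ∀ {n} → Fin (suc n) → Vec Carrier n
  slopes {n}     zero    = replicate n u
  slopes {suc n} (suc i) = (1# - v) ∷ slopes i

  pairProduct-q-insert-zero : ∀ {n} (ys : Vec Carrier n) i →
    pairProduct q (insertAt ys i 0#) ≈ affine (slopes i) ys * pairProduct q ys
  pairProduct-q-insert-zero ys zero = *-congʳ (go ys)
    where
    go : ∀ {n} (ys : Vec Carrier n) → ∏ (q 0#) ys ≈ affine (replicate n u) ys
    go []       = refl
    go (y ∷ ys) = *-cong (q-zeroˡ y) (go ys)
  pairProduct-q-insert-zero (y ∷ ys) (suc i) =
    trans (*-cong (go ys i) (pairProduct-q-insert-zero ys i))
      (solve 4 (λ a b c d → (a :* b) :* (c :* d) := (a :* c) :* (b :* d)) refl _ _ _ _)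
    where
    go : ∀ {n} (ys : Vec Carrier n) i → ∏ (q y) (insertAt ys i 0#) ≈ (1# + (1# - v) * y) * ∏ (q y) ys
    go ys       zero    = *-congʳ (q-zeroʳ y)
    go (z ∷ ys) (suc i) = trans (*-congˡ (go ys i)) (solve 3 (λ a b c → a :* (b :* c) := b :* (a :* c)) refl _ _ _)

-- Exponent vectors, polynomial algebras and their homomorphisms.

swapAt : ∀ {A : Set} {n} → ℕ → Vec A n → Vec A n
swapAt zero    (x ∷ y ∷ xs) = y ∷ x ∷ xs
swapAt zero    xs           = xs
swapAt (suc p) []           = []
swapAt (suc p) (x ∷ xs)     = x ∷ swapAt p xs

swapAt-map : ∀ {A B : Set} {n} (f : A → B) p (xs : Vec A n) → swapAt p (Vec.map f xs) ≡ Vec.map f (swapAt p xs)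
swapAt-map f zero    []           = ≡.refl
swapAt-map f zero    (x ∷ [])     = ≡.refl
swapAt-map f zero    (x ∷ y ∷ xs) = ≡.refl
swapAt-map f (suc p) []           = ≡.refl
swapAt-map f (suc p) (x ∷ xs)     = ≡.cong (f x ∷_) (swapAt-map f p xs)

swapAt-zipWith : ∀ {A : Set} {n} (f : A → A → A) p (xs ys : Vec A n) →
            swapAt p (zipWith f xs ys) ≡ zipWith f (swapAt p xs) (swapAt p ys)
swapAt-zipWith f zero    []           []           = ≡.refl
swapAt-zipWith f zero    (x ∷ [])     (y ∷ [])     = ≡.refl
swapAt-zipWith f zero    (x ∷ _ ∷ xs) (y ∷ _ ∷ ys) = ≡.refl
swapAt-zipWith f (suc p) []           []           = ≡.refl
swapAt-zipWith f (suc p) (x ∷ xs)     (y ∷ ys)     = ≡.cong (f x y ∷_) (swapAt-zipWith f p xs ys)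

swapAt-replicate : ∀ {A : Set} n p (x : A) → swapAt p (replicate n x) ≡ replicate n x
swapAt-replicate zero          zero    x = ≡.refl
swapAt-replicate (suc zero)    zero    x = ≡.refl
swapAt-replicate (suc (suc n)) zero    x = ≡.refl
swapAt-replicate zero          (suc p) x = ≡.refl
swapAt-replicate (suc n)       (suc p) x = ≡.cong (x ∷_) (swapAt-replicate n p x)

removeAt-zipWith : ∀ {A : Set} {n} (f : A → A → A) (xs ys : Vec A (suc n)) i →
            removeAt (zipWith f xs ys) i ≡ zipWith f (removeAt xs i) (removeAt ys i)
removeAt-zipWith f (x ∷ xs)      (y ∷ ys)      zero    = ≡.refl
removeAt-zipWith f (x ∷ x′ ∷ xs) (y ∷ y′ ∷ ys) (suc i) = ≡.cong (f x y ∷_) (removeAt-zipWith f (x′ ∷ xs) (y′ ∷ ys) i)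

removeAt-replicate : ∀ {A : Set} {n} (x : A) i → removeAt (replicate (suc n) x) i ≡ replicate n x
removeAt-replicate             x zero    = ≡.refl
removeAt-replicate {n = suc n} x (suc i) = ≡.cong (x ∷_) (removeAt-replicate x i)

removeAt-Pointwise : ∀ {A : Set} {_∼_ : A → A → Set} {n} {xs ys : Vec A (suc n)} i →
            Pointwise _∼_ xs ys → Pointwise _∼_ (removeAt xs i) (removeAt ys i)
removeAt-Pointwise zero    (p ∷ ps)     = ps
removeAt-Pointwise (suc i) (p ∷ q ∷ ps) = p ∷ removeAt-Pointwise i (q ∷ ps)

removeAt-map : ∀ {A B : Set} {n} (f : A → B) (xs : Vec A (suc n)) i →
               removeAt (Vec.map f xs) i ≡ Vec.map f (removeAt xs i)
removeAt-map f (x ∷ xs)     zero    = ≡.refl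
removeAt-map f (x ∷ y ∷ xs) (suc i) = ≡.cong (f x ∷_) (removeAt-map f (y ∷ xs) i)

exponents : ∀ n → IsCommutativeMonoid _≡_ (zipWith {n = n} ℕ._+_) (replicate n 0)
exponents n = record
  { isMonoid = record
    { isSemigroup = record
      { isMagma = record { isEquivalence = ≡.isEquivalence ; ∙-cong = ≡.cong₂ _ }
      ; assoc = Vecₚ.zipWith-assoc ℕₚ.+-assoc }
    ; identity = Vecₚ.zipWith-identityˡ ℕₚ.+-identityˡ , Vecₚ.zipWith-identityʳ ℕₚ.+-identityʳ }
  ; comm = Vecₚ.zipWith-comm ℕₚ.+-comm }

module Polynomials (K : Ring₀) where
  open CommutativeRing K hiding (zero)
  open Relation.Binary.Reasoning.Setoid setoid
  open Sums K
  module MA {n : ℕ} = MonoidAlgebra K (exponents n)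
  open MA public using (_≋_; pairing≈; pair; monomial; ⟨⟩-⊞; ⟨⟩-⊠; ⟨⟩-scale; ⟨⟩-monomial; ⟨⟩-unit; scale)

  Poly : ℕ → Ring₀
  Poly n = MA.algebra {n}

  Comb : ℕ → Set
  Comb n = MA.Comb {n}

  module P {n : ℕ} = CommutativeRing (Poly n)
  module Π {n : ℕ} = Products (Poly n)
  open P public using () renaming (_+_ to _+′_; _*_ to _*′_; _-_ to _-′_; 1# to 1′; 0# to 0′; -_ to -′_;
    refl to ≋-refl; sym to ≋-sym; trans to ≋-trans; +-cong to +′-cong; *-cong to *′-cong; -‿cong to -′-cong;
    *-assoc to *′-assoc; *-comm to *′-comm; *-identityˡ to *′-identityˡ; *-congˡ to *′-congˡ; *-congʳ to *′-congʳ;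
    +-congˡ to +′-congˡ)

  infixl 6 _+ᵉ_
  _+ᵉ_ : ∀ {n} → Vec ℕ n → Vec ℕ n → Vec ℕ n
  _+ᵉ_ = zipWith ℕ._+_

  const : ∀ {n} → Carrier → Comb n
  const {n} c = monomial c (replicate n 0)

  x₀ : ∀ {n} → Comb (suc n)
  x₀ {n} = monomial 1# (1 ∷ replicate n 0)

  monomial-cong : ∀ {n c c′} {m m′ : Vec ℕ n} → c ≈ c′ → m ≡ m′ → monomial c m ≋ monomial c′ m′
  monomial-cong {m = m} p ≡.refl = pairing≈ (λ ψ → trans (⟨⟩-monomial _ m ψ) (trans (*-congʳ p) (sym (⟨⟩-monomial _ m ψ))))

  opaque
    unfolding ⟨_,_⟩

    -- A weighted change of exponents. It covers the renaming of variables (weight 1), the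
    -- substitution of 0 (the weight tests for exponent 0) and the extraction of a coefficient (the
    -- weight is read from a power series).
    transport : ∀ {n n′} → (Vec ℕ n → Carrier) → (Vec ℕ n → Vec ℕ n′) → Comb n → Comb n′
    transport θ π = List.map (λ { (c , m) → c * θ m , π m })

    ⟨⟩-transport : ∀ {n n′} θ (π : Vec ℕ n → Vec ℕ n′) P ψ → ⟨ transport θ π P , ψ ⟩ ≈ ⟨ P , (λ m → θ m * ψ (π m)) ⟩
    ⟨⟩-transport θ π P ψ = trans (∑-map _ P _) (∑-cong P (λ { (c , m) → *-assoc c _ _ }))

  transport-monomial : ∀ {n n′} θ (π : Vec ℕ n → Vec ℕ n′) c m → transport θ π (monomial c m) ≋ monomial (c * θ m) (π m)
  transport-monomial θ π c m = pairing≈ (λ ψ → begin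
    ⟨ transport θ π (monomial c m) , ψ ⟩ ≈⟨ ⟨⟩-transport θ π (monomial c m) ψ ⟩
    ⟨ monomial c m , (λ m → θ m * ψ (π m)) ⟩ ≈⟨ ⟨⟩-monomial c m _ ⟩
    c * (θ m * ψ (π m)) ≈⟨ *-assoc _ _ _ ⟨
    c * θ m * ψ (π m) ≈⟨ ⟨⟩-monomial (c * θ m) (π m) ψ ⟨
    ⟨ monomial (c * θ m) (π m) , ψ ⟩ ∎)

  transport-cong : ∀ {n n′} θ (π : Vec ℕ n → Vec ℕ n′) {P Q} → P ≋ Q → transport θ π P ≋ transport θ π Q
  transport-cong θ π {P} {Q} p = pairing≈ (λ ψ → trans (⟨⟩-transport θ π P ψ) (trans (pair p _) (sym (⟨⟩-transport θ π Q ψ))))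

  record AlgebraHom (n n′ : ℕ) : Set where
    field
      ⟦_⟧        : Comb n → Comb n′
      cong       : ∀ {P Q} → P ≋ Q → ⟦ P ⟧ ≋ ⟦ Q ⟧
      +-homo     : ∀ P Q → ⟦ P +′ Q ⟧ ≋ ⟦ P ⟧ +′ ⟦ Q ⟧
      *-homo     : ∀ P Q → ⟦ P *′ Q ⟧ ≋ ⟦ P ⟧ *′ ⟦ Q ⟧
      neg-homo   : ∀ P → ⟦ -′ P ⟧ ≋ -′ ⟦ P ⟧
      const-homo : ∀ c → ⟦ const c ⟧ ≋ const c

  -- Extracting a coefficient is not of this kind, as its weight is not multiplicative;
  -- `contract-lift` is what remains of multiplicativity there.
  transportHom : ∀ {n n′} (θ : Vec ℕ n → Carrier) (π : Vec ℕ n → Vec ℕ n′) →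
    θ (replicate n 0) ≈ 1# → (∀ a b → θ (a +ᵉ b) ≈ θ a * θ b) →
    π (replicate n 0) ≡ replicate n′ 0 → (∀ a b → π (a +ᵉ b) ≡ π a +ᵉ π b) → AlgebraHom n n′
  transportHom {n} {n′} θ π θ-ε θ-∙ π-ε π-∙ = record
    { ⟦_⟧ = transport θ π
    ; cong = transport-cong θ π
    ; +-homo = λ P Q → pairing≈ (λ ψ → begin
        ⟨ transport θ π (P +′ Q) , ψ ⟩ ≈⟨ ⟨⟩-transport θ π (P +′ Q) ψ ⟩
        ⟨ P +′ Q , (λ m → θ m * ψ (π m)) ⟩ ≈⟨ ⟨⟩-⊞ P Q _ ⟩
        _ ≈⟨ +-cong (⟨⟩-transport θ π P ψ) (⟨⟩-transport θ π Q ψ) ⟨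
        _ ≈⟨ ⟨⟩-⊞ (transport θ π P) (transport θ π Q) _ ⟨
        ⟨ transport θ π P +′ transport θ π Q , ψ ⟩ ∎)
    ; *-homo = λ P Q → pairing≈ (λ ψ → begin
        ⟨ transport θ π (P *′ Q) , ψ ⟩ ≈⟨ ⟨⟩-transport θ π (P *′ Q) ψ ⟩
        ⟨ P *′ Q , (λ m → θ m * ψ (π m)) ⟩ ≈⟨ ⟨⟩-⊠ P Q _ ⟩
        ⟨ P , (λ a → ⟨ Q , (λ b → θ (a +ᵉ b) * ψ (π (a +ᵉ b))) ⟩) ⟩
          ≈⟨ ⟨⟩-cong P (λ a → ⟨⟩-cong Q (λ b → trans (*-cong (θ-∙ a b) (reflexive (≡.cong ψ (π-∙ a b)))) (*-assoc _ _ _))) ⟩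
        ⟨ P , (λ a → ⟨ Q , (λ b → θ a * (θ b * ψ (π a +ᵉ π b))) ⟩) ⟩
          ≈⟨ ⟨⟩-cong P (λ a → ⟨⟩-* Q (θ a) _) ⟩
        ⟨ P , (λ a → θ a * ⟨ Q , (λ b → θ b * ψ (π a +ᵉ π b)) ⟩) ⟩
          ≈⟨ ⟨⟩-cong P (λ a → *-congˡ (⟨⟩-transport θ π Q _)) ⟨
        ⟨ P , (λ a → θ a * ⟨ transport θ π Q , (λ b → ψ (π a +ᵉ b)) ⟩) ⟩
          ≈⟨ ⟨⟩-transport θ π P _ ⟨
        _ ≈⟨ ⟨⟩-⊠ (transport θ π P) (transport θ π Q) ψ ⟨
        ⟨ transport θ π P *′ transport θ π Q , ψ ⟩ ∎)
    ; neg-homo = λ P → pairing≈ (λ ψ → begin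
        ⟨ transport θ π (scale (- 1#) P) , ψ ⟩ ≈⟨ ⟨⟩-transport θ π (scale (- 1#) P) ψ ⟩
        ⟨ scale (- 1#) P , (λ m → θ m * ψ (π m)) ⟩ ≈⟨ ⟨⟩-scale (- 1#) P _ ⟩
        - 1# * ⟨ P , (λ m → θ m * ψ (π m)) ⟩ ≈⟨ *-congˡ (⟨⟩-transport θ π P ψ) ⟨
        _ ≈⟨ ⟨⟩-scale (- 1#) (transport θ π P) ψ ⟨
        ⟨ scale (- 1#) (transport θ π P) , ψ ⟩ ∎)
    ; const-homo = λ c → ≋-trans (transport-monomial θ π c (replicate n 0)) (monomial-cong (trans (*-congˡ θ-ε) (*-identityʳ c)) π-ε) }

  module HomProperties (u v : Carrier) {n n′} (h : AlgebraHom n n′) where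
    open AlgebraHom h
    private
      module F = PairFactors (Poly n) (const u) (const v)
      module G = PairFactors (Poly n′) (const u) (const v)

    minus-homo : ∀ P Q → ⟦ P -′ Q ⟧ ≋ ⟦ P ⟧ -′ ⟦ Q ⟧
    minus-homo P Q = ≋-trans (+-homo P (-′ Q)) (+′-congˡ {x = ⟦ P ⟧} (neg-homo Q))

    ∏-homo : ∀ {k} {f : Comb n → Comb n} {g : Comb n′ → Comb n′} (xs : Vec (Comb n) k) →
             (∀ x → ⟦ f x ⟧ ≋ g ⟦ x ⟧) → ⟦ Π.∏ f xs ⟧ ≋ Π.∏ g (Vec.map ⟦_⟧ xs)
    ∏-homo []       p = const-homo 1#
    ∏-homo {f = f} (x ∷ xs) p = ≋-trans (*-homo (f x) (Π.∏ f xs)) (*′-cong (p x) (∏-homo xs p))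

    pairProduct-homo : ∀ {k} {f : Comb n → Comb n → Comb n} {g : Comb n′ → Comb n′ → Comb n′} (xs : Vec (Comb n) k) →
      (∀ x y → ⟦ f x y ⟧ ≋ g ⟦ x ⟧ ⟦ y ⟧) → ⟦ Π.pairProduct f xs ⟧ ≋ Π.pairProduct g (Vec.map ⟦_⟧ xs)
    pairProduct-homo []       p = const-homo 1#
    pairProduct-homo {f = f} (x ∷ xs) p =
      ≋-trans (*-homo (Π.∏ (f x) xs) (Π.pairProduct f xs)) (*′-cong (∏-homo xs (p x)) (pairProduct-homo xs p))

    ^-homo : ∀ x k → ⟦ x Π.^ k ⟧ ≋ ⟦ x ⟧ Π.^ k
    ^-homo x zero    = const-homo 1#
    ^-homo x (suc k) = ≋-trans (*-homo x (x Π.^ k)) (*′-congˡ {x = ⟦ x ⟧} (^-homo x k))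

    q-homo : ∀ x y → ⟦ F.q x y ⟧ ≋ G.q ⟦ x ⟧ ⟦ y ⟧
    q-homo x y = ≋-trans (+-homo _ (const u *′ (y +′ x *′ y))) (+′-cong
      (≋-trans (+-homo 1′ ((1′ -′ const v) *′ x)) (+′-cong (const-homo 1#)
        (≋-trans (*-homo (1′ -′ const v) x) (*′-congʳ (≋-trans (minus-homo 1′ (const v))
          (+′-cong (const-homo 1#) (-′-cong (const-homo v))))))))
      (≋-trans (*-homo (const u) (y +′ x *′ y)) (*′-cong (const-homo u)
        (≋-trans (+-homo y (x *′ y)) (+′-congˡ {x = ⟦ y ⟧} (*-homo x y))))))

    pairFactor′-homo : ∀ x y → ⟦ F.pairFactor′ x y ⟧ ≋ G.pairFactor′ ⟦ x ⟧ ⟦ y ⟧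
    pairFactor′-homo x y = ≋-trans (*-homo (x -′ y) (F.q x y)) (*′-cong (minus-homo x y) (q-homo x y))

-- Substitutions in polynomials and coefficient functionals.

module Coefficients (K : Ring₀) (u v : CommutativeRing.Carrier K) where
  open CommutativeRing K hiding (zero)
  open IntegerSolver K using (solve; _:=_; _:+_; _:*_; _:-_; :-_; con; :1)
  open Relation.Binary.Reasoning.Setoid setoid
  open Sums K
  open AlternatingSums K
  open Polynomials K public
  module F {n} = PairFactors (Poly n) (const u) (const v)
  module Alt {n} = AlternatingSums (Poly n)
  open AlgebraHom using (cong; +-homo; *-homo; const-homo)

  -- A commuting square of exponent maps with matching weights. Commutation rules between lifting,
  -- swapping, evaluation and contraction are squares of this form.
  transport-∘ : ∀ {n n′ n″ k} θ (π : Vec ℕ n → Vec ℕ n′) θ′ (π′ : Vec ℕ n′ → Vec ℕ n″)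
    η (ρ : Vec ℕ n → Vec ℕ k) η′ (ρ′ : Vec ℕ k → Vec ℕ n″) →
    (∀ m → θ m * θ′ (π m) ≈ η m * η′ (ρ m)) → (∀ m → π′ (π m) ≡ ρ′ (ρ m)) →
    ∀ P → transport θ′ π′ (transport θ π P) ≋ transport η′ ρ′ (transport η ρ P)
  transport-∘ θ π θ′ π′ η ρ η′ ρ′ p q P = pairing≈ (λ ψ → begin
    ⟨ transport θ′ π′ (transport θ π P) , ψ ⟩ ≈⟨ ⟨⟩-transport θ′ π′ (transport θ π P) ψ ⟩
    ⟨ transport θ π P , (λ m → θ′ m * ψ (π′ m)) ⟩ ≈⟨ ⟨⟩-transport θ π P _ ⟩
    ⟨ P , (λ m → θ m * (θ′ (π m) * ψ (π′ (π m)))) ⟩ ≈⟨ ⟨⟩-cong P (λ m → trans (sym (*-assoc _ _ _))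
            (trans (*-cong (p m) (reflexive (≡.cong ψ (q m)))) (*-assoc _ _ _))) ⟩
    ⟨ P , (λ m → η m * (η′ (ρ m) * ψ (ρ′ (ρ m)))) ⟩ ≈⟨ ⟨⟩-transport η ρ P _ ⟨
    ⟨ transport η ρ P , (λ m → η′ m * ψ (ρ′ m)) ⟩ ≈⟨ ⟨⟩-transport η′ ρ′ (transport η ρ P) ψ ⟨
    ⟨ transport η′ ρ′ (transport η ρ P) , ψ ⟩ ∎)

  one : ∀ {n} → Vec ℕ n → Carrier
  one _ = 1#

  liftHom : ∀ {n} → AlgebraHom n (suc n)
  liftHom = transportHom one (0 ∷_) refl (λ _ _ → sym (*-identityˡ 1#)) ≡.refl (λ _ _ → ≡.refl)

  swapHom : ∀ {n} → ℕ → AlgebraHom n n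
  swapHom {n} p = transportHom one (swapAt p) refl (λ _ _ → sym (*-identityˡ 1#))
            (swapAt-replicate n p 0) (swapAt-zipWith ℕ._+_ p)

  isZero : ℕ → Carrier
  isZero zero    = 1#
  isZero (suc _) = 0#

  isZero-+ : ∀ a b → isZero (a ℕ.+ b) ≈ isZero a * isZero b
  isZero-+ zero    b = sym (*-identityˡ _)
  isZero-+ (suc a) b = sym (zeroˡ _)

  vanishAt : ∀ {n} → Fin n → Vec ℕ n → Carrier
  vanishAt i m = isZero (lookup m i)

  remove : ∀ {n} → Fin (suc n) → Vec ℕ (suc n) → Vec ℕ n
  remove i m = removeAt m i

  -- Substitution of 0 for the variable at i: a term survives only if its exponent there is 0, and
  -- the coordinate is then dropped.
  evalHom : ∀ {n} → Fin (suc n) → AlgebraHom (suc n) n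
  evalHom {n} i = transportHom (vanishAt i) (remove i)
    (reflexive (≡.cong isZero (Vecₚ.lookup-replicate i 0)))
    (λ a b → trans (reflexive (≡.cong isZero (Vecₚ.lookup-zipWith ℕ._+_ i a b))) (isZero-+ (lookup a i) (lookup b i)))
    (removeAt-replicate 0 i)
    (λ a b → removeAt-zipWith ℕ._+_ a b i)

  lift : ∀ {n} → Comb n → Comb (suc n)
  lift = AlgebraHom.⟦_⟧ liftHom

  swap : ∀ {n} → ℕ → Comb n → Comb n
  swap p = AlgebraHom.⟦_⟧ (swapHom p)

  eval : ∀ {n} → Fin (suc n) → Comb (suc n) → Comb n
  eval i = AlgebraHom.⟦_⟧ (evalHom i)

  vars : ∀ n → Vec (Comb n) n
  vars zero    = []
  vars (suc n) = x₀ ∷ Vec.map lift (vars n)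

  swap-x₀ : ∀ {n} → swap zero (x₀ {suc n}) ≋ lift x₀
  swap-x₀ {n} = ≋-trans (transport-monomial one (swapAt zero) 1# (1 ∷ 0 ∷ replicate n 0))
    (≋-sym (transport-monomial one (0 ∷_) 1# (1 ∷ replicate n 0)))

  swap-lift-x₀ : ∀ {n} → swap zero (lift (x₀ {n})) ≋ x₀
  swap-lift-x₀ {n} = ≋-trans (cong (swapHom zero) (transport-monomial one (0 ∷_) 1# (1 ∷ replicate n 0)))
    (≋-trans (transport-monomial one (swapAt zero) _ (0 ∷ 1 ∷ replicate n 0))
      (monomial-cong (trans (*-identityʳ _) (*-identityʳ _)) ≡.refl))

  swap-lift-lift : ∀ {n} (P : Comb n) → swap zero (lift (lift P)) ≋ lift (lift P)
  swap-lift-lift P = pairing≈ (λ ψ → begin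
    ⟨ swap zero (lift (lift P)) , ψ ⟩ ≈⟨ ⟨⟩-transport one (swapAt zero) (lift (lift P)) ψ ⟩
    _ ≈⟨ ⟨⟩-transport one (0 ∷_) (lift P) _ ⟩
    _ ≈⟨ ⟨⟩-transport one (0 ∷_) P _ ⟩
    _ ≈⟨ ⟨⟩-cong P (λ m → *-congˡ (*-congˡ (*-identityˡ (ψ (0 ∷ 0 ∷ m))))) ⟩
    _ ≈⟨ ⟨⟩-transport one (0 ∷_) P _ ⟨
    _ ≈⟨ ⟨⟩-transport one (0 ∷_) (lift P) ψ ⟨
    ⟨ lift (lift P) , ψ ⟩ ∎)

  swap-suc-x₀ : ∀ {n} p → swap (suc p) (x₀ {n}) ≋ x₀
  swap-suc-x₀ {n} p = ≋-trans (transport-monomial one (swapAt (suc p)) 1# (1 ∷ replicate n 0)) (monomial-cong (*-identityʳ _) (≡.cong (1 ∷_) (swapAt-replicate n p 0)))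

  swap-suc-lift : ∀ {n} p (P : Comb n) → swap (suc p) (lift P) ≋ lift (swap p P)
  swap-suc-lift p = transport-∘ one (0 ∷_) one (swapAt (suc p)) one (swapAt p) one (0 ∷_) (λ _ → refl) (λ _ → ≡.refl)

  eval-zero-x₀ : ∀ {n} → eval zero (x₀ {n}) ≋ 0′
  eval-zero-x₀ {n} = ≋-trans (transport-monomial (vanishAt zero) (remove zero) 1# (1 ∷ replicate n 0))
    (pairing≈ (λ ψ → trans (⟨⟩-monomial _ _ ψ) (trans (trans (*-congʳ (zeroʳ 1#)) (zeroˡ _)) (sym (MA.⟨⟩-none ψ)))))

  eval-zero-lift : ∀ {n} (P : Comb n) → eval zero (lift P) ≋ P
  eval-zero-lift P = pairing≈ (λ ψ → begin
    ⟨ eval zero (lift P) , ψ ⟩ ≈⟨ ⟨⟩-transport (vanishAt zero) (remove zero) (lift P) ψ ⟩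
    _ ≈⟨ ⟨⟩-transport one (0 ∷_) P _ ⟩
    _ ≈⟨ ⟨⟩-cong P (λ m → trans (*-identityˡ _) (*-identityˡ (ψ m))) ⟩
    ⟨ P , ψ ⟩ ∎)

  eval-suc-x₀ : ∀ {n} (i : Fin (suc n)) → eval (suc i) (x₀ {suc n}) ≋ x₀
  eval-suc-x₀ {n} i = ≋-trans (transport-monomial (vanishAt (suc i)) (remove (suc i)) 1# (1 ∷ replicate (suc n) 0)) (monomial-cong (trans (*-identityˡ _) (reflexive (≡.cong isZero (Vecₚ.lookup-replicate i 0))))
            (≡.cong (1 ∷_) (removeAt-replicate 0 i)))

  remove-cons : ∀ {n} i a (m : Vec ℕ (suc n)) → remove (suc i) (a ∷ m) ≡ a ∷ remove i m
  remove-cons i a (b ∷ m) = ≡.refl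

  eval-suc-lift : ∀ {n} i (P : Comb (suc n)) → eval (suc i) (lift P) ≋ lift (eval i P)
  eval-suc-lift i = transport-∘ one (0 ∷_) (vanishAt (suc i)) (remove (suc i)) (vanishAt i) (remove i) one (0 ∷_)
    (λ m → *-comm _ _) (remove-cons i 0)

  map-≋ : ∀ {n n′ k} {f g : Comb n → Comb n′} (xs : Vec (Comb n) k) → (∀ P → f P ≋ g P) →
          Pointwise _≋_ (Vec.map f xs) (Vec.map g xs)
  map-≋ []       p = []
  map-≋ (x ∷ xs) p = p x ∷ map-≋ xs p

  map-cong-≋ : ∀ {n n′ k} {f : Comb n → Comb n′} {xs ys : Vec (Comb n) k} → (∀ {P Q} → P ≋ Q → f P ≋ f Q) →
          Pointwise _≋_ xs ys → Pointwise _≋_ (Vec.map f xs) (Vec.map f ys)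
  map-cong-≋ p []       = []
  map-cong-≋ p (q ∷ qs) = p q ∷ map-cong-≋ p qs

  pw-refl : ∀ {n k} {xs : Vec (Comb n) k} → Pointwise _≋_ xs xs
  pw-refl = PW.refl ≋-refl

  pw-trans : ∀ {n k} {xs ys zs : Vec (Comb n) k} → Pointwise _≋_ xs ys → Pointwise _≋_ ys zs → Pointwise _≋_ xs zs
  pw-trans = PW.trans ≋-trans

  pw-≡ : ∀ {n k} {xs ys : Vec (Comb n) k} → xs ≡ ys → Pointwise _≋_ xs ys
  pw-≡ ≡.refl = pw-refl

  pw-insertAt : ∀ {n k} {P Q : Comb n} (xs : Vec (Comb n) k) i → P ≋ Q → Pointwise _≋_ (insertAt xs i P) (insertAt xs i Q)
  pw-insertAt xs       zero    p = p ∷ pw-refl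
  pw-insertAt (x ∷ xs) (suc i) p = ≋-refl ∷ pw-insertAt xs i p

  lift-zero : ∀ {n} → lift (0′ {n}) ≋ 0′
  lift-zero = pairing≈ (λ ψ → trans (⟨⟩-transport one (0 ∷_) 0′ ψ) (trans (MA.⟨⟩-none _) (sym (MA.⟨⟩-none ψ))))

  swap-vars : ∀ n p → Pointwise _≋_ (Vec.map (swap p) (vars n)) (swapAt p (vars n))
  swap-vars zero          zero    = []
  swap-vars zero          (suc p) = []
  swap-vars (suc zero)    zero    =
    ≋-trans (transport-monomial one (swapAt zero) 1# (1 ∷ [])) (monomial-cong (*-identityʳ _) ≡.refl) ∷ []
  swap-vars (suc (suc n)) zero    = swap-x₀ ∷ swap-lift-x₀ ∷ go (vars n)
    where
    go : ∀ {k} (xs : Vec (Comb n) k) → Pointwise _≋_ (Vec.map (swap zero) (Vec.map lift (Vec.map lift xs))) (Vec.map lift (Vec.map lift xs))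
    go []       = []
    go (x ∷ xs) = swap-lift-lift x ∷ go xs
  swap-vars (suc n)       (suc p) = swap-suc-x₀ p ∷
    pw-trans (pw-≡ (≡.sym (Vecₚ.map-∘ (swap (suc p)) lift (vars n))))
    (pw-trans (map-≋ (vars n) (swap-suc-lift p))
    (pw-trans (pw-≡ (Vecₚ.map-∘ lift (swap p) (vars n)))
    (pw-trans (map-cong-≋ (λ {P} {Q} → cong liftHom {P} {Q}) (swap-vars n p))
    (pw-≡ (≡.sym (swapAt-map lift p (vars n)))))))

  eval-vars : ∀ n i → Pointwise _≋_ (Vec.map (eval i) (vars (suc n))) (insertAt (vars n) i 0′)
  eval-vars n zero = eval-zero-x₀ ∷ pw-trans (pw-≡ (≡.sym (Vecₚ.map-∘ (eval zero) lift (vars n))))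
    (pw-trans (map-≋ (vars n) eval-zero-lift) (pw-≡ (Vecₚ.map-id (vars n))))
  eval-vars (suc n) (suc i) = eval-suc-x₀ i ∷
    pw-trans (pw-≡ (≡.sym (Vecₚ.map-∘ (eval (suc i)) lift (vars (suc n)))))
    (pw-trans (map-≋ (vars (suc n)) (eval-suc-lift i))
    (pw-trans (pw-≡ (Vecₚ.map-∘ lift (eval i) (vars (suc n))))
    (pw-trans (map-cong-≋ (λ {P} {Q} → cong liftHom {P} {Q}) (eval-vars n i))
    (pw-trans (pw-≡ (Vecₚ.map-insertAt lift 0′ (vars n) i)) (pw-insertAt (Vec.map lift (vars n)) i lift-zero)))))

  eval-removeAt-vars : ∀ n i → Pointwise _≋_ (Vec.map (eval i) (removeAt (vars (suc n)) i)) (vars n)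
  eval-removeAt-vars n i = pw-trans (pw-≡ (≡.sym (removeAt-map (eval i) (vars (suc n)) i)))
    (pw-trans (removeAt-Pointwise i (eval-vars n i)) (pw-≡ (Vecₚ.removeAt-insertAt (vars n) i 0′)))

  PowerSeries : Set
  PowerSeries = ℕ → Carrier

  infix 4 _≐_
  _≐_ : PowerSeries → PowerSeries → Set
  g ≐ h = ∀ l → g l ≈ h l

  X : PowerSeries → PowerSeries
  X g zero    = 0#
  X g (suc l) = g l

  infixl 6 _⊕_
  _⊕_ : PowerSeries → PowerSeries → PowerSeries
  (g ⊕ h) l = g l + h l

  infixr 7 _·_
  _·_ : Carrier → PowerSeries → PowerSeries
  (c · g) l = c * g l

  1+_x : Carrier → PowerSeries → PowerSeries
  1+ c x g = g ⊕ c · X g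

  -- The coefficient of x^(N - e), which is 0 for e > N.
  coefficient : ℕ → PowerSeries → ℕ → Carrier
  coefficient N       g zero    = g N
  coefficient zero    g (suc e) = 0#
  coefficient (suc N) g (suc e) = coefficient N g e

  coefficient-X : ∀ N g e → coefficient N (X g) e ≈ coefficient N g (suc e)
  coefficient-X zero    g zero    = refl
  coefficient-X zero    g (suc e) = refl
  coefficient-X (suc N) g zero    = refl
  coefficient-X (suc N) g (suc e) = coefficient-X N g e

  coefficient-≐ : ∀ N {g h} e → g ≐ h → coefficient N g e ≈ coefficient N h e
  coefficient-≐ N       zero    p = p N
  coefficient-≐ zero    (suc e) p = refl
  coefficient-≐ (suc N) (suc e) p = coefficient-≐ N e p

  coefficient-⊕ : ∀ N g h e → coefficient N (g ⊕ h) e ≈ coefficient N g e + coefficient N h e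
  coefficient-⊕ N       g h zero    = refl
  coefficient-⊕ zero    g h (suc e) = sym (+-identityˡ 0#)
  coefficient-⊕ (suc N) g h (suc e) = coefficient-⊕ N g h e

  coefficient-· : ∀ N c g e → coefficient N (c · g) e ≈ c * coefficient N g e
  coefficient-· N       c g zero    = refl
  coefficient-· zero    c g (suc e) = sym (zeroʳ c)
  coefficient-· (suc N) c g (suc e) = coefficient-· N c g e

  coefficient-full : ∀ N g e → coefficient N g (N ℕ.+ e) ≈ g 0 * isZero e
  coefficient-full zero    g zero    = sym (*-identityʳ _)
  coefficient-full zero    g (suc e) = sym (zeroʳ _)
  coefficient-full (suc N) g e       = coefficient-full N g e

  coefficients : ∀ {n} → ℕ → Vec PowerSeries n → Vec ℕ n → Carrier
  coefficients N []       m = 1#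
  coefficients N (g ∷ gs) m = coefficient N g (head m) * coefficients N gs (tail m)

  -- The coefficient of (x₁ ⋯ xₙ)^N in P(x₁, …, xₙ) g₁(x₁) ⋯ gₙ(xₙ).
  Λ : ∀ {n} → ℕ → Vec PowerSeries n → Comb n → Carrier
  Λ N gs P = ⟨ P , coefficients N gs ⟩

  coefficientAtHead : ∀ {n} → ℕ → PowerSeries → Vec ℕ (suc n) → Carrier
  coefficientAtHead N g m = coefficient N g (head m)

  -- Eliminates the first variable by taking the coefficient of its N-th power after multiplication
  -- by g, so that `Λ` can be computed one slot at a time.
  contract : ∀ {n} → ℕ → PowerSeries → Comb (suc n) → Comb n
  contract N g = transport (coefficientAtHead N g) tail

  Λ-cong : ∀ {n} N (gs : Vec PowerSeries n) {P Q} → P ≋ Q → Λ N gs P ≈ Λ N gs Q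
  Λ-cong N gs p = pair p _

  Λ-+ : ∀ {n} N (gs : Vec PowerSeries n) P Q → Λ N gs (P +′ Q) ≈ Λ N gs P + Λ N gs Q
  Λ-+ N gs P Q = ⟨⟩-⊞ P Q _

  Λ-neg : ∀ {n} N (gs : Vec PowerSeries n) P → Λ N gs (-′ P) ≈ - Λ N gs P
  Λ-neg N gs P = trans (⟨⟩-scale (- 1#) P _) (solve 1 (λ a → (:- :1) :* a := :- a) refl _)

  Λ-contract : ∀ {n} N g (gs : Vec PowerSeries n) P → Λ N (g ∷ gs) P ≈ Λ N gs (contract N g P)
  Λ-contract N g gs P = sym (⟨⟩-transport (coefficientAtHead N g) tail P _)

  contract-cong : ∀ {n} N g {P Q : Comb (suc n)} → P ≋ Q → contract N g P ≋ contract N g Q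
  contract-cong N g {P} {Q} = transport-cong _ _ {P} {Q}

  ⟨⟩-lift-* : ∀ {n} (P : Comb n) Q ψ → ⟨ lift P *′ Q , ψ ⟩ ≈ ⟨ Q , (λ m → ⟨ P , (λ a → ψ (head m ∷ (a +ᵉ tail m))) ⟩) ⟩
  ⟨⟩-lift-* P Q ψ = begin
    ⟨ lift P *′ Q , ψ ⟩ ≈⟨ ⟨⟩-⊠ (lift P) Q ψ ⟩
    _ ≈⟨ ⟨⟩-transport one (0 ∷_) P _ ⟩
    _ ≈⟨ ⟨⟩-cong P (λ a → *-identityˡ _) ⟩
    ⟨ P , (λ a → ⟨ Q , (λ m → ψ ((0 ∷ a) +ᵉ m)) ⟩) ⟩ ≈⟨ ⟨⟩-swap P Q _ ⟩
    ⟨ Q , (λ m → ⟨ P , (λ a → ψ ((0 ∷ a) +ᵉ m)) ⟩) ⟩ ≈⟨ ⟨⟩-cong Q (λ { (e ∷ m) → refl }) ⟩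
    ⟨ Q , (λ m → ⟨ P , (λ a → ψ (head m ∷ (a +ᵉ tail m))) ⟩) ⟩ ∎

  -- A factor free of the first variable can be pulled out of the extraction of its coefficient.
  contract-lift : ∀ {n} N g (P : Comb n) Q → contract N g (lift P *′ Q) ≋ P *′ contract N g Q
  contract-lift N g P Q = pairing≈ (λ ψ → begin
    ⟨ contract N g (lift P *′ Q) , ψ ⟩
      ≈⟨ ⟨⟩-transport (coefficientAtHead N g) tail (lift P *′ Q) ψ ⟩
    ⟨ lift P *′ Q , (λ m → coefficient N g (head m) * ψ (tail m)) ⟩
      ≈⟨ ⟨⟩-lift-* P Q _ ⟩
    ⟨ Q , (λ m → ⟨ P , (λ a → coefficient N g (head m) * ψ (a +ᵉ tail m)) ⟩) ⟩
      ≈⟨ ⟨⟩-cong Q (λ m → ⟨⟩-* P _ _) ⟩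
    ⟨ Q , (λ m → coefficient N g (head m) * ⟨ P , (λ a → ψ (a +ᵉ tail m)) ⟩) ⟩
      ≈⟨ ⟨⟩-transport (coefficientAtHead N g) tail Q _ ⟨
    ⟨ contract N g Q , (λ b → ⟨ P , (λ a → ψ (a +ᵉ b)) ⟩) ⟩
      ≈⟨ ⟨⟩-swap (contract N g Q) P _ ⟩
    ⟨ P , (λ a → ⟨ contract N g Q , (λ b → ψ (a +ᵉ b)) ⟩) ⟩
      ≈⟨ ⟨⟩-⊠ P (contract N g Q) ψ ⟨
    ⟨ P *′ contract N g Q , ψ ⟩ ∎)

  Λ-lift : ∀ {n} N g (gs : Vec PowerSeries n) P Q → Λ N (g ∷ gs) (lift P *′ Q) ≈ Λ N gs (P *′ contract N g Q)
  Λ-lift N g gs P Q = trans (Λ-contract N g gs (lift P *′ Q)) (Λ-cong N gs (contract-lift N g P Q))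

  coefficients-≐ : ∀ {n} N {gs hs : Vec PowerSeries n} → Pointwise _≐_ gs hs → ∀ m → coefficients N gs m ≈ coefficients N hs m
  coefficients-≐ N []       m = refl
  coefficients-≐ N (p ∷ ps) m = *-cong (coefficient-≐ N (head m) p) (coefficients-≐ N ps (tail m))

  Λ-≐ : ∀ {n} N {gs hs : Vec PowerSeries n} P → Pointwise _≐_ gs hs → Λ N gs P ≈ Λ N hs P
  Λ-≐ N P p = ⟨⟩-cong P (coefficients-≐ N p)

  Λ-⊕ : ∀ {n} N g h (gs : Vec PowerSeries n) P → Λ N (g ⊕ h ∷ gs) P ≈ Λ N (g ∷ gs) P + Λ N (h ∷ gs) P
  Λ-⊕ N g h gs P = trans (⟨⟩-cong P (λ m → trans (*-congʳ (coefficient-⊕ N g h (head m))) (distribʳ _ _ _))) (⟨⟩-+ P _ _)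

  Λ-· : ∀ {n} N c g (gs : Vec PowerSeries n) P → Λ N (c · g ∷ gs) P ≈ c * Λ N (g ∷ gs) P
  Λ-· N c g gs P = trans (⟨⟩-cong P (λ m → trans (*-congʳ (coefficient-· N c g (head m))) (*-assoc _ _ _))) (⟨⟩-* P c _)

  Λ-X : ∀ {n} N g (gs : Vec PowerSeries n) P → Λ N (X g ∷ gs) P ≈ Λ N (g ∷ gs) (x₀ *′ P)
  Λ-X {n} N g gs P = sym (begin
    ⟨ x₀ *′ P , coefficients N (g ∷ gs) ⟩ ≈⟨ ⟨⟩-⊠ x₀ P (coefficients N (g ∷ gs)) ⟩
    _ ≈⟨ ⟨⟩-unit (1 ∷ replicate n 0) (λ m → ⟨ P , (λ a → coefficients N (g ∷ gs) (m +ᵉ a)) ⟩) ⟩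
    ⟨ P , (λ m → coefficients N (g ∷ gs) ((1 ∷ replicate n 0) +ᵉ m)) ⟩
      ≈⟨ ⟨⟩-cong P (λ { (e ∷ m) → *-cong (sym (coefficient-X N g e))
            (reflexive (≡.cong (coefficients N gs) (Vecₚ.zipWith-identityˡ ℕₚ.+-identityˡ m))) }) ⟩
    Λ N (X g ∷ gs) P ∎)

  const-* : ∀ {n} c (P : Comb n) ψ → ⟨ const c *′ P , ψ ⟩ ≈ c * ⟨ P , ψ ⟩
  const-* {n} c P ψ = begin
    ⟨ const c *′ P , ψ ⟩ ≈⟨ ⟨⟩-⊠ (const c) P ψ ⟩
    _ ≈⟨ ⟨⟩-monomial c (replicate n 0) (λ m → ⟨ P , (λ a → ψ (m +ᵉ a)) ⟩) ⟩
    c * ⟨ P , (λ m → ψ (replicate n 0 +ᵉ m)) ⟩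
      ≈⟨ *-congˡ (⟨⟩-cong P (λ m → reflexive (≡.cong ψ (Vecₚ.zipWith-identityˡ ℕₚ.+-identityˡ m)))) ⟩
    c * ⟨ P , ψ ⟩ ∎

  -- Multiplying a series and multiplying the polynomial have the same effect on the coefficient of
  -- their product. Together with `Λ-X` this moves factors freely between slots and polynomials.
  Λ-1+x : ∀ {n} N c g (gs : Vec PowerSeries n) P → Λ N (1+ c x g ∷ gs) P ≈ Λ N (g ∷ gs) ((1′ +′ const c *′ x₀) *′ P)
  Λ-1+x N c g gs P = begin
    Λ N (1+ c x g ∷ gs) P ≈⟨ Λ-⊕ N g (c · X g) gs P ⟩
    Λ N (g ∷ gs) P + Λ N (c · X g ∷ gs) P ≈⟨ +-congˡ (Λ-· N c (X g) gs P) ⟩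
    Λ N (g ∷ gs) P + c * Λ N (X g ∷ gs) P ≈⟨ +-congˡ (*-congˡ (Λ-X N g gs P)) ⟩
    Λ N (g ∷ gs) P + c * Λ N (g ∷ gs) (x₀ *′ P) ≈⟨ +-congˡ (const-* c (x₀ *′ P) _) ⟨
    Λ N (g ∷ gs) P + Λ N (g ∷ gs) (const c *′ (x₀ *′ P)) ≈⟨ Λ-+ N (g ∷ gs) P _ ⟨
    Λ N (g ∷ gs) (P +′ const c *′ (x₀ *′ P)) ≈⟨ Λ-cong N (g ∷ gs) (expand P x₀ (const c)) ⟨
    Λ N (g ∷ gs) ((1′ +′ const c *′ x₀) *′ P) ∎
    where
    expand : ∀ {n} (P x c : Comb n) → (1′ +′ c *′ x) *′ P ≋ P +′ c *′ (x *′ P)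
    expand {n} = S.solve 3 (λ P x c → (S.:1 S.:+ c S.:* x) S.:* P S.:= P S.:+ c S.:* (x S.:* P)) ≋-refl
      where module S = IntegerSolver (Poly n)

-- The cancellation between two adjacent slots.

module RingIdentities (A : Ring₀) (u v : CommutativeRing.Carrier A) where
  open CommutativeRing A hiding (zero)
  open IntegerSolver A using (solve; _:=_; _:+_; _:*_; _:-_; :-_; con; :1)
  open PairFactors A u v
  open Products A

  -- The parameters `uv`, `d` and `y₁` leave room for `const (u * v)` and for a lifted factor, which
  -- agree with the expressions in the identity only up to `≋`.
  swapped-factor-* : ∀ {uv d y₁} x y P → uv ≈ u * v → d ≈ 1# + (1# - v) * y → y₁ ≈ y →
    d * ((1# + u * x) * P) + uv * (y₁ * (x * P)) ≈ q y x * P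
  swapped-factor-* x y P p r s = trans (+-cong (*-congʳ r) (*-cong p (*-congʳ s)))
    (solve 5 (λ u v x y P → (:1 :+ (:1 :- v) :* y) :* ((:1 :+ u :* x) :* P) :+ (u :* v) :* (y :* (x :* P))
       := (:1 :+ (:1 :- v) :* y :+ u :* (x :+ y :* x)) :* P) refl u v x y P)

  minus-distribʳ : ∀ x y T → (x - y) * T ≈ x * T + - (y * T)
  minus-distribʳ = solve 3 (λ x y T → (x :- y) :* T := x :* T :+ :- (y :* T)) refl

  affine-cong : ∀ {n} {cs ds : Vec Carrier n} {xs ys} → Pointwise _≈_ cs ds → Pointwise _≈_ xs ys → affine cs xs ≈ affine ds ys
  affine-cong []       []       = refl
  affine-cong (p ∷ ps) (r ∷ rs) = *-cong (+-congˡ (*-cong p r)) (affine-cong ps rs)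

  regroup : ∀ e w a b → (e * w) * (a * b) ≈ e * (a * (w * b))
  regroup = solve 4 (λ e w a b → (e :* w) :* (a :* b) := e :* (a :* (w :* b))) refl

  ∏-swapAt : ∀ {n} {I : Set} (f : I → Carrier) p (xs : Vec I n) → ∏ f (swapAt p xs) ≈ ∏ f xs
  ∏-swapAt f zero    []           = refl
  ∏-swapAt f zero    (x ∷ [])     = refl
  ∏-swapAt f zero    (x ∷ y ∷ xs) = solve 3 (λ a b c → b :* (a :* c) := a :* (b :* c)) refl _ _ _
  ∏-swapAt f (suc p) []           = refl
  ∏-swapAt f (suc p) (x ∷ xs)     = *-congˡ (∏-swapAt f p xs)

module Functionals (K : Ring₀) (u v : CommutativeRing.Carrier K) where
  open CommutativeRing K hiding (zero)
  open IntegerSolver K using (solve; _:=_; _:+_; _:*_; _:-_; :-_; con; :1)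
  open Relation.Binary.Reasoning.Setoid setoid
  open Sums K
  open AlternatingSums K
  open Coefficients K u v public
  open AlgebraHom using (cong; +-homo; *-homo; const-homo)
  module I {n} = RingIdentities (Poly n) (const u) (const v)
  module H {n n′} (h : AlgebraHom n n′) = HomProperties u v h

  V : ∀ n → Comb n
  V n = F.V (vars n)

  r l : PowerSeries → PowerSeries
  r = 1+ u x
  l = 1+ (1# - v) x

  const-minus : ∀ {n} → const {n} (1# - v) ≋ 1′ -′ const v
  const-minus {n} = pairing≈ (λ ψ → begin
    ⟨ const (1# - v) , ψ ⟩ ≈⟨ ⟨⟩-monomial _ _ ψ ⟩
    (1# - v) * ψ (replicate n 0) ≈⟨ solve 2 (λ v a → (:1 :- v) :* a := :1 :* a :+ (:- :1) :* (v :* a)) refl v _ ⟩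
    1# * ψ (replicate n 0) + - 1# * (v * ψ (replicate n 0))
      ≈⟨ +-cong (⟨⟩-monomial _ _ ψ) (trans (⟨⟩-scale (- 1#) (const v) ψ) (*-congˡ (⟨⟩-monomial _ _ ψ))) ⟨
    ⟨ 1′ , ψ ⟩ + ⟨ -′ const v , ψ ⟩ ≈⟨ ⟨⟩-⊞ 1′ (-′ const v) ψ ⟨
    ⟨ 1′ -′ const v , ψ ⟩ ∎)

  const-uv : ∀ {n} → const {n} (u * v) ≋ const u *′ const v
  const-uv {n} = pairing≈ (λ ψ → begin
    ⟨ const (u * v) , ψ ⟩ ≈⟨ ⟨⟩-monomial _ _ ψ ⟩
    (u * v) * ψ (replicate n 0) ≈⟨ *-assoc u v _ ⟩
    u * (v * ψ (replicate n 0)) ≈⟨ *-congˡ (⟨⟩-monomial _ _ ψ) ⟨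
    u * ⟨ const v , ψ ⟩ ≈⟨ const-* u (const v) ψ ⟨
    ⟨ const u *′ const v , ψ ⟩ ∎)

  lift-1+x : ∀ {n} c → lift (1′ +′ const c *′ x₀ {n}) ≋ 1′ +′ const c *′ lift x₀
  lift-1+x c = ≋-trans (+-homo liftHom 1′ (const c *′ x₀)) (+′-cong (const-homo liftHom 1#)
    (≋-trans (*-homo liftHom (const c) x₀) (*′-congʳ {x = lift x₀} (const-homo liftHom c))))

  Λ-1+x² : ∀ {n} N c g h (gs : Vec PowerSeries n) P →
           Λ N (g ∷ 1+ c x h ∷ gs) P ≈ Λ N (g ∷ h ∷ gs) (lift (1′ +′ const c *′ x₀) *′ P)
  Λ-1+x² N c g h gs P = begin
    Λ N (g ∷ 1+ c x h ∷ gs) P ≈⟨ Λ-contract N g (1+ c x h ∷ gs) P ⟩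
    Λ N (1+ c x h ∷ gs) (contract N g P) ≈⟨ Λ-1+x N c h gs (contract N g P) ⟩
    Λ N (h ∷ gs) ((1′ +′ const c *′ x₀) *′ contract N g P) ≈⟨ Λ-lift N g (h ∷ gs) (1′ +′ const c *′ x₀) P ⟨
    Λ N (g ∷ h ∷ gs) (lift (1′ +′ const c *′ x₀) *′ P) ∎

  Λ-X² : ∀ {n} N g h (gs : Vec PowerSeries n) P → Λ N (g ∷ X h ∷ gs) P ≈ Λ N (g ∷ h ∷ gs) (lift x₀ *′ P)
  Λ-X² N g h gs P = begin
    Λ N (g ∷ X h ∷ gs) P ≈⟨ Λ-contract N g (X h ∷ gs) P ⟩
    Λ N (X h ∷ gs) (contract N g P) ≈⟨ Λ-X N h gs (contract N g P) ⟩
    Λ N (h ∷ gs) (x₀ *′ contract N g P) ≈⟨ Λ-lift N g (h ∷ gs) x₀ P ⟨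
    Λ N (g ∷ h ∷ gs) (lift x₀ *′ P) ∎

  -- Two slots with the same series cannot tell their variables apart. Applied to (x - y) T with T
  -- symmetric, this gives 0.
  Λ-swap : ∀ {n} N h (gs : Vec PowerSeries n) P → Λ N (h ∷ h ∷ gs) (swap zero P) ≈ Λ N (h ∷ h ∷ gs) P
  Λ-swap N h gs P = trans (⟨⟩-transport one (swapAt zero) P _) (⟨⟩-cong P (λ { (a ∷ b ∷ m) →
    solve 3 (λ a b c → :1 :* (b :* (a :* c)) := a :* (b :* c)) refl _ _ _ }))

  -- Invariance under adjacent transpositions. Here p runs over all of ℕ, since `swapAt` does
  -- nothing beyond the end of a vector.
  Symmetric : ∀ {n} → Comb n → Set
  Symmetric S = ∀ p → swap p S ≋ S

  module _ {n} (S : Comb (suc (suc n))) (S-sym : Symmetric S) where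
    private
      x y : Comb (suc (suc n))
      x = x₀
      y = lift x₀
      zs = Vec.map lift (Vec.map lift (vars n))
      module Hσ = H {suc (suc n)} (swapHom 0)
      T : Comb (suc (suc n))
      T = (F.q y x *′ F.q x y) *′ ((Π.∏ (F.pairFactor′ x) zs *′ Π.∏ (F.pairFactor′ y) zs) *′ (F.V zs *′ S))

      swap-zs : Pointwise _≋_ (Vec.map (swap zero) zs) zs
      swap-zs = go (vars n)
        where
        go : ∀ {k} (xs : Vec (Comb n) k) → Pointwise _≋_ (Vec.map (swap zero) (Vec.map lift (Vec.map lift xs))) (Vec.map lift (Vec.map lift xs))
        go []       = []
        go (x ∷ xs) = swap-lift-lift x ∷ go xs

      swap-∏ : ∀ {a b} → swap zero a ≋ b → swap zero (Π.∏ (F.pairFactor′ a) zs) ≋ Π.∏ (F.pairFactor′ b) zs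
      swap-∏ {a} p = ≋-trans (Hσ.∏-homo zs (λ z → Hσ.pairFactor′-homo a z)) (Π.∏-cong (λ s → F.pairFactor′-cong p s) swap-zs)

      swap-q : ∀ {a b c d} → swap zero a ≋ c → swap zero b ≋ d → swap zero (F.q a b) ≋ F.q c d
      swap-q {a} {b} p s = ≋-trans (Hσ.q-homo a b) (F.q-cong p s)

      sx : swap zero x ≋ y
      sx = swap-x₀
      sy : swap zero y ≋ x
      sy = swap-lift-x₀

      swap-T : swap zero T ≋ T
      swap-T = ≋-trans (*-homo (swapHom 0) (F.q y x *′ F.q x y) _) (*′-cong
        (≋-trans (*-homo (swapHom 0) (F.q y x) (F.q x y)) (≋-trans (*′-cong (swap-q {y} {x} sy sx) (swap-q {x} {y} sx sy))
           (*′-comm (F.q x y) (F.q y x))))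
        (≋-trans (*-homo (swapHom 0) (Π.∏ (F.pairFactor′ x) zs *′ Π.∏ (F.pairFactor′ y) zs) _) (*′-cong
          (≋-trans (*-homo (swapHom 0) (Π.∏ (F.pairFactor′ x) zs) _) (≋-trans (*′-cong (swap-∏ {x} sx) (swap-∏ {y} sy))
            (*′-comm (Π.∏ (F.pairFactor′ y) zs) _)))
          (≋-trans (*-homo (swapHom 0) (F.V zs) S) (*′-cong
            (≋-trans (Hσ.pairProduct-homo zs Hσ.pairFactor′-homo) (Π.pairProduct-cong F.pairFactor′-cong swap-zs))
            (S-sym 0))))))

    -- Up to the factor x - y, the sum of the two sides is symmetric in the first two variables.
    collision : ∀ N h (gs : Vec PowerSeries n) P → P ≋ S *′ V (suc (suc n)) →
                Λ N (r h ∷ l h ∷ gs) P + (u * v) * Λ N (X h ∷ X h ∷ gs) P ≈ 0#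
    collision N h gs P P≋ = begin
      Λ N (r h ∷ l h ∷ gs) P + (u * v) * Λ N (X h ∷ X h ∷ gs) P
        ≈⟨ +-cong (trans (Λ-1+x N u h (l h ∷ gs) P) (Λ-1+x² N (1# - v) h h gs _))
            (*-congˡ (trans (Λ-X N h (X h ∷ gs) P) (Λ-X² N h h gs _))) ⟩
      Λ N hs (D *′ ((1′ +′ const u *′ x) *′ P)) + (u * v) * Λ N hs (y *′ (x *′ P))
        ≈⟨ +-congˡ (const-* (u * v) (y *′ (x *′ P)) _) ⟨
      Λ N hs (D *′ ((1′ +′ const u *′ x) *′ P)) + Λ N hs (const (u * v) *′ (y *′ (x *′ P)))
        ≈⟨ Λ-+ N hs _ _ ⟨
      Λ N hs (D *′ ((1′ +′ const u *′ x) *′ P) +′ const (u * v) *′ (y *′ (x *′ P)))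
        ≈⟨ Λ-cong N hs (I.swapped-factor-* x y P const-uv
             (≋-trans (lift-1+x (1# - v)) (+′-congˡ {x = 1′} (*′-congʳ {x = y} const-minus))) ≋-refl) ⟩
      Λ N hs (F.q y x *′ P)
        ≈⟨ Λ-cong N hs (≋-trans (*′-congˡ {x = F.q y x} P≋) (F.antisymmetric-part S x y zs)) ⟩
      Λ N hs ((x -′ y) *′ T)
        ≈⟨ Λ-cong N hs (I.minus-distribʳ x y T) ⟩
      Λ N hs (x *′ T +′ -′ (y *′ T))
        ≈⟨ trans (Λ-+ N hs _ _) (+-congˡ (Λ-neg N hs (y *′ T))) ⟩
      Λ N hs (x *′ T) - Λ N hs (y *′ T)
        ≈⟨ +-congʳ (Λ-swap N h gs (x *′ T)) ⟨
      Λ N hs (swap zero (x *′ T)) - Λ N hs (y *′ T)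
        ≈⟨ +-congʳ (Λ-cong N hs (≋-trans (*-homo (swapHom 0) x T) (*′-cong sx swap-T))) ⟩
      Λ N hs (y *′ T) - Λ N hs (y *′ T)
        ≈⟨ -‿inverseʳ _ ⟩
      0# ∎
      where
      hs = h ∷ h ∷ gs
      D = lift (1′ +′ const (1# - v) *′ x₀ {n})

  module _ {n} (S : Comb (suc n)) (S-sym : Symmetric S) where
    private
      ys = Vec.map lift (vars n)
      E : Comb (suc n)
      E = S *′ Π.∏ (F.pairFactor′ x₀) ys

    V-suc : V (suc n) ≋ Π.∏ (F.pairFactor′ x₀) ys *′ lift (V n)
    V-suc = *′-congˡ {x = Π.∏ (F.pairFactor′ x₀) ys}
      (≋-sym (H.pairProduct-homo (liftHom {n}) (vars n) (H.pairFactor′-homo liftHom)))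

    -- The factors of V that contain the first variable go into E together with S; the others form a
    -- lifted V and pass through the contraction. Hence the shape S V is preserved.
    contract-V : ∀ N g P → P ≋ S *′ V (suc n) → contract N g P ≋ contract N g E *′ V n
    contract-V N g P P≋ = ≋-trans (contract-cong N g {P} {lift (V n) *′ E}
      (≋-trans P≋ (≋-trans (*′-congˡ {x = S} V-suc)
        (≋-trans (≋-sym (*′-assoc S _ _)) (*′-comm E (lift (V n)))))))
      (≋-trans (contract-lift N g (V n) E) (*′-comm (V n) _))

    -- The first variable meets all others through the same factor, so a swap of two later variables
    -- only reorders the product in E.
    contract-symmetric : ∀ N g → Symmetric (contract N g E)
    contract-symmetric N g p = ≋-trans
      (transport-∘ (coefficientAtHead N g) tail one (swapAt p) one (swapAt (suc p)) (coefficientAtHead N g) tail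
        (λ { (a ∷ m) → *-comm _ _ }) (λ { (a ∷ m) → ≡.refl }) E)
      (contract-cong N g {swap (suc p) E} {E} (≋-trans (*-homo (swapHom (suc p)) S _) (*′-cong (S-sym (suc p)) swap-∏)))
      where
      module Hσ = H {suc n} (swapHom (suc p))
      swap-∏ : swap (suc p) (Π.∏ (F.pairFactor′ x₀) ys) ≋ Π.∏ (F.pairFactor′ x₀) ys
      swap-∏ = ≋-trans (Hσ.∏-homo ys (λ z → Hσ.pairFactor′-homo x₀ z))
        (≋-trans (Π.∏-cong (λ s → F.pairFactor′-cong (swap-suc-x₀ p) s) (PW.tail (swap-vars (suc n) (suc p))))
            (I.∏-swapAt (F.pairFactor′ x₀) p ys))

  Functional : Set
  Functional = List PowerSeries → Carrier

  record LinearInFirst (M : Functional) : Set where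
    field
      M-≐ : ∀ {g h} gs → g ≐ h → M (g ∷ gs) ≈ M (h ∷ gs)
      M-⊕ : ∀ g h gs → M (g ⊕ h ∷ gs) ≈ M (g ∷ gs) + M (h ∷ gs)
      M-· : ∀ c g gs → M (c · g ∷ gs) ≈ c * M (g ∷ gs)

  -- The number counts the slots after the first one; if there are none, no pair of slots exists.
  Collision : ℕ → Functional → Set
  Collision zero    M = ⊤
  Collision (suc _) M = ∀ h gs → M (r h ∷ l h ∷ gs) + (u * v) * M (X h ∷ X h ∷ gs) ≈ 0#

  -- Both properties are stated for the leading slots only; filling the first slot and recurring
  -- carries them to every later position.
  Good : ℕ → Functional → Set
  Good zero    M = ⊤
  Good (suc n) M = LinearInFirst M × Collision n M × (∀ g → Good n (λ gs → M (g ∷ gs)))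

  -- Missing slots receive the zero series and surplus ones are cut off, which makes functionals
  -- total on lists; lists allow the slots to be filled one by one.
  pad : ∀ n → List PowerSeries → Vec PowerSeries n
  pad zero    _        = []
  pad (suc n) []       = (λ _ → 0#) ∷ pad n []
  pad (suc n) (g ∷ gs) = g ∷ pad n gs

  -- The symmetric factor S starts as 1 in `good-V` and accumulates what the slots already filled
  -- leave behind.
  good : ∀ n N P S M → Symmetric S → P ≋ S *′ V n → (∀ gs → M gs ≈ Λ N (pad n gs) P) → Good n M
  good zero    N P S M S-sym P≋ M≈ = tt
  good (suc n) N P S M S-sym P≋ M≈ = linear , coll n P S S-sym P≋ M≈ , λ g →
    good n N (contract N g P) _ (λ gs → M (g ∷ gs)) (contract-symmetric S S-sym N g) (contract-V S S-sym N g P P≋)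
      (λ gs → trans (M≈ (g ∷ gs)) (Λ-contract N g (pad n gs) P))
    where
    linear : LinearInFirst M
    linear = record
      { M-≐ = λ {g} {h} gs p → trans (M≈ _) (trans (Λ-≐ N {g ∷ pad n gs} {h ∷ pad n gs} P (p ∷ PW.refl (λ _ → refl))) (sym (M≈ _)))
      ; M-⊕ = λ g h gs → trans (M≈ _) (trans (Λ-⊕ N g h (pad n gs) P) (sym (+-cong (M≈ _) (M≈ _))))
      ; M-· = λ c g gs → trans (M≈ _) (trans (Λ-· N c g (pad n gs) P) (sym (*-congˡ (M≈ _)))) }
    coll : ∀ n (P S : Comb (suc n)) → Symmetric S → P ≋ S *′ V (suc n) → (∀ gs → M gs ≈ Λ N (pad (suc n) gs) P) → Collision n M
    coll zero    P S S-sym P≋ M≈ = tt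
    coll (suc n) P S S-sym P≋ M≈ h gs = trans (+-cong (M≈ _) (*-congˡ (M≈ _))) (collision S S-sym N h (pad n gs) P P≋)

  symmetric-1 : ∀ {n} → Symmetric (1′ {n})
  symmetric-1 p = const-homo (swapHom p) 1#

  good-V : ∀ n N → Good n (λ gs → Λ N (pad n gs) (V n))
  good-V n N = good n N (V n) 1′ _ symmetric-1 (≋-sym (*′-identityˡ (V n))) (λ _ → refl)

-- The expansion of the constant term by one variable.

module RowExpansion (K : Ring₀) (u v : CommutativeRing.Carrier K) where
  open CommutativeRing K hiding (zero)
  open IntegerSolver K using (solve; _:=_; _:+_; _:*_; _:-_; :-_; con; :1)
  open Relation.Binary.Reasoning.Setoid setoid
  open Sums K
  open AlternatingSums K
  open Functionals K u v public
  open AlgebraHom using (cong; +-homo; *-homo; const-homo)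

  -- This is how the linear factors that remain when a variable is set to 0 become the operators `r`
  -- and `l` on the series of the other slots.
  Λ-affine : ∀ {n} N (cs : Vec Carrier n) (gs : Vec PowerSeries n) P →
    Λ N (zipWith 1+_x cs gs) P ≈ Λ N gs (F.affine (Vec.map const cs) (vars n) *′ P)
  Λ-affine N []       []       P = Λ-cong N [] (≋-sym (*′-identityˡ P))
  Λ-affine {suc n} N (c ∷ cs) (g ∷ gs) P = begin
    Λ N (1+ c x g ∷ zipWith 1+_x cs gs) P ≈⟨ Λ-contract N (1+ c x g) (zipWith 1+_x cs gs) P ⟩
    Λ N (zipWith 1+_x cs gs) (contract N (1+ c x g) P) ≈⟨ Λ-affine N cs gs (contract N (1+ c x g) P) ⟩
    Λ N gs (Q *′ contract N (1+ c x g) P) ≈⟨ Λ-lift N (1+ c x g) gs Q P ⟨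
    Λ N (1+ c x g ∷ gs) (lift Q *′ P) ≈⟨ Λ-1+x N c g gs (lift Q *′ P) ⟩
    Λ N (g ∷ gs) ((1′ +′ const c *′ x₀) *′ (lift Q *′ P))
      ≈⟨ Λ-cong N (g ∷ gs) (≋-trans (≋-sym (*′-assoc _ (lift Q) P))
            (*′-congʳ {x = P} (*′-congˡ {x = 1′ +′ const c *′ x₀} (lift-affine cs (vars n))))) ⟩
    Λ N (g ∷ gs) (F.affine (Vec.map const (c ∷ cs)) (vars (suc n)) *′ P) ∎
    where
    Q : Comb n
    Q = F.affine (Vec.map const cs) (vars n)
    lift-affine : ∀ {k} (cs : Vec Carrier k) (xs : Vec (Comb n) k) →
      lift (F.affine (Vec.map const cs) xs) ≋ F.affine (Vec.map const cs) (Vec.map lift xs)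
    lift-affine []       []       = const-homo liftHom 1#
    lift-affine (c ∷ cs) (x ∷ xs) = ≋-trans (*-homo liftHom (1′ +′ const c *′ x) (F.affine (Vec.map const cs) xs)) (*′-cong
      (≋-trans (+-homo liftHom 1′ (const c *′ x)) (+′-cong (const-homo liftHom 1#)
        (≋-trans (*-homo liftHom (const c) x) (*′-congʳ {x = lift x} (const-homo liftHom c)))))
      (lift-affine cs xs))

  -- The scalar version of `F.slopes`: these coefficients act on power series, whereas `F.slopes`
  -- are constants of the polynomial ring.
  lowerings : ∀ {n} → Fin (suc n) → Vec Carrier n
  lowerings {n}     zero    = replicate n u
  lowerings {suc n} (suc i) = (1# - v) ∷ lowerings i

  const-lowerings : ∀ {n k} (i : Fin (suc n)) → Pointwise _≋_ (Vec.map (const {k}) (lowerings i)) (F.slopes i)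
  const-lowerings {n} zero = pw-≡ (Vecₚ.map-replicate const u n)
  const-lowerings {suc n} (suc i) = const-minus ∷ const-lowerings i

  lower : ∀ {n} → Fin (suc n) → Vec PowerSeries (suc n) → Vec PowerSeries n
  lower         zero    (g ∷ gs)      = Vec.map r gs
  lower {suc n} (suc i) (g ∷ gs)      = l g ∷ lower i gs

  lower-zipWith : ∀ {n} i (gs : Vec PowerSeries (suc n)) → lower i gs ≡ zipWith 1+_x (lowerings i) (removeAt gs i)
  lower-zipWith zero    (g ∷ gs)      = go gs
    where
    go : ∀ {n} (gs : Vec PowerSeries n) → Vec.map r gs ≡ zipWith 1+_x (replicate n u) gs
    go []       = ≡.refl
    go (g ∷ gs) = ≡.cong (r g ∷_) (go gs)
  lower-zipWith (suc i) (g ∷ h ∷ gs) = ≡.cong (l g ∷_) (lower-zipWith i (h ∷ gs))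

  Λ-lower : ∀ {n} N i (gs : Vec PowerSeries (suc n)) P →
            Λ N (lower i gs) P ≈ Λ N (removeAt gs i) (F.affine (F.slopes i) (vars n) *′ P)
  Λ-lower {n} N i gs P = begin
    Λ N (lower i gs) P ≡⟨ ≡.cong (λ hs → Λ N hs P) (lower-zipWith i gs) ⟩
    Λ N (zipWith 1+_x (lowerings i) (removeAt gs i)) P ≈⟨ Λ-affine N (lowerings i) (removeAt gs i) P ⟩
    Λ N (removeAt gs i) (F.affine (Vec.map const (lowerings i)) (vars n) *′ P)
      ≈⟨ Λ-cong N (removeAt gs i) (*′-congʳ {x = P} (I.affine-cong (const-lowerings i) pw-refl)) ⟩
    Λ N (removeAt gs i) (F.affine (F.slopes i) (vars n) *′ P) ∎

  ∏vars : ∀ n → Comb n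
  ∏vars n = Π.∏ (λ x → x) (vars n)

  contract-x₀ : ∀ {n} N g (P : Comb (suc n)) → contract (suc N) g (x₀ *′ P) ≋ contract N g P
  contract-x₀ {n} N g P = pairing≈ (λ ψ → begin
    ⟨ contract (suc N) g (x₀ *′ P) , ψ ⟩
      ≈⟨ ⟨⟩-transport (coefficientAtHead (suc N) g) tail (x₀ *′ P) ψ ⟩
    ⟨ x₀ *′ P , χ ψ ⟩
      ≈⟨ ⟨⟩-⊠ x₀ P (χ ψ) ⟩
    ⟨ x₀ , (λ m → ⟨ P , (λ a → χ ψ (m +ᵉ a)) ⟩) ⟩
      ≈⟨ ⟨⟩-unit (1 ∷ replicate n 0) _ ⟩
    ⟨ P , (λ a → χ ψ ((1 ∷ replicate n 0) +ᵉ a)) ⟩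
      ≈⟨ ⟨⟩-cong P (λ { (e ∷ a) → *-congˡ (reflexive (≡.cong ψ (Vecₚ.zipWith-identityˡ ℕₚ.+-identityˡ a))) }) ⟩
    ⟨ P , (λ a → coefficient N g (head a) * ψ (tail a)) ⟩
      ≈⟨ ⟨⟩-transport (coefficientAtHead N g) tail P ψ ⟨
    ⟨ contract N g P , ψ ⟩ ∎)
    where
    χ : (Vec ℕ n → Carrier) → Vec ℕ (suc n) → Carrier
    χ ψ m = coefficient (suc N) g (head m) * ψ (tail m)

  ∏vars-suc : ∀ n → ∏vars (suc n) ≋ x₀ *′ lift (∏vars n)
  ∏vars-suc n = *′-congˡ {x = x₀} (≋-sym (H.∏-homo liftHom (vars n) (λ _ → ≋-refl)))

  -- One additional factor of each variable is compensated by asking for one more power of each.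
  Λ-∏vars : ∀ {n} N (gs : Vec PowerSeries n) P → Λ (suc N) gs (∏vars n *′ P) ≈ Λ N gs P
  Λ-∏vars N [] P = Λ-cong N [] (*′-identityˡ P)
  Λ-∏vars {suc n} N (g ∷ gs) P = begin
    Λ (suc N) (g ∷ gs) (∏vars (suc n) *′ P)
      ≈⟨ Λ-cong (suc N) (g ∷ gs) (≋-trans (*′-congʳ {x = P} (≋-trans (∏vars-suc n)
            (*′-comm x₀ (lift (∏vars n))))) (*′-assoc (lift (∏vars n)) x₀ P)) ⟩
    Λ (suc N) (g ∷ gs) (lift (∏vars n) *′ (x₀ *′ P)) ≈⟨ Λ-lift (suc N) g gs (∏vars n) (x₀ *′ P) ⟩
    Λ (suc N) gs (∏vars n *′ contract (suc N) g (x₀ *′ P)) ≈⟨ Λ-∏vars N gs (contract (suc N) g (x₀ *′ P)) ⟩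
    Λ N gs (contract (suc N) g (x₀ *′ P)) ≈⟨ Λ-cong N gs (contract-x₀ N g P) ⟩
    Λ N gs (contract N g P) ≈⟨ Λ-contract N g gs P ⟨
    Λ N (g ∷ gs) P ∎

  x₀^ : ∀ {n} k → x₀ {n} Π.^ k ≋ monomial 1# (k ∷ replicate n 0)
  x₀^         zero    = ≋-refl
  x₀^ {n} (suc k) = ≋-trans (*′-congˡ {x = x₀} (x₀^ k)) (pairing≈ (λ ψ → begin
    ⟨ x₀ *′ monomial 1# (k ∷ replicate n 0) , ψ ⟩
      ≈⟨ ⟨⟩-⊠ x₀ (monomial 1# (k ∷ replicate n 0)) ψ ⟩
    _ ≈⟨ ⟨⟩-unit (1 ∷ replicate n 0) (λ m → ⟨ monomial 1# (k ∷ replicate n 0) , (λ a → ψ (m +ᵉ a)) ⟩) ⟩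
    _ ≈⟨ ⟨⟩-unit (k ∷ replicate n 0) (λ a → ψ ((1 ∷ replicate n 0) +ᵉ a)) ⟩
    ψ (suc k ∷ (replicate n 0 +ᵉ replicate n 0))
      ≡⟨ ≡.cong (λ m → ψ (suc k ∷ m)) (Vecₚ.zipWith-identityˡ ℕₚ.+-identityˡ (replicate n 0)) ⟩
    ψ (suc k ∷ replicate n 0)
      ≈⟨ ⟨⟩-unit (suc k ∷ replicate n 0) ψ ⟨
    ⟨ monomial 1# (suc k ∷ replicate n 0) , ψ ⟩ ∎))

  contract-eval : ∀ {n} N g i (P : Comb (suc (suc n))) → eval i (contract N g P) ≋ contract N g (eval (suc i) P)
  contract-eval N g i = transport-∘ (coefficientAtHead N g) tail (vanishAt i) (remove i)
    (vanishAt (suc i)) (remove (suc i)) (coefficientAtHead N g) tail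
    (λ { (a ∷ b ∷ m) → *-comm _ _ }) (λ { (a ∷ b ∷ m) → ≡.refl })

  -- The factor xᵢ^N exhausts the power of xᵢ, so that only the value at xᵢ = 0 of the rest counts.
  Λ-full-power : ∀ {n} N (gs : Vec PowerSeries (suc n)) i P →
    Λ N gs (lookup (vars (suc n)) i Π.^ N *′ P) ≈ lookup gs i 0 * Λ N (removeAt gs i) (eval i P)
  Λ-full-power {n} N (g ∷ gs) zero P = begin
    Λ N (g ∷ gs) (x₀ Π.^ N *′ P)
      ≈⟨ Λ-cong N (g ∷ gs) (*′-congʳ {x = P} (x₀^ N)) ⟩
    Λ N (g ∷ gs) (monomial 1# (N ∷ replicate n 0) *′ P)
      ≈⟨ ⟨⟩-⊠ (monomial 1# (N ∷ replicate n 0)) P (coefficients N (g ∷ gs)) ⟩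
    _ ≈⟨ ⟨⟩-unit (N ∷ replicate n 0) (λ m → ⟨ P , (λ a → coefficients N (g ∷ gs) (m +ᵉ a)) ⟩) ⟩
    ⟨ P , (λ a → coefficients N (g ∷ gs) ((N ∷ replicate n 0) +ᵉ a)) ⟩
      ≈⟨ ⟨⟩-cong P (λ { (e ∷ a) → trans (*-cong (coefficient-full N g e)
           (reflexive (≡.cong (coefficients N gs) (Vecₚ.zipWith-identityˡ ℕₚ.+-identityˡ a)))) (*-assoc _ _ _) }) ⟩
    ⟨ P , (λ a → g 0 * (vanishAt zero a * coefficients N gs (remove zero a))) ⟩
      ≈⟨ ⟨⟩-* P (g 0) _ ⟩
    g 0 * ⟨ P , (λ a → vanishAt zero a * coefficients N gs (remove zero a)) ⟩
      ≈⟨ *-congˡ (⟨⟩-transport (vanishAt zero) (remove zero) P (coefficients N gs)) ⟨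
    g 0 * Λ N gs (eval zero P) ∎
  Λ-full-power {suc n} N (g ∷ gs@(_ ∷ _)) (suc i) P = begin
    Λ N (g ∷ gs) (lookup (Vec.map lift (vars (suc n))) i Π.^ N *′ P)
      ≈⟨ Λ-cong N (g ∷ gs) (*′-congʳ {x = P} (≋-trans (P.reflexive (≡.cong (Π._^ N) (Vecₚ.lookup-map i lift (vars (suc n)))))
           (≋-sym (H.^-homo liftHom y N)))) ⟩
    Λ N (g ∷ gs) (lift (y Π.^ N) *′ P)
      ≈⟨ Λ-lift N g gs (y Π.^ N) P ⟩
    Λ N gs (y Π.^ N *′ contract N g P)
      ≈⟨ Λ-full-power N gs i (contract N g P) ⟩
    lookup gs i 0 * Λ N (removeAt gs i) (eval i (contract N g P))
      ≈⟨ *-congˡ (trans (Λ-cong N (removeAt gs i) (contract-eval N g i P)) (sym (Λ-contract N g (removeAt gs i) (eval (suc i) P)))) ⟩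
    lookup gs i 0 * Λ N (g ∷ removeAt gs i) (eval (suc i) P) ∎
    where
    y : Comb (suc n)
    y = lookup (vars (suc n)) i

  Λ-alternating : ∀ {n k} N (gs : Vec PowerSeries n) (f : Fin k → Comb n) →
    Λ N gs (Alt.alternating f) ≈ alternating (λ i → Λ N gs (f i))
  Λ-alternating {k = zero}  N gs f = MA.⟨⟩-none _
  Λ-alternating {k = suc k} N gs f = trans (Λ-+ N gs (f zero) _)
    (+-congˡ (trans (Λ-neg N gs _) (-‿cong (Λ-alternating N gs (λ i → f (suc i))))))

  -- Only the Vandermonde half of V is expanded. Setting xᵢ = 0 in the other half leaves its
  -- analogue in the remaining variables and the linear factors that `lower i` absorbs, so the two
  -- halves recombine to `V n`.
  Λ-V-expansion : ∀ n (gs : Vec PowerSeries (suc n)) →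
    Λ n gs (V (suc n)) ≈ alternating (λ i → lookup gs i 0 * Λ n (lower i gs) (V n))
  Λ-V-expansion n gs = begin
    Λ n gs (V (suc n))
      ≈⟨ Λ-∏vars n gs (V (suc n)) ⟨
    Λ (suc n) gs (∏vars (suc n) *′ V (suc n))
      ≈⟨ Λ-cong (suc n) gs (≋-trans (*′-congˡ {x = ∏vars (suc n)} (F.V-split xs)) (≋-trans (≋-sym (*′-assoc (∏vars (suc n)) _ Q))
           (≋-trans (*′-congʳ {x = Q} (Π.∏*vandermonde xs)) (≋-trans (*′-comm _ Q)
             (≋-sym (Alt.alternating-* Q (λ i → xᵢ i Π.^ suc n *′ W i))))))) ⟩
    Λ (suc n) gs (Alt.alternating (λ i → Q *′ (xᵢ i Π.^ suc n *′ W i)))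
      ≈⟨ Λ-alternating (suc n) gs (λ i → Q *′ (xᵢ i Π.^ suc n *′ W i)) ⟩
    alternating (λ i → Λ (suc n) gs (Q *′ (xᵢ i Π.^ suc n *′ W i)))
      ≈⟨ alternating-cong summand ⟩
    alternating (λ i → lookup gs i 0 * Λ n (lower i gs) (V n)) ∎
    where
    xs = vars (suc n)
    Q : Comb (suc n)
    Q = Π.pairProduct F.q xs
    xᵢ W : Fin (suc n) → Comb (suc n)
    xᵢ = lookup xs
    W i = Π.∏ (λ x → x) (removeAt xs i) *′ Π.vandermonde (removeAt xs i)
    minus-cong : ∀ {k} {a b c d : Comb k} → a ≋ b → c ≋ d → a -′ c ≋ b -′ d
    minus-cong p s = +′-cong p (-′-cong s)
    eval-W : ∀ i → eval i (W i) ≋ ∏vars n *′ Π.vandermonde (vars n)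
    eval-W i = ≋-trans (*-homo (evalHom i) (Π.∏ (λ x → x) (removeAt xs i)) _) (*′-cong
      (≋-trans (H.∏-homo (evalHom i) (removeAt xs i) (λ _ → ≋-refl)) (Π.∏-cong (λ p → p) (eval-removeAt-vars n i)))
      (≋-trans (H.pairProduct-homo (evalHom i) (removeAt xs i) (H.minus-homo (evalHom i)))
        (Π.pairProduct-cong minus-cong (eval-removeAt-vars n i))))
    eval-Q : ∀ i → eval i Q ≋ F.affine (F.slopes i) (vars n) *′ Π.pairProduct F.q (vars n)
    eval-Q i = ≋-trans (H.pairProduct-homo (evalHom i) xs (H.q-homo (evalHom i)))
      (≋-trans (Π.pairProduct-cong F.q-cong (eval-vars n i)) (F.pairProduct-q-insert-zero (vars n) i))
    commute : ∀ {k} (a b c : Comb k) → a *′ (b *′ c) ≋ b *′ (c *′ a)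
    commute a b c = ≋-trans (*′-comm a (b *′ c)) (*′-assoc b c a)
    summand : ∀ i → Λ (suc n) gs (Q *′ (xᵢ i Π.^ suc n *′ W i)) ≈ lookup gs i 0 * Λ n (lower i gs) (V n)
    summand i = begin
      Λ (suc n) gs (Q *′ (xᵢ i Π.^ suc n *′ W i))
        ≈⟨ Λ-cong (suc n) gs (commute Q (xᵢ i Π.^ suc n) (W i)) ⟩
      Λ (suc n) gs (xᵢ i Π.^ suc n *′ (W i *′ Q))
        ≈⟨ Λ-full-power (suc n) gs i (W i *′ Q) ⟩
      lookup gs i 0 * Λ (suc n) (removeAt gs i) (eval i (W i *′ Q))
        ≈⟨ *-congˡ (Λ-cong (suc n) (removeAt gs i) (≋-trans (*-homo (evalHom i) (W i) Q)
             (≋-trans (*′-cong (eval-W i) (eval-Q i)) (≋-trans (I.regroup (∏vars n) (Π.vandermonde (vars n)) _ _)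
               (*′-congˡ {x = ∏vars n} (*′-congˡ {x = F.affine (F.slopes i) (vars n)} (≋-sym (F.V-split (vars n))))))))) ⟩
      lookup gs i 0 * Λ (suc n) (removeAt gs i) (∏vars n *′ (F.affine (F.slopes i) (vars n) *′ V n))
        ≈⟨ *-congˡ (Λ-∏vars n (removeAt gs i) _) ⟩
      lookup gs i 0 * Λ n (removeAt gs i) (F.affine (F.slopes i) (vars n) *′ V n)
        ≈⟨ *-congˡ (Λ-lower n i gs (V n)) ⟨
      lookup gs i 0 * Λ n (lower i gs) (V n) ∎

  -- The alternating sum in a form suited to induction along a row: every slot g that is passed is
  -- recorded as `l g` in the functional, and the slot chosen turns the rest into `r`.
  expand : List PowerSeries → Functional → Carrier
  expand []       M = 0#
  expand (g ∷ gs) M = g 0 * M (List.map r gs) - expand gs (λ hs → M (l g ∷ hs))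

  expand-cong : ∀ gs {M M′ : Functional} → (∀ hs → M hs ≈ M′ hs) → expand gs M ≈ expand gs M′
  expand-cong []       p = refl
  expand-cong (g ∷ gs) p = +-cong (*-congˡ (p _)) (-‿cong (expand-cong gs (λ hs → p (l g ∷ hs))))

  expand-alternating : ∀ {n} (gs : Vec PowerSeries (suc n)) M →
    expand (toList gs) M ≈ alternating (λ i → lookup gs i 0 * M (toList (lower i gs)))
  expand-alternating (g ∷ [])     M = refl
  expand-alternating (g ∷ h ∷ gs) M = +-cong
    (*-congˡ (reflexive (≡.cong M (≡.sym (Vecₚ.toList-map r (h ∷ gs))))))
    (-‿cong (expand-alternating (h ∷ gs) (λ hs → M (l g ∷ hs))))

  pad-toList : ∀ {n} (gs : Vec PowerSeries n) → pad n (toList gs) ≡ gs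
  pad-toList []       = ≡.refl
  pad-toList (g ∷ gs) = ≡.cong (g ∷_) (pad-toList gs)

  toList-pad : ∀ n gs → length gs ≡ n → toList (pad n gs) ≡ gs
  toList-pad zero    []       p = ≡.refl
  toList-pad (suc n) (g ∷ gs) p = ≡.cong (g ∷_) (toList-pad n gs (ℕₚ.suc-injective p))

  -- The constant term of V(x₁, …, xₙ) ∏ gᵢ(xᵢ) xᵢ^(1 - n).
  constantTerm : ℕ → Functional
  constantTerm n gs = Λ (ℕ.pred n) (pad n gs) (V n)

  -- It reads the coefficient of xᵢ ^ n where `constantTerm` reads that of xᵢ ^ (n - 1). This
  -- amounts to dividing every series by x, without leaving power series.
  reduced : ℕ → Functional
  reduced n gs = Λ n (pad n gs) (V n)

  constantTerm-expand : ∀ n gs → length gs ≡ suc n → constantTerm (suc n) gs ≈ expand gs (reduced n)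
  constantTerm-expand n gs p = begin
    Λ n (pad (suc n) gs) (V (suc n))
      ≈⟨ Λ-V-expansion n (pad (suc n) gs) ⟩
    alternating (λ i → lookup (pad (suc n) gs) i 0 * Λ n (lower i (pad (suc n) gs)) (V n))
      ≈⟨ alternating-cong (λ i → *-congˡ {lookup (pad (suc n) gs) i 0} (reflexive (≡.cong (λ hs → Λ n hs (V n)) (pad-toList (lower i (pad (suc n) gs)))))) ⟨
    alternating (λ i → lookup (pad (suc n) gs) i 0 * reduced n (toList (lower i (pad (suc n) gs))))
      ≈⟨ expand-alternating (pad (suc n) gs) (reduced n) ⟨
    expand (toList (pad (suc n) gs)) (reduced n)
      ≡⟨ ≡.cong (λ hs → expand hs (reduced n)) (toList-pad (suc n) gs p) ⟩
    expand gs (reduced n) ∎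

-- The sum over a single entry.

module RowSums (K : Ring₀) (u v : CommutativeRing.Carrier K) where
  open CommutativeRing K hiding (zero)
  open IntegerSolver K using (solve; _:=_; _:+_; _:*_; _:-_; :-_; con; :1)
  open Relation.Binary.Reasoning.Setoid setoid
  open Sums K
  open RowExpansion K u v public

  ∑-applyUpTo : ∀ {I : Set} n (e : ℕ → I) (F : I → Carrier) → ∑ (applyUpTo e n) F ≈ ∑ (upTo n) (F ∘ e)
  ∑-applyUpTo n e F = trans (reflexive (≡.cong (λ xs → ∑ xs F) (≡.sym (Listₚ.map-applyUpTo id e n)))) (∑-map e (upTo n) F)

  telescope : ∀ n (F D : ℕ → Carrier) → (∀ c → F c ≈ D (suc c) - D c) → ∑ (upTo n) F ≈ D n - D 0
  telescope zero    F D p = sym (-‿inverseʳ _)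
  telescope (suc n) F D p = begin
    F 0 + ∑ (applyUpTo suc n) F ≈⟨ +-cong (p 0) (∑-applyUpTo n suc F) ⟩
    (D 1 - D 0) + ∑ (upTo n) (F ∘ suc) ≈⟨ +-congˡ (telescope n (F ∘ suc) (D ∘ suc) (λ c → p (suc c))) ⟩
    (D 1 - D 0) + (D (suc n) - D 1) ≈⟨ solve 3 (λ a b c → (b :- a) :+ (c :- b) := c :- a) refl (D 0) (D 1) (D (suc n)) ⟩
    D (suc n) - D 0 ∎

  range : ℕ → List ℕ
  range B = List.map suc (upTo B)

  -- Entries are positive, so the partial sums start from D 1 = 0 and the total is the value just
  -- beyond the bound B.
  ∑-range : ∀ B (F D : ℕ → Carrier) → (∀ c → F c ≈ D (suc c) - D c) → D 1 ≈ 0# → ∑ (range B) F ≈ D (suc B)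
  ∑-range B F D p q = begin
    ∑ (range B) F ≈⟨ ∑-map suc (upTo B) F ⟩
    ∑ (upTo B) (F ∘ suc) ≈⟨ telescope B (F ∘ suc) (D ∘ suc) (λ c → p (suc c)) ⟩
    D (suc B) - D 1 ≈⟨ +-congˡ (-‿cong q) ⟩
    D (suc B) - 0# ≈⟨ solve 1 (λ a → a :- con 0ℤ := a) refl _ ⟩
    D (suc B) ∎

  indicator : Bool → Carrier
  indicator true  = 1#
  indicator false = 0#

  ≤ᵇ-true : ∀ {m n} → m ℕ.≤ n → (m ℕ.≤ᵇ n) ≡ true
  ≤ᵇ-true {m} {n} = dec-true (m ℕ.≤? n)

  ≤ᵇ-false : ∀ {m n} → n ℕ.< m → (m ℕ.≤ᵇ n) ≡ false
  ≤ᵇ-false {m} {n} p = dec-false (m ℕ.≤? n) (ℕₚ.<⇒≱ p)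

  ≡ᵇ-true : ∀ n → (n ℕ.≡ᵇ n) ≡ true
  ≡ᵇ-true n = dec-true (n ℕ.≟ n) ≡.refl

  ≡ᵇ-false : ∀ {m n} → m ≢ n → (m ℕ.≡ᵇ n) ≡ false
  ≡ᵇ-false {m} {n} = dec-false (m ℕ.≟ n)

  ∑-range-pick : ∀ B b (F : ℕ → Carrier) → 1 ℕ.≤ b → b ℕ.≤ B → ∑ (range B) (λ c → indicator (c ℕ.≡ᵇ b) * F c) ≈ F b
  ∑-range-pick B b F 1≤b b≤B = trans (∑-range B _ D step (trans (*-congʳ (reflexive (≡.cong indicator (≤ᵇ-false (ℕ.s≤s 1≤b))))) (zeroˡ _)))
    (trans (*-congʳ (reflexive (≡.cong indicator (≤ᵇ-true (ℕ.s≤s b≤B))))) (*-identityˡ _))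
    where
    D : ℕ → Carrier
    D c = indicator (suc b ℕ.≤ᵇ c) * F b
    step : ∀ c → indicator (c ℕ.≡ᵇ b) * F c ≈ D (suc c) - D c
    step c with ℕₚ.<-cmp c b
    ... | tri< c<b c≢b _ rewrite ≡ᵇ-false c≢b | ≤ᵇ-false (ℕ.s≤s c<b) | ≤ᵇ-false (ℕₚ.m<n⇒m<1+n c<b) =
            solve 2 (λ x y → con 0ℤ :* x := con 0ℤ :* y :- con 0ℤ :* y) refl (F c) (F b)
    ... | tri≈ _ ≡.refl _ rewrite ≡ᵇ-true c | ≤ᵇ-true (ℕₚ.≤-refl {suc c}) | ≤ᵇ-false (ℕₚ.n<1+n c) =
            solve 1 (λ x → :1 :* x := :1 :* x :- con 0ℤ :* x) refl (F c)
    ... | tri> _ c≢b b<c rewrite ≡ᵇ-false c≢b | ≤ᵇ-true (ℕₚ.m≤n⇒m≤1+n b<c) | ≤ᵇ-true b<c =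
            solve 2 (λ x y → con 0ℤ :* x := :1 :* y :- :1 :* y) refl (F c) (F b)

  mark : Carrier → Bool → Carrier
  mark t true  = t
  mark t false = 1#

  -- The weight of an entry c lying above the entries b and b′ of the next row (b′ may be missing).
  entryWeight : ℕ → Maybe ℕ → ℕ → Carrier
  entryWeight b b′ c = (indicator (b ℕ.≤ᵇ c) * mark v (c ℕ.≡ᵇ b)) * (indicator (leM (just c) b′) * mark u (eqM (just c) b′))

  -- A missing neighbour counts as infinitely large.
  data Before (c : ℕ) : Maybe ℕ → Set where
    none : Before c nothing
    some : ∀ {b} → c ℕ.< b → Before c (just b)

  entryWeight-below : ∀ {b b′ c} → c ℕ.< b → entryWeight b b′ c ≈ 0#
  entryWeight-below {b} {b′} {c} p = trans (*-congʳ (trans (*-congʳ (reflexive (≡.cong indicator (≤ᵇ-false p)))) (zeroˡ _))) (zeroˡ _)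

  before-weight : ∀ {b′ c} → Before c b′ → indicator (leM (just c) b′) * mark u (eqM (just c) b′) ≈ 1#
  before-weight none                 = *-identityˡ 1#
  before-weight (some p) rewrite ≤ᵇ-true (ℕₚ.<⇒≤ p) | ≡ᵇ-false (ℕₚ.<⇒≢ p) = *-identityˡ 1#

  entryWeight-left : ∀ {b b′} → Before b b′ → entryWeight b b′ b ≈ v
  entryWeight-left {b} p rewrite ≤ᵇ-true (ℕₚ.≤-refl {b}) | ≡ᵇ-true b = trans (*-congˡ (before-weight p)) (trans (*-identityʳ _) (*-identityˡ _))

  entryWeight-between : ∀ {b b′ c} → b ℕ.< c → Before c b′ → entryWeight b b′ c ≈ 1#
  entryWeight-between {b} {b′} {c} p s rewrite ≤ᵇ-true (ℕₚ.<⇒≤ p) | ≡ᵇ-false (ℕₚ.>⇒≢ p) = trans (*-congˡ (before-weight s)) (trans (*-identityʳ _) (*-identityˡ _))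

  entryWeight-right : ∀ {b b′} → b ℕ.< b′ → entryWeight b (just b′) b′ ≈ u
  entryWeight-right {b} {b′} p rewrite ≤ᵇ-true (ℕₚ.<⇒≤ p) | ≡ᵇ-false (ℕₚ.>⇒≢ p) | ≤ᵇ-true (ℕₚ.≤-refl {b′}) | ≡ᵇ-true b′ =
    trans (*-congʳ (*-identityˡ _)) (trans (*-identityˡ _) (*-identityˡ _))

  entryWeight-above : ∀ {b b′ c} → b′ ℕ.< c → entryWeight b (just b′) c ≈ 0#
  entryWeight-above {b} {b′} {c} p rewrite ≤ᵇ-false p = trans (*-congˡ (zeroˡ _)) (zeroʳ _)

  δ : PowerSeries
  δ zero    = 1#
  δ (suc _) = 0#

  pow : ℕ → PowerSeries
  pow zero    = δ
  pow (suc b) = 1+ 1# x (pow b)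

  pow-0 : ∀ b → pow b 0 ≈ 1#
  pow-0 zero    = refl
  pow-0 (suc b) = trans (+-cong (pow-0 b) (zeroʳ 1#)) (+-identityʳ 1#)

  -- The entry above b runs up to the next entry b′ of the lower row or, for the last entry of
  -- a truncated row, up to the bound B; then g is chosen such that both cases have the same sum.
  data Next (b B : ℕ) : Maybe ℕ → PowerSeries → Set where
    inner : ∀ {b′} → b ℕ.< b′ → b′ ℕ.≤ B → Next b B (just b′) (pow b′)
    outer : ∀ {g} → b ℕ.≤ B → r g ≐ pow (suc B) → g 0 ≈ 1# → Next b B nothing g

  Next-before : ∀ {b B b′ g} → Next b B b′ g → Before b b′
  Next-before (inner p _)   = some p
  Next-before (outer _ _ _) = none

  -- The partial sums over c < d are 0 for d ≤ b, then (1 + x)^d - l (1 + x)^b up to d = b′.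
  entry-sum : ∀ {b B b′ g} → 1 ℕ.≤ b → Next b B b′ g → ∀ k →
              ∑ (range B) (λ c → entryWeight b b′ c * X (pow c) k) ≈ r g k - l (pow b) k
  entry-sum {b} {B} 1≤b (outer {g} b≤B rg _) k = trans (∑-range B _ D step D-1) D-B
    where
    D : ℕ → Carrier
    D d = indicator (suc b ℕ.≤ᵇ d) * (pow d k - l (pow b) k)
    D-1 : D 1 ≈ 0#
    D-1 rewrite ≤ᵇ-false (ℕ.s≤s 1≤b) = zeroˡ _
    D-B : D (suc B) ≈ r g k - l (pow b) k
    D-B rewrite ≤ᵇ-true (ℕ.s≤s b≤B) = trans (*-identityˡ _) (+-congʳ (sym (rg k)))
    step : ∀ c → entryWeight b nothing c * X (pow c) k ≈ D (suc c) - D c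
    step c with ℕₚ.<-cmp c b
    ... | tri< c<b _ _ rewrite ≤ᵇ-false (ℕ.s≤s c<b) | ≤ᵇ-false (ℕₚ.m<n⇒m<1+n c<b) =
            trans (*-congʳ (entryWeight-below {b} {nothing} c<b)) (solve 3 (λ x y z → con 0ℤ :* x := con 0ℤ :* y :- con 0ℤ :* z) refl _ _ _)
    ... | tri≈ _ ≡.refl _ rewrite ≤ᵇ-true (ℕₚ.≤-refl {suc c}) | ≤ᵇ-false (ℕₚ.n<1+n c) =
            trans (*-congʳ (entryWeight-left {c} {nothing} none))
              (solve 4 (λ v p x z → v :* x := :1 :* ((p :+ :1 :* x) :- (p :+ (:1 :- v) :* x)) :- con 0ℤ :* z) refl v (pow c k) (X (pow c) k) _)
    ... | tri> _ _ b<c rewrite ≤ᵇ-true (ℕₚ.m≤n⇒m≤1+n b<c) | ≤ᵇ-true b<c =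
            trans (*-congʳ (entryWeight-between {b} {nothing} b<c none))
              (solve 3 (λ p x q → :1 :* x := :1 :* ((p :+ :1 :* x) :- q) :- :1 :* (p :- q)) refl (pow c k) (X (pow c) k) (l (pow b) k))
  entry-sum {b} {B} 1≤b (inner {b′} b<b′ b′≤B) k = trans (∑-range B _ D step D-1) D-B
    where
    -- The entry b′ has weight u in place of 1, which makes the last increment turn (1 + x) ^ b′
    -- into r (1 + x) ^ b′. From there on the value is frozen, because larger entries have weight 0.
    T : ℕ → Carrier
    T d = indicator (suc b′ ℕ.≤ᵇ d) * (r (pow b′) k - l (pow b) k) + (1# - indicator (suc b′ ℕ.≤ᵇ d)) * (pow d k - l (pow b) k)
    D : ℕ → Carrier
    D d = indicator (suc b ℕ.≤ᵇ d) * T d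
    D-1 : D 1 ≈ 0#
    D-1 rewrite ≤ᵇ-false (ℕ.s≤s 1≤b) = zeroˡ _
    D-B : D (suc B) ≈ r (pow b′) k - l (pow b) k
    D-B rewrite ≤ᵇ-true (ℕ.s≤s (ℕₚ.≤-trans (ℕₚ.<⇒≤ b<b′) b′≤B)) | ≤ᵇ-true (ℕ.s≤s b′≤B) =
      solve 2 (λ x y → :1 :* (:1 :* x :+ (:1 :- :1) :* y) := x) refl _ _
    step : ∀ c → entryWeight b (just b′) c * X (pow c) k ≈ D (suc c) - D c
    step c with ℕₚ.<-cmp c b
    ... | tri< c<b _ _ rewrite ≤ᵇ-false (ℕ.s≤s c<b) | ≤ᵇ-false (ℕₚ.m<n⇒m<1+n c<b) =
            trans (*-congʳ (entryWeight-below {b} {just b′} c<b)) (solve 3 (λ x y z → con 0ℤ :* x := con 0ℤ :* y :- con 0ℤ :* z) refl _ _ _)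
    ... | tri≈ _ ≡.refl _ rewrite ≤ᵇ-true (ℕₚ.≤-refl {suc c}) | ≤ᵇ-false (ℕₚ.n<1+n c) | ≤ᵇ-false (ℕ.s≤s b<b′) =
            trans (*-congʳ (entryWeight-left {c} (some b<b′)))
              (solve 5 (λ v p x y z → v :* x := :1 :* (con 0ℤ :* y :+ (:1 :- con 0ℤ) :* ((p :+ :1 :* x) :- (p :+ (:1 :- v) :* x))) :- con 0ℤ :* z)
                refl v (pow c k) (X (pow c) k) _ _)
    ... | tri> _ _ b<c rewrite ≤ᵇ-true (ℕₚ.m≤n⇒m≤1+n b<c) | ≤ᵇ-true b<c with ℕₚ.<-cmp c b′
    ...   | tri< c<b′ _ _ rewrite ≤ᵇ-false (ℕ.s≤s c<b′) | ≤ᵇ-false (ℕₚ.m<n⇒m<1+n c<b′) =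
            trans (*-congʳ (entryWeight-between b<c (some c<b′)))
              (solve 4 (λ p x q y → :1 :* x := :1 :* (con 0ℤ :* y :+ (:1 :- con 0ℤ) :* ((p :+ :1 :* x) :- q)) :- :1 :* (con 0ℤ :* y :+ (:1 :- con 0ℤ) :* (p :- q)))
                refl (pow c k) (X (pow c) k) (l (pow b) k) _)
    ...   | tri≈ _ ≡.refl _ rewrite ≤ᵇ-true (ℕₚ.≤-refl {suc c}) | ≤ᵇ-false (ℕₚ.n<1+n c) =
            trans (*-congʳ (entryWeight-right b<c))
              (solve 5 (λ u p x q y → u :* x := :1 :* (:1 :* ((p :+ u :* x) :- q) :+ (:1 :- :1) :* y) :- :1 :* (con 0ℤ :* ((p :+ u :* x) :- q) :+ (:1 :- con 0ℤ) :* (p :- q)))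
                refl u (pow c k) (X (pow c) k) (l (pow b) k) _)
    ...   | tri> _ _ b′<c rewrite ≤ᵇ-true (ℕₚ.m≤n⇒m≤1+n b′<c) | ≤ᵇ-true b′<c =
            trans (*-congʳ (entryWeight-above {b} b′<c))
              (solve 4 (λ z x y w → con 0ℤ :* z := :1 :* (:1 :* x :+ (:1 :- :1) :* y) :- :1 :* (:1 :* x :+ (:1 :- :1) :* w)) refl _ _ _ _)

-- The sum over a whole row.

module RowTheorem (K : Ring₀) (u v : CommutativeRing.Carrier K) where
  open CommutativeRing K hiding (zero)
  open IntegerSolver K using (solve; _:=_; _:+_; _:*_; _:-_; :-_; con; :1)
  open Relation.Binary.Reasoning.Setoid setoid
  open Sums K
  open RowSums K u v public

  ascent : ℕ → Maybe ℕ → Carrier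
  ascent c c′ = indicator (ltM (just c) c′)

  -- It is 0 unless cs is increasing and interlaces with bs.
  rowWeight : List ℕ → List ℕ → Carrier
  rowWeight bs       []       = 1#
  rowWeight []       (c ∷ cs) = 0#
  rowWeight (b ∷ bs) (c ∷ cs) = entryWeight b (at bs 0) c * (ascent c (at cs 0) * rowWeight bs cs)

  ∑-choices : ∀ {I : Set} (R : List I) Rs (F : List I → Carrier) → ∑ (choices (R ∷ Rs)) F ≈ ∑ R (λ c → ∑ (choices Rs) (λ cs → F (c ∷ cs)))
  ∑-choices R Rs F = trans (∑-concatMap _ R F) (∑-cong R (λ c → ∑-map (c ∷_) (choices Rs) F))

  ∑-choices-[] : ∀ {I : Set} (F : List I → Carrier) → ∑ (choices []) F ≈ F []
  ∑-choices-[] F = +-identityʳ _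

  XPow : ℕ → PowerSeries
  XPow c = X (pow c)

  rowSum : List ℕ → List ℕ → List PowerSeries → Functional → Carrier
  rowSum bs Bs tl M = ∑ (choices (List.map range Bs)) (λ cs → rowWeight bs cs * M (List.map XPow cs ++ tl))

  -- Bs are the bounds on the entries above bs, gs the series of the lower row, and tl the series
  -- left unchanged by the summation over the upper row.
  data Chain : (bs Bs : List ℕ) (gs tl : List PowerSeries) → Set where
    closed : ∀ {b} → Chain (b ∷ []) [] (pow b ∷ []) []
    open′  : ∀ {g rest} → g 0 ≈ 1# → All (λ h → h 0 ≈ 0#) rest → Chain [] [] (g ∷ rest) (List.map r rest)
    link   : ∀ {b bs B Bs g gs tl} → 1 ℕ.≤ b → Next b B (at bs 0) g → Chain bs Bs (g ∷ gs) tl → Chain (b ∷ bs) (B ∷ Bs) (pow b ∷ g ∷ gs) tl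

  -- This ends the expansion of an open chain: the extra series after the first are divisible by x,
  -- so omitting one of them contributes nothing.
  expand-zero : ∀ gs M → All (λ h → h 0 ≈ 0#) gs → expand gs M ≈ 0#
  expand-zero []       M []       = refl
  expand-zero (g ∷ gs) M (p ∷ ps) = trans (+-cong (trans (*-congʳ p) (zeroˡ _)) (-‿cong (expand-zero gs _ ps)))
    (solve 0 (con 0ℤ :- con 0ℤ := con 0ℤ) refl)

  expand-neg-* : ∀ gs c (M : Functional) → expand gs (λ hs → - (c * M hs)) ≈ - (c * expand gs M)
  expand-neg-* []       c M = solve 1 (λ c → con 0ℤ := :- (c :* con 0ℤ)) refl c
  expand-neg-* (g ∷ gs) c M = trans (+-congˡ (-‿cong (expand-neg-* gs c (λ hs → M (l g ∷ hs)))))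
    (solve 4 (λ g c m e → g :* (:- (c :* m)) :- (:- (c :* e)) := :- (c :* (g :* m :- e))) refl (g 0) c _ _)

  expand-minus : ∀ gs (M M′ : Functional) → expand gs (λ hs → M hs - M′ hs) ≈ expand gs M - expand gs M′
  expand-minus []       M M′ = solve 0 (con 0ℤ := con 0ℤ :- con 0ℤ) refl
  expand-minus (g ∷ gs) M M′ = trans (+-congˡ (-‿cong (expand-minus gs (λ hs → M (l g ∷ hs)) (λ hs → M′ (l g ∷ hs)))))
    (solve 5 (λ g m m′ e e′ → g :* (m :- m′) :- (e :- e′) := (g :* m :- e) :- (g :* m′ :- e′)) refl (g 0) _ _ _ _)

  expand-∑ : ∀ (xs : List ℕ) (c : ℕ → Carrier) gs (M : ℕ → Functional) →
    ∑ xs (λ x → c x * expand gs (M x)) ≈ expand gs (λ hs → ∑ xs (λ x → c x * M x hs))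
  expand-∑ xs c []       M = ∑-zero xs (λ x → zeroʳ _)
  expand-∑ xs c (g ∷ gs) M = begin
    ∑ xs (λ x → c x * (g 0 * M x (List.map r gs) - expand gs (λ hs → M x (l g ∷ hs))))
      ≈⟨ ∑-cong xs (λ x → solve 4 (λ c g m e → c :* (g :* m :- e) := g :* (c :* m) :+ (:- (c :* e))) refl (c x) (g 0) _ _) ⟩
    ∑ xs (λ x → g 0 * (c x * M x (List.map r gs)) + - (c x * expand gs (λ hs → M x (l g ∷ hs))))
      ≈⟨ ∑-+ xs _ _ ⟩
    _ ≈⟨ +-cong (∑-*ˡ xs (g 0) _) (trans (∑-neg xs _) (-‿cong (expand-∑ xs c gs (λ x hs → M x (l g ∷ hs))))) ⟩
    g 0 * ∑ xs (λ x → c x * M x (List.map r gs)) - expand gs (λ hs → ∑ xs (λ x → c x * M x (l g ∷ hs))) ∎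

  module _ {M : Functional} (lin : LinearInFirst M) where
    open LinearInFirst lin

    linear-∑ : ∀ (xs : List ℕ) (c : ℕ → Carrier) (g : ℕ → PowerSeries) hs →
      ∑ xs (λ x → c x * M (g x ∷ hs)) ≈ M ((λ k → ∑ xs (λ x → c x * g x k)) ∷ hs)
    linear-∑ [] c g hs = sym (begin
      M ((λ k → 0#) ∷ hs) ≈⟨ M-≐ hs (λ k → sym (zeroˡ 0#)) ⟩
      M (0# · (λ k → 0#) ∷ hs) ≈⟨ M-· 0# _ hs ⟩
      0# * M ((λ k → 0#) ∷ hs) ≈⟨ zeroˡ _ ⟩
      0# ∎)
    linear-∑ (x ∷ xs) c g hs = begin
      c x * M (g x ∷ hs) + ∑ xs (λ x → c x * M (g x ∷ hs))
        ≈⟨ +-cong (sym (M-· (c x) (g x) hs)) (linear-∑ xs c g hs) ⟩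
      M (c x · g x ∷ hs) + M ((λ k → ∑ xs (λ x → c x * g x k)) ∷ hs) ≈⟨ M-⊕ (c x · g x) _ hs ⟨
      M (c x · g x ⊕ (λ k → ∑ xs (λ x → c x * g x k)) ∷ hs) ≈⟨ M-≐ hs (λ k → refl) ⟩
      M ((λ k → ∑ (x ∷ xs) (λ x → c x * g x k)) ∷ hs) ∎

    linear-minus : ∀ {f} g h hs → (∀ k → f k ≈ g k - h k) → M (f ∷ hs) ≈ M (g ∷ hs) - M (h ∷ hs)
    linear-minus {f} g h hs p = begin
      M (f ∷ hs) ≈⟨ M-≐ hs (λ k → trans (p k) (solve 2 (λ a b → a :- b := a :+ (:- :1) :* b) refl _ _)) ⟩
      M (g ⊕ (- 1#) · h ∷ hs) ≈⟨ M-⊕ g ((- 1#) · h) hs ⟩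
      M (g ∷ hs) + M ((- 1#) · h ∷ hs) ≈⟨ +-congˡ (M-· (- 1#) h hs) ⟩
      M (g ∷ hs) + (- 1#) * M (h ∷ hs) ≈⟨ solve 2 (λ a b → a :+ (:- :1) :* b := a :- b) refl _ _ ⟩
      M (g ∷ hs) - M (h ∷ hs) ∎

    first-entry : ∀ {b B b′ g} hs → 1 ℕ.≤ b → Next b B b′ g →
      ∑ (range B) (λ c → entryWeight b b′ c * M (XPow c ∷ hs)) ≈ M (r g ∷ hs) - M (l (pow b) ∷ hs)
    first-entry {b} {B} {b′} {g} hs 1≤b next = trans (linear-∑ (range B) (entryWeight b b′) XPow hs)
      (linear-minus (r g) (l (pow b)) hs (entry-sum 1≤b next))

  ascent-true : ∀ {c c′} → c ℕ.< c′ → ascent c (just c′) ≈ 1#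
  ascent-true p = reflexive (≡.cong indicator (≤ᵇ-true p))

  -- If b precedes bs, then an entry b above it is smaller than all entries above bs.
  ascent-free : ∀ {b bs} cs → Before b (at bs 0) → ascent b (at cs 0) * rowWeight bs cs ≈ rowWeight bs cs
  ascent-free                 []       _        = *-identityˡ _
  ascent-free {bs = []}       (c ∷ cs) _        = zeroʳ _
  ascent-free {b} {b′ ∷ bs}   (c ∷ cs) (some p) with ℕₚ.<-cmp c b′
  ... | tri< c<b′ _ _ = trans (*-congˡ zero-weight) (trans (zeroʳ _) (sym zero-weight))
    where
    zero-weight : rowWeight (b′ ∷ bs) (c ∷ cs) ≈ 0#
    zero-weight = trans (*-congʳ (entryWeight-below {b′} {at bs 0} c<b′)) (zeroˡ _)
  ... | tri≈ _ ≡.refl _ = trans (*-congʳ (ascent-true p)) (*-identityˡ _)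
  ... | tri> _ _ b′<c   = trans (*-congʳ (ascent-true (ℕₚ.<-trans p b′<c))) (*-identityˡ _)

  -- Next to c ≤ b′, the only increasing pair excluded by c < c′ is c = b′ = c′.
  exclusion : ∀ b b′ {b″} c c′ F →
    entryWeight b (just b′) c * (ascent c (just c′) * (entryWeight b′ b″ c′ * F)) ≈
    entryWeight b (just b′) c * (entryWeight b′ b″ c′ * F
      - indicator (c ℕ.≡ᵇ b′) * (indicator (c′ ℕ.≡ᵇ b′) * (entryWeight b′ b″ c′ * F)))
  exclusion b b′ {b″} c c′ F with ℕₚ.<-cmp c b′ | ℕₚ.<-cmp c′ b′
  ... | tri> _ _ b′<c | _ = trans (*-congʳ z) (trans (zeroˡ _) (sym (trans (*-congʳ z) (zeroˡ _))))
    where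
    z : entryWeight b (just b′) c ≈ 0#
    z = entryWeight-above {b} b′<c
  ... | tri< _ _ _ | tri< c′<b′ _ _ = *-congˡ (trans (*-congˡ z) (trans (zeroʳ _)
          (sym (trans (+-cong z (-‿cong (*-congˡ (*-congˡ z)))) (solve 2 (λ x y → con 0ℤ :- x :* (y :* con 0ℤ) := con 0ℤ) refl _ _)))))
    where
    z : entryWeight b′ b″ c′ * F ≈ 0#
    z = trans (*-congʳ (entryWeight-below {b′} {b″} c′<b′)) (zeroˡ _)
  ... | tri≈ _ _ _ | tri< c′<b′ _ _ = *-congˡ (trans (*-congˡ z) (trans (zeroʳ _)
          (sym (trans (+-cong z (-‿cong (*-congˡ (*-congˡ z)))) (solve 2 (λ x y → con 0ℤ :- x :* (y :* con 0ℤ) := con 0ℤ) refl _ _)))))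
    where
    z : entryWeight b′ b″ c′ * F ≈ 0#
    z = trans (*-congʳ (entryWeight-below {b′} {b″} c′<b′)) (zeroˡ _)
  ... | tri< c<b′ c≢b′ _ | tri≈ _ ≡.refl _ rewrite ≡ᵇ-false c≢b′ = *-congˡ (trans (*-congʳ (ascent-true c<b′))
          (solve 2 (λ x y → :1 :* x := x :- con 0ℤ :* y) refl _ _))
  ... | tri< c<b′ c≢b′ _ | tri> _ _ b′<c′ rewrite ≡ᵇ-false c≢b′ = *-congˡ (trans (*-congʳ (ascent-true (ℕₚ.<-trans c<b′ b′<c′)))
          (solve 2 (λ x y → :1 :* x := x :- con 0ℤ :* y) refl _ _))
  ... | tri≈ _ ≡.refl _ | tri≈ _ ≡.refl _ rewrite ≡ᵇ-true b′ | ≤ᵇ-false (ℕₚ.n<1+n b′) = *-congˡ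
          (solve 1 (λ x → con 0ℤ :* x := x :- :1 :* (:1 :* x)) refl _)
  ... | tri≈ _ ≡.refl _ | tri> _ c′≢b′ b′<c′ rewrite ≡ᵇ-true b′ | ≡ᵇ-false c′≢b′ = *-congˡ (trans (*-congʳ (ascent-true b′<c′))
          (solve 1 (λ x → :1 :* x := x :- :1 :* (con 0ℤ :* x)) refl _))

  rowSum-unfold : ∀ b bs B Bs tl M → rowSum (b ∷ bs) (B ∷ Bs) tl M ≈
    ∑ (range B) (λ c → ∑ (choices (List.map range Bs)) (λ cs →
      (entryWeight b (at bs 0) c * (ascent c (at cs 0) * rowWeight bs cs)) * M (XPow c ∷ List.map XPow cs ++ tl)))
  rowSum-unfold b bs B Bs tl M = ∑-choices (range B) (List.map range Bs) _

  rowSum-[] : ∀ bs tl M → rowSum bs [] tl M ≈ M tl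
  rowSum-[] bs tl M = trans (∑-choices-[] {ℕ} (λ cs → rowWeight bs cs * M (List.map XPow cs ++ tl))) (*-identityˡ _)

  -- Inclusion-exclusion over the configuration c = b′ = c′ of the first two entries.
  rowSum-step : ∀ b b′ bs B B′ Bs tl M → 1 ℕ.≤ b → b ℕ.< b′ → b′ ℕ.≤ B → b′ ℕ.≤ B′ → Before b′ (at bs 0) →
    rowSum (b ∷ b′ ∷ bs) (B ∷ B′ ∷ Bs) tl M ≈
    ∑ (range B) (λ c → entryWeight b (just b′) c * rowSum (b′ ∷ bs) (B′ ∷ Bs) tl (λ hs → M (XPow c ∷ hs)))
      - (u * v) * rowSum bs Bs tl (λ hs → M (XPow b′ ∷ XPow b′ ∷ hs))
  rowSum-step b b′ bs B B′ Bs tl M 1≤b b<b′ b′≤B b′≤B′ before = begin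
    rowSum (b ∷ b′ ∷ bs) (B ∷ B′ ∷ Bs) tl M
      ≈⟨ rowSum-unfold b (b′ ∷ bs) B (B′ ∷ Bs) tl M ⟩
    ∑ (range B) (λ c → ∑ (choices (List.map range (B′ ∷ Bs))) (λ cs →
      (w c * (ascent c (at cs 0) * rowWeight (b′ ∷ bs) cs)) * M (XPow c ∷ List.map XPow cs ++ tl)))
      ≈⟨ ∑-cong (range B) (λ c → trans (∑-choices (range B′) Rs _) (trans (∑-cong (range B′) (λ c′ →
           trans (∑-cong Cs (λ cs → split c c′ cs)) (trans (∑-+ Cs _ _) (+-cong (∑-*ˡ Cs (w c) _) (∑-*ˡ Cs (indicator (c ℕ.≡ᵇ b′) * - w c) _)))))
           (trans (∑-+ (range B′) _ _) (+-cong (∑-*ˡ (range B′) (w c) _) (∑-*ˡ (range B′) (indicator (c ℕ.≡ᵇ b′) * - w c) _))))) ⟩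
    ∑ (range B) (λ c → w c * ∑ (range B′) (λ c′ → ∑ Cs (λ cs → S c c′ cs))
            + (indicator (c ℕ.≡ᵇ b′) * - w c) * ∑ (range B′) (λ c′ → ∑ Cs (λ cs → indicator (c′ ℕ.≡ᵇ b′) * S c c′ cs)))
      ≈⟨ ∑-cong (range B) (λ c → +-cong (*-congˡ (sym (∑-choices (range B′) Rs _)))
           (trans (*-congˡ (trans (∑-cong (range B′) (λ c′ → ∑-*ˡ Cs (indicator (c′ ℕ.≡ᵇ b′)) (S c c′)))
             (∑-range-pick B′ b′ (λ c′ → ∑ Cs (S c c′)) 1≤b′ b′≤B′))) (*-assoc _ _ _))) ⟩
    ∑ (range B) (λ c → w c * rowSum (b′ ∷ bs) (B′ ∷ Bs) tl (λ hs → M (XPow c ∷ hs)) + indicator (c ℕ.≡ᵇ b′) * (- w c * ∑ Cs (S c b′)))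
      ≈⟨ ∑-+ (range B) _ _ ⟩
    _ ≈⟨ +-congˡ (∑-range-pick B b′ (λ c → - w c * ∑ Cs (S c b′)) 1≤b′ b′≤B) ⟩
    main + (- w b′ * ∑ Cs (S b′ b′))
      -- In the excluded configuration c equals the entry on its right, with weight u, and c′ the
      -- entry on its left, with weight v. The comparison of c′ with its successor is then automatic
      -- by `ascent-free`.
      ≈⟨ +-congˡ (*-cong (-‿cong (entryWeight-right b<b′)) (trans (∑-cong Cs corrected) (∑-*ˡ Cs v _))) ⟩
    main + (- u * (v * rowSum bs Bs tl (λ hs → M (XPow b′ ∷ XPow b′ ∷ hs))))
      ≈⟨ solve 4 (λ m u v s → m :+ (:- u) :* (v :* s) := m :- (u :* v) :* s) refl main u v _ ⟩
    main - (u * v) * rowSum bs Bs tl (λ hs → M (XPow b′ ∷ XPow b′ ∷ hs)) ∎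
    where
    Rs = List.map range Bs
    Cs = choices Rs
    1≤b′ = ℕₚ.≤-trans 1≤b (ℕₚ.<⇒≤ b<b′)
    w : ℕ → Carrier
    w = entryWeight b (just b′)
    S : ℕ → ℕ → List ℕ → Carrier
    S c c′ cs = rowWeight (b′ ∷ bs) (c′ ∷ cs) * M (XPow c ∷ XPow c′ ∷ List.map XPow cs ++ tl)
    main : Carrier
    main = ∑ (range B) (λ c → w c * rowSum (b′ ∷ bs) (B′ ∷ Bs) tl (λ hs → M (XPow c ∷ hs)))
    split : ∀ c c′ cs → (w c * (ascent c (just c′) * rowWeight (b′ ∷ bs) (c′ ∷ cs))) * M (XPow c ∷ XPow c′ ∷ List.map XPow cs ++ tl)
      ≈ w c * S c c′ cs + (indicator (c ℕ.≡ᵇ b′) * - w c) * (indicator (c′ ℕ.≡ᵇ b′) * S c c′ cs)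
    split c c′ cs = trans (*-congʳ (exclusion b b′ {at bs 0} c c′ (ascent c′ (at cs 0) * rowWeight bs cs)))
      (solve 5 (λ w i j s m → (w :* (s :- i :* (j :* s))) :* m := w :* (s :* m) :+ (i :* (:- w)) :* (j :* (s :* m)))
        refl (w c) (indicator (c ℕ.≡ᵇ b′)) (indicator (c′ ℕ.≡ᵇ b′)) (rowWeight (b′ ∷ bs) (c′ ∷ cs)) _)
    corrected : ∀ cs → S b′ b′ cs ≈ v * (rowWeight bs cs * M (XPow b′ ∷ XPow b′ ∷ List.map XPow cs ++ tl))
    corrected cs = trans (*-congʳ (*-cong (entryWeight-left before) (ascent-free {b′} {bs} cs before))) (*-assoc _ _ _)

  -- Induction along the chain. The later entries are expanded before the first one is summed, so
  -- that this last sum needs only linearity in the first slot. The correction term of `rowSum-step`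
  -- is a row sum with two entries fewer, which is why the hypothesis is also applied to `chain′`.
  rowSum-expand : ∀ {bs Bs gs tl} → Chain bs Bs gs tl → ∀ M → Good (length Bs) M → rowSum bs Bs tl M ≈ expand gs M
  rowSum-expand (closed {b}) M _ = trans (rowSum-[] (b ∷ []) [] M)
    (trans (solve 1 (λ m → m := :1 :* m :- con 0ℤ) refl _) (+-congʳ (*-congʳ (sym (pow-0 b)))))
  rowSum-expand (open′ {g} {rest} g0 zeros) M _ = trans (rowSum-[] [] (List.map r rest) M)
    (trans (solve 1 (λ m → m := :1 :* m :- con 0ℤ) refl _) (sym (+-cong (*-congʳ g0) (-‿cong (expand-zero rest _ zeros)))))
  rowSum-expand (link {b} {bs} {B} {[]} {g} {gs} {tl} 1≤b next chain) M (lin , coll , good) = begin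
    rowSum (b ∷ bs) (B ∷ []) tl M
      ≈⟨ rowSum-unfold b bs B [] tl M ⟩
    ∑ (range B) (λ c → ∑ (choices []) (F c))
      ≈⟨ ∑-cong (range B) (λ c → trans (∑-choices-[] (F c)) (*-congʳ (trans (*-congˡ (*-identityˡ 1#)) (*-identityʳ _)))) ⟩
    ∑ (range B) (λ c → entryWeight b (at bs 0) c * M (XPow c ∷ tl))
      ≈⟨ first-entry lin tl 1≤b next ⟩
    M (r g ∷ tl) - M (l (pow b) ∷ tl)
      ≈⟨ +-congˡ (-‿cong (trans (sym (rowSum-[] bs tl (λ hs → M (l (pow b) ∷ hs)))) (rowSum-expand chain (λ hs → M (l (pow b) ∷ hs)) tt))) ⟩
    M (r g ∷ tl) - expand (g ∷ gs) (λ hs → M (l (pow b) ∷ hs))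
      ≈⟨ +-congʳ (trans (sym (*-identityˡ _)) (*-cong (sym (pow-0 b)) (reflexive (≡.cong (λ hs → M (r g ∷ hs)) (tail-series chain))))) ⟩
    expand (pow b ∷ g ∷ gs) M ∎
    where
    F : ℕ → List ℕ → Carrier
    -- With no further bounds the chain has ended, so `tl` consists of the slots after g with `r`
    -- applied, which is what the leading term of `expand` requires.
    F c cs = (entryWeight b (at bs 0) c * (ascent c (at cs 0) * rowWeight bs cs)) * M (XPow c ∷ List.map XPow cs ++ tl)
    tail-series : ∀ {bs g gs tl} → Chain bs [] (g ∷ gs) tl → tl ≡ List.map r gs
    tail-series closed      = ≡.refl
    tail-series (open′ _ _) = ≡.refl
  rowSum-expand (link {b} {b′ ∷ bs} {B} {B′ ∷ Bs} {_} {g₂ ∷ gs} {tl} 1≤b (inner b<b′ b′≤B) chain@(link 1≤b′ next chain′)) M (lin , coll , good) = begin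
    rowSum (b ∷ b′ ∷ bs) (B ∷ B′ ∷ Bs) tl M
      ≈⟨ rowSum-step b b′ bs B B′ Bs tl M 1≤b b<b′ b′≤B (bound next) (Next-before next) ⟩
    ∑ (range B) (λ c → w c * rowSum (b′ ∷ bs) (B′ ∷ Bs) tl (λ hs → M (XPow c ∷ hs)))
      - (u * v) * rowSum bs Bs tl (λ hs → M (XPow b′ ∷ XPow b′ ∷ hs))
      ≈⟨ +-cong (∑-cong (range B) (λ c → *-congˡ (rowSum-expand chain (λ hs → M (XPow c ∷ hs)) (good (XPow c)))))
           (-‿cong (*-congˡ (rowSum-expand chain′ (λ hs → M (XPow b′ ∷ XPow b′ ∷ hs)) (proj₂ (proj₂ (good (XPow b′))) (XPow b′))))) ⟩
    ∑ (range B) (λ c → w c * expand (g ∷ g₂ ∷ gs) (λ hs → M (XPow c ∷ hs))) - (u * v) * E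
      ≈⟨ +-congʳ (trans (expand-∑ (range B) w (g ∷ g₂ ∷ gs) (λ c hs → M (XPow c ∷ hs)))
           (trans (expand-cong (g ∷ g₂ ∷ gs) (λ hs → first-entry lin hs 1≤b (inner b<b′ b′≤B)))
             (expand-minus (g ∷ g₂ ∷ gs) (λ hs → M (r g ∷ hs)) (λ hs → M (l (pow b) ∷ hs))))) ⟩
    ((g 0 * M (r g ∷ r g₂ ∷ List.map r gs) - expand (g₂ ∷ gs) (λ hs → M (r g ∷ l g ∷ hs))) - L) - (u * v) * E
      -- The terms with `r g` and `l g` side by side use b′ twice. By `coll` they add up to + (u *
      -- v) * E, which the correction for c = b′ = c′ cancels.
      ≈⟨ +-congʳ (+-congʳ (+-cong (*-congʳ (pow-0 b′)) (-‿cong (trans (expand-cong (g₂ ∷ gs) (λ hs → collide hs))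
           (expand-neg-* (g₂ ∷ gs) (u * v) (λ hs → M (X g ∷ X g ∷ hs))))))) ⟩
    ((1# * M (r g ∷ r g₂ ∷ List.map r gs) - - ((u * v) * E)) - L) - (u * v) * E
      ≈⟨ solve 3 (λ m e l → ((:1 :* m :- (:- e)) :- l) :- e := :1 :* m :- l) refl _ ((u * v) * E) L ⟩
    1# * M (r g ∷ r g₂ ∷ List.map r gs) - L
      ≈⟨ +-congʳ (*-congʳ (pow-0 b)) ⟨
    expand (pow b ∷ g ∷ g₂ ∷ gs) M ∎
    where
    g = pow b′
    w : ℕ → Carrier
    w = entryWeight b (just b′)
    E L : Carrier
    E = expand (g₂ ∷ gs) (λ hs → M (XPow b′ ∷ XPow b′ ∷ hs))
    L = expand (g ∷ g₂ ∷ gs) (λ hs → M (l (pow b) ∷ hs))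
    bound : ∀ {b B m h} → Next b B m h → b ℕ.≤ B
    bound (inner p q)   = ℕₚ.≤-trans (ℕₚ.<⇒≤ p) q
    bound (outer p _ _) = p
    collide : ∀ hs → M (r g ∷ l g ∷ hs) ≈ - ((u * v) * M (X g ∷ X g ∷ hs))
    collide hs = trans (solve 2 (λ a b → a := (a :+ b) :+ :- b) refl _ _) (trans (+-congʳ (coll g hs)) (+-identityˡ _))

-- The recursion satisfied by the constant term.

bounds : ℕ → ℕ → List ℕ
bounds a zero    = []
bounds a (suc n) = a ∷ bounds (suc a) n

length-bounds : ∀ a n → length (bounds a n) ≡ n
length-bounds a zero    = ≡.refl
length-bounds a (suc n) = ≡.cong suc (length-bounds (suc a) n)

-- The series (1 + u x)^(-j), of which only these two relations are needed.
record InversePowers (K : Ring₀) (u v : CommutativeRing.Carrier K) : Set where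
  open RowTheorem K u v
  field
    inverse      : ℕ → PowerSeries
    inverse-zero : inverse 0 ≐ δ
    inverse-suc  : ∀ j → r (inverse (suc j)) ≐ inverse j

module Recursion (K : Ring₀) (u v : CommutativeRing.Carrier K) (powers : InversePowers K u v) where
  open CommutativeRing K hiding (zero)
  open IntegerSolver K using (solve; _:=_; _:+_; _:*_; _:-_; :-_; con; :1)
  open Relation.Binary.Reasoning.Setoid setoid
  open Sums K
  open RowTheorem K u v public
  open InversePowers powers public

  binomials : ℕ → PowerSeries → PowerSeries
  binomials zero    g = g
  binomials (suc a) g = 1+ 1# x (binomials a g)

  shift : ℕ → PowerSeries → PowerSeries
  shift zero    g = g
  shift (suc j) g = X (shift j g)

  1+x-cong : ∀ c {g h} → g ≐ h → 1+ c x g ≐ 1+ c x h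
  1+x-cong c p zero    = +-congʳ (p 0)
  1+x-cong c p (suc k) = +-cong (p (suc k)) (*-congˡ (p k))

  X-cong : ∀ {g h} → g ≐ h → X g ≐ X h
  X-cong p zero    = refl
  X-cong p (suc k) = p k

  binomials-cong : ∀ a {g h} → g ≐ h → binomials a g ≐ binomials a h
  binomials-cong zero    p = p
  binomials-cong (suc a) p = 1+x-cong 1# (binomials-cong a p)

  shift-cong : ∀ j {g h} → g ≐ h → shift j g ≐ shift j h
  shift-cong zero    p = p
  shift-cong (suc j) p = X-cong (shift-cong j p)

  ≐-trans : ∀ {f g h} → f ≐ g → g ≐ h → f ≐ h
  ≐-trans p q k = trans (p k) (q k)

  ≐-refl : ∀ {g} → g ≐ g
  ≐-refl k = refl

  ≐-≡ : ∀ {g h : PowerSeries} → g ≡ h → g ≐ h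
  ≐-≡ ≡.refl k = refl

  pow-binomials : ∀ b → pow b ≐ binomials b δ
  pow-binomials zero    = ≐-refl
  pow-binomials (suc b) = 1+x-cong 1# (pow-binomials b)

  1+x-X : ∀ c g → 1+ c x (X g) ≐ X (1+ c x g)
  1+x-X c g zero          = solve 1 (λ c → con 0ℤ :+ c :* con 0ℤ := con 0ℤ) refl c
  1+x-X c g (suc zero)    = refl
  1+x-X c g (suc (suc k)) = refl

  1+x-comm : ∀ c d g → 1+ c x (1+ d x g) ≐ 1+ d x (1+ c x g)
  1+x-comm c d g zero          = solve 3 (λ c d g → (g :+ d :* con 0ℤ) :+ c :* con 0ℤ := (g :+ c :* con 0ℤ) :+ d :* con 0ℤ) refl c d (g 0)
  1+x-comm c d g (suc zero)    = solve 4 (λ c d g h → (h :+ d :* g) :+ c :* (g :+ d :* con 0ℤ) := (h :+ c :* g) :+ d :* (g :+ c :* con 0ℤ)) refl c d (g 0) (g 1)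
  1+x-comm c d g (suc (suc k)) = solve 5 (λ c d g h i → (i :+ d :* h) :+ c :* (h :+ d :* g) := (i :+ c :* h) :+ d :* (h :+ c :* g)) refl c d (g k) (g (suc k)) (g (suc (suc k)))

  1+x-binomials : ∀ c a g → 1+ c x (binomials a g) ≐ binomials a (1+ c x g)
  1+x-binomials c zero    g = ≐-refl
  1+x-binomials c (suc a) g = ≐-trans (1+x-comm c 1# (binomials a g)) (1+x-cong 1# (1+x-binomials c a g))

  1+x-shift : ∀ c j g → 1+ c x (shift j g) ≐ shift j (1+ c x g)
  1+x-shift c zero    g = ≐-refl
  1+x-shift c (suc j) g = ≐-trans (1+x-X c (shift j g)) (X-cong (1+x-shift c j g))

  inverse-0 : ∀ j → inverse j 0 ≈ 1#
  inverse-0 zero    = inverse-zero 0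
  inverse-0 (suc j) = trans (solve 2 (λ a u → a := a :+ u :* con 0ℤ) refl _ u) (trans (inverse-suc j 0) (inverse-0 j))

  binomials-0 : ∀ a g → binomials a g 0 ≈ g 0
  binomials-0 zero    g = refl
  binomials-0 (suc a) g = trans (+-cong (binomials-0 a g) (zeroʳ 1#)) (+-identityʳ _)

  -- The series x^j (1 + x)^(m + i + 1) (1 + u x)^(k - i) of the variable with index i = k + 1 + j.
  extra : ℕ → ℕ → ℕ → PowerSeries
  extra m k j = shift j (binomials (m ℕ.+ suc (k ℕ.+ j) ℕ.+ 1) (inverse (suc j)))

  extras : ℕ → ℕ → ℕ → List PowerSeries
  extras m k p = applyUpTo (extra m k) p

  -- The bound on the last entry of the truncated row above is B = m + k + 1, and the first extra
  -- series is (1 + x)^(B + 1) / (1 + u x), as `outer` demands.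
  r-extra-zero : ∀ m k → r (extra m k 0) ≐ pow (suc (suc m ℕ.+ k))
  r-extra-zero m k = ≐-trans (1+x-binomials u (m ℕ.+ suc (k ℕ.+ 0) ℕ.+ 1) (inverse 1))
    (≐-trans (binomials-cong (m ℕ.+ suc (k ℕ.+ 0) ℕ.+ 1) (≐-trans (inverse-suc 0) inverse-zero))
    (≐-trans (≐-≡ (≡.cong (λ a → binomials a δ) index)) (λ i → sym (pow-binomials (suc (suc m ℕ.+ k)) i))))
    where
    index : m ℕ.+ suc (k ℕ.+ 0) ℕ.+ 1 ≡ suc (suc m ℕ.+ k)
    index = ≡.trans (ℕₚ.+-comm _ 1) (≡.cong suc (≡.trans (ℕₚ.+-suc m (k ℕ.+ 0)) (≡.cong (λ a → suc (m ℕ.+ a)) (ℕₚ.+-identityʳ k))))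

  -- `r` cancels one factor 1 / (1 + u x), and the x that comes out is absorbed by `reduced-X`. The
  -- binomial exponent m + i + 1 stays the same because i drops by one while m rises by one.
  r-extra-suc : ∀ m k j → r (extra m k (suc j)) ≐ X (extra (suc m) k j)
  r-extra-suc m k j = ≐-trans (1+x-shift u (suc j) _) (shift-cong (suc j)
    (≐-trans (1+x-binomials u (m ℕ.+ suc (k ℕ.+ suc j) ℕ.+ 1) (inverse (suc (suc j))))
    (≐-trans (binomials-cong (m ℕ.+ suc (k ℕ.+ suc j) ℕ.+ 1) (inverse-suc (suc j)))
      (≐-≡ (≡.cong (λ a → binomials (a ℕ.+ 1) (inverse (suc j))) index)))))
    where
    index : m ℕ.+ suc (k ℕ.+ suc j) ≡ suc m ℕ.+ suc (k ℕ.+ j)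
    index = ≡.trans (≡.cong (λ a → m ℕ.+ suc a) (ℕₚ.+-suc k j)) (ℕₚ.+-suc m (suc (k ℕ.+ j)))

  extra-zero-0 : ∀ m k → extra m k 0 0 ≈ 1#
  extra-zero-0 m k = trans (binomials-0 (m ℕ.+ suc (k ℕ.+ 0) ℕ.+ 1) (inverse 1)) (inverse-0 1)

  -- The bound grows by one from column to column, so a bottom row of an (m, n, k)-Gog trapezoid is
  -- a `Row (suc m)`.
  data Row : ℕ → List ℕ → Set where
    []   : ∀ {a} → Row a []
    cons : ∀ {a b bs} → 1 ℕ.≤ b → b ℕ.≤ a → Before b (at bs 0) → Row (suc a) bs → Row a (b ∷ bs)

  -- The bound on a column of the upper row equals the bound on the next column of the lower row,
  -- which yields b′ ≤ B for `inner`. The last column has no next one and is linked to the first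
  -- extra series.
  chain-open : ∀ {a bs g rest} → Row a bs → r g ≐ pow (suc (a ℕ.+ length bs)) → g 0 ≈ 1# → All (λ h → h 0 ≈ 0#) rest →
               Chain bs (bounds (suc a) (length bs)) (List.map pow bs ++ g ∷ rest) (List.map r rest)
  chain-open [] rg g0 zeros = open′ g0 zeros
  chain-open {a} {b ∷ []} {g} (cons 1≤b b≤a none []) rg g0 zeros =
    link 1≤b (outer (ℕₚ.m≤n⇒m≤1+n b≤a) (≐-trans rg (≐-≡ (≡.cong (pow ∘ suc) (ℕₚ.+-comm a 1)))) g0) (open′ g0 zeros)
  chain-open {a} {b ∷ b′ ∷ bs} (cons 1≤b b≤a (some b<b′) row@(cons _ b′≤ _ _)) rg g0 zeros =
    link 1≤b (inner b<b′ b′≤) (chain-open row (≐-trans rg (≐-≡ (≡.cong (pow ∘ suc) (ℕₚ.+-suc a (suc (length bs)))))) g0 zeros)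

  -- In the triangular part the upper row is one entry shorter: nothing lies above the last entry of
  -- the lower row, and the chain closes there.
  chain-closed : ∀ {a b bs} → Row a (b ∷ bs) → Chain (b ∷ bs) (bounds (suc a) (length bs)) (List.map pow (b ∷ bs)) []
  chain-closed {bs = []}     row = closed
  chain-closed {bs = b′ ∷ bs} (cons 1≤b b≤a (some b<b′) row@(cons _ b′≤ _ _)) = link 1≤b (inner b<b′ b′≤) (chain-closed row)

  -- Only the k slots of row entries are summed over; the slots of the extra variables are carried
  -- along.
  Good-weaken : ∀ k p {M} → Good (k ℕ.+ p) M → Good k M
  Good-weaken zero          p good = tt
  Good-weaken (suc zero)    p (lin , coll , good) = lin , tt , (λ g → tt)
  Good-weaken (suc (suc k)) p (lin , coll , good) = lin , coll , (λ g → Good-weaken (suc k) p (good g))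

  pad-≐ : ∀ n {gs hs} → LPW.Pointwise _≐_ gs hs → PW.Pointwise _≐_ (pad n gs) (pad n hs)
  pad-≐ zero    p        = []
  pad-≐ (suc n) []       = ≐-refl ∷ pad-≐ n []
  pad-≐ (suc n) (p ∷ ps) = p ∷ pad-≐ n ps

  reduced-≐ : ∀ n {gs hs} → LPW.Pointwise _≐_ gs hs → reduced n gs ≈ reduced n hs
  reduced-≐ n p = Λ-≐ n (V n) (pad-≐ n p)

  coefficients-X : ∀ N {n} (gs : Vec PowerSeries n) m → coefficients (suc N) (Vec.map X gs) m ≈ coefficients N gs m
  coefficients-X N []       m = refl
  coefficients-X N (g ∷ gs) m = *-cong (coefficient-X (suc N) g (Vec.head m)) (coefficients-X N gs (Vec.tail m))

  pad-map-X : ∀ n gs → length gs ≡ n → pad n (List.map X gs) ≡ Vec.map X (pad n gs)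
  pad-map-X zero    []       _ = ≡.refl
  pad-map-X (suc n) (g ∷ gs) p = ≡.cong (X g ∷_) (pad-map-X n gs (ℕₚ.suc-injective p))

  -- Every slot left by the summation over a row carries a factor x, and these factors lower the
  -- exponent from n to n - 1, the one of a smaller constant term.
  reduced-X : ∀ n gs → length gs ≡ n → reduced n (List.map X gs) ≈ constantTerm n gs
  reduced-X zero    gs p = refl
  reduced-X (suc n) gs p = trans (reflexive (≡.cong (λ hs → Λ (suc n) hs (V (suc n))) (pad-map-X (suc n) gs p)))
    (⟨⟩-cong (V (suc n)) (coefficients-X n (pad (suc n) gs)))

  -- The part of `Row` that candidate lists satisfy by construction; the increase is enforced by the
  -- weights.
  data Bounded : ℕ → List ℕ → Set where
    []   : ∀ {a} → Bounded a []
    cons : ∀ {a c cs} → 1 ℕ.≤ c → c ℕ.≤ a → Bounded (suc a) cs → Bounded a (c ∷ cs)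

  rows : ℕ → ℕ → List (List ℕ)
  rows a k = choices (List.map range (bounds a k))

  ∑-cong-All : ∀ {I : Set} {xs : List I} {F G : I → Carrier} → All (λ x → F x ≈ G x) xs → ∑ xs F ≈ ∑ xs G
  ∑-cong-All []       = refl
  ∑-cong-All (p ∷ ps) = +-cong p (∑-cong-All ps)

  ∑-rows-cong : ∀ a k {F G : List ℕ → Carrier} → (∀ cs → Bounded a cs → length cs ≡ k → F cs ≈ G cs) → ∑ (rows a k) F ≈ ∑ (rows a k) G
  ∑-rows-cong a zero    p = +-congʳ (p [] [] ≡.refl)
  ∑-rows-cong a (suc k) {F} {G} p = trans (∑-choices (range a) (List.map range (bounds (suc a) k)) F) (trans
    (∑-cong-All (Allₚ.map⁺ (Allₚ.applyUpTo⁺₁ id a (λ {i} i<a → ∑-rows-cong (suc a) k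
      (λ cs bounded eq → p (suc i ∷ cs) (cons (ℕ.s≤s ℕ.z≤n) i<a bounded) (≡.cong suc eq))))))
    (sym (∑-choices (range a) (List.map range (bounds (suc a) k)) G)))

  -- The common part of the open and the closed step: `next cs` lists the series that cs receives
  -- once it is a bottom row itself, and the last hypothesis says that the summation produces these
  -- series times x.
  row-step : ∀ {n k a bs gs tl} (next : List ℕ → List PowerSeries) → Chain bs (bounds a k) gs tl → Good k (reduced n) → length gs ≡ suc n →
    (∀ cs → length cs ≡ k → length (next cs) ≡ n × LPW.Pointwise _≐_ (List.map XPow cs ++ tl) (List.map X (next cs))) →
    constantTerm (suc n) gs ≈ ∑ (rows a k) (λ cs → rowWeight bs cs * constantTerm n (next cs))
  row-step {n} {k} {a} {bs} {gs} {tl} next chain good eq p = begin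
    constantTerm (suc n) gs ≈⟨ constantTerm-expand n gs eq ⟩
    expand gs (reduced n)
      ≈⟨ rowSum-expand chain (reduced n) (≡.subst (λ k → Good k (reduced n)) (≡.sym (length-bounds a k)) good) ⟨
    ∑ (rows a k) (λ cs → rowWeight bs cs * reduced n (List.map XPow cs ++ tl))
      ≈⟨ ∑-rows-cong a k (λ cs _ len → *-congˡ (trans (reduced-≐ n (proj₂ (p cs len))) (reduced-X n (next cs) (proj₁ (p cs len))))) ⟩
    ∑ (rows a k) (λ cs → rowWeight bs cs * constantTerm n (next cs)) ∎

  -- Of the suc p extra variables the first is consumed as the bound of the last entry, and the
  -- others move one place down, to the series for m + 1.
  open-step : ∀ m p {bs} → Row (suc m) bs → let k = length bs in
    constantTerm (suc (k ℕ.+ p)) (List.map pow bs ++ extras m k (suc p)) ≈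
    ∑ (rows (suc (suc m)) k) (λ cs → rowWeight bs cs * constantTerm (k ℕ.+ p) (List.map pow cs ++ extras (suc m) k p))
  open-step m p {bs} row = row-step (λ cs → List.map pow cs ++ extras (suc m) k p)
    (chain-open row (r-extra-zero m k) (extra-zero-0 m k) (Allₚ.applyUpTo⁺₂ (extra m k ∘ suc) p (λ j → refl)))
    (Good-weaken k p (good-V (k ℕ.+ p) (k ℕ.+ p)))
    (≡.trans (len pow bs (extras m k (suc p))) (≡.trans (≡.cong (k ℕ.+_) (Listₚ.length-applyUpTo (extra m k) (suc p))) (ℕₚ.+-suc k p)))
    (λ cs eq → ≡.trans (len pow cs (extras (suc m) k p)) (≡.cong₂ ℕ._+_ eq (Listₚ.length-applyUpTo (extra (suc m) k) p)) , series cs)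
    where
    k = length bs
    len : ∀ {A : Set} (f : ℕ → A) xs ys → length (List.map f xs ++ ys) ≡ length xs ℕ.+ length ys
    len f xs ys = ≡.trans (Listₚ.length-++ (List.map f xs)) (≡.cong (ℕ._+ length ys) (Listₚ.length-map f xs))
    tails : ∀ p (f g : ℕ → PowerSeries) → (∀ j → r (f j) ≐ X (g j)) → LPW.Pointwise _≐_ (List.map r (applyUpTo f p)) (List.map X (applyUpTo g p))
    tails zero    f g q = []
    tails (suc p) f g q = q 0 ∷ tails p (f ∘ suc) (g ∘ suc) (λ j → q (suc j))
    series : ∀ cs → LPW.Pointwise _≐_ (List.map XPow cs ++ List.map r (applyUpTo (extra m k ∘ suc) p)) (List.map X (List.map pow cs ++ extras (suc m) k p))
    series []       = tails p (extra m k ∘ suc) (extra (suc m) k) (r-extra-suc m k)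
    series (c ∷ cs) = ≐-refl ∷ series cs

  closed-step : ∀ m {b bs k} → Row (suc m) (b ∷ bs) → length bs ≡ k →
    constantTerm (suc k) (List.map pow (b ∷ bs)) ≈ ∑ (rows (suc (suc m)) k) (λ cs → rowWeight (b ∷ bs) cs * constantTerm k (List.map pow cs))
  closed-step m {b} {bs} {k} row ≡.refl = row-step (List.map pow) (chain-closed row) (good-V k k) (≡.cong suc (Listₚ.length-map pow bs))
    (λ cs eq → ≡.trans (Listₚ.length-map pow cs) eq , series cs)
    where
    series : ∀ cs → LPW.Pointwise _≐_ (List.map XPow cs ++ []) (List.map X (List.map pow cs))
    series []       = []
    series (c ∷ cs) = ≐-refl ∷ series cs

  -- The sums run over all bounded candidates, the induction hypothesis covers increasing rows only;
  -- the other candidates have weight 0.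
  row-or-zero : ∀ {a} bs cs → Bounded a cs → rowWeight bs cs ≈ 0# ⊎ Row a cs
  row-or-zero bs       []       []                 = inj₂ []
  row-or-zero []       (c ∷ cs) _                  = inj₁ refl
  row-or-zero (b ∷ bs) (c ∷ cs) (cons 1≤c c≤a bounded) with row-or-zero bs cs bounded
  ... | inj₁ z = inj₁ (trans (*-congˡ (trans (*-congˡ z) (zeroʳ _))) (zeroʳ _))
  ... | inj₂ row with cs
  ...   | []      = inj₂ (cons 1≤c c≤a none row)
  ...   | c′ ∷ cs with ℕₚ.<-≤-connex c c′
  ...     | inj₁ c<c′ = inj₂ (cons 1≤c c≤a (some c<c′) row)
  ...     | inj₂ c′≤c = inj₁ (trans (*-congˡ (trans (*-congʳ (reflexive (≡.cong indicator (≤ᵇ-false (ℕ.s≤s c′≤c))))) (zeroˡ _))) (zeroʳ _))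

  -- With the array count abstracted to f, the base value and the row recursion determine it. The
  -- recursion is asked for valid bottom rows only.
  module _ (f : (m n k : ℕ) → List ℕ → Carrier)
           (f-zero : ∀ m k → f m 0 k [] ≈ 1#)
           (f-suc : ∀ m n k bs → Row (suc m) bs → length bs ≡ suc n ℕ.⊓ k →
            f m (suc n) k bs ≈ ∑ (rows (suc (suc m)) (n ℕ.⊓ k)) (λ cs → rowWeight bs cs * f (suc m) n k cs)) where

    closed-solution : ∀ n k m bs → n ℕ.≤ k → Row (suc m) bs → length bs ≡ n → f m n k bs ≈ constantTerm n (List.map pow bs)
    closed-solution zero k m [] n≤k row eq = trans (f-zero m k) (sym (trans (⟨⟩-unit _ _) refl))
    closed-solution (suc n) k m (b ∷ bs) n≤k row eq = begin
      f m (suc n) k (b ∷ bs)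
        ≈⟨ f-suc m n k (b ∷ bs) row (≡.trans eq (≡.sym (ℕₚ.m≤n⇒m⊓n≡m n≤k))) ⟩
      ∑ (rows (suc (suc m)) (n ℕ.⊓ k)) (λ cs → rowWeight (b ∷ bs) cs * f (suc m) n k cs)
        ≡⟨ ≡.cong (λ j → ∑ (rows (suc (suc m)) j) (λ cs → rowWeight (b ∷ bs) cs * f (suc m) n k cs)) (ℕₚ.m≤n⇒m⊓n≡m (ℕₚ.<⇒≤ n≤k)) ⟩
      ∑ (rows (suc (suc m)) n) (λ cs → rowWeight (b ∷ bs) cs * f (suc m) n k cs)
        ≈⟨ ∑-rows-cong (suc (suc m)) n compare ⟩
      ∑ (rows (suc (suc m)) n) (λ cs → rowWeight (b ∷ bs) cs * constantTerm n (List.map pow cs))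
        ≈⟨ closed-step m row (ℕₚ.suc-injective eq) ⟨
      constantTerm (suc n) (List.map pow (b ∷ bs)) ∎
      where
      compare : ∀ cs → Bounded (suc (suc m)) cs → length cs ≡ n → rowWeight (b ∷ bs) cs * f (suc m) n k cs ≈ rowWeight (b ∷ bs) cs * constantTerm n (List.map pow cs)
      compare cs bounded eq with row-or-zero (b ∷ bs) cs bounded
      ... | inj₁ z   = trans (*-congʳ z) (trans (zeroˡ _) (sym (trans (*-congʳ z) (zeroˡ _))))
      ... | inj₂ row = *-congˡ (closed-solution n k (suc m) cs (ℕₚ.<⇒≤ n≤k) row eq)

    solution : ∀ p k m bs → Row (suc m) bs → length bs ≡ k → f m (k ℕ.+ p) k bs ≈ constantTerm (k ℕ.+ p) (List.map pow bs ++ extras m k p)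
    -- Now n = k and no extra variable is left; the remaining array is a triangle.
    solution zero k m bs row eq = trans (closed-solution (k ℕ.+ 0) k m bs (ℕₚ.≤-reflexive (ℕₚ.+-identityʳ k)) row (≡.trans eq (≡.sym (ℕₚ.+-identityʳ k))))
      (reflexive (≡.cong (constantTerm (k ℕ.+ 0)) (≡.sym (Listₚ.++-identityʳ _))))
    solution (suc p) k m bs row ≡.refl = ≡.subst (λ n → f m n k bs ≈ constantTerm n (List.map pow bs ++ extras m k (suc p))) (≡.sym (ℕₚ.+-suc k p)) (begin
      f m (suc (k ℕ.+ p)) k bs
        ≈⟨ f-suc m (k ℕ.+ p) k bs row (≡.sym (ℕₚ.m≥n⇒m⊓n≡n (ℕₚ.m≤n⇒m≤1+n (ℕₚ.m≤m+n k p)))) ⟩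
      ∑ (rows (suc (suc m)) ((k ℕ.+ p) ℕ.⊓ k)) (λ cs → rowWeight bs cs * f (suc m) (k ℕ.+ p) k cs)
        ≡⟨ ≡.cong (λ j → ∑ (rows (suc (suc m)) j) (λ cs → rowWeight bs cs * f (suc m) (k ℕ.+ p) k cs)) (ℕₚ.m≥n⇒m⊓n≡n (ℕₚ.m≤m+n k p)) ⟩
      ∑ (rows (suc (suc m)) k) (λ cs → rowWeight bs cs * f (suc m) (k ℕ.+ p) k cs)
        ≈⟨ ∑-rows-cong (suc (suc m)) k compare ⟩
      ∑ (rows (suc (suc m)) k) (λ cs → rowWeight bs cs * constantTerm (k ℕ.+ p) (List.map pow cs ++ extras (suc m) k p))
        ≈⟨ open-step m p row ⟨
      constantTerm (suc (k ℕ.+ p)) (List.map pow bs ++ extras m k (suc p)) ∎)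
      where
      compare : ∀ cs → Bounded (suc (suc m)) cs → length cs ≡ k →
        rowWeight bs cs * f (suc m) (k ℕ.+ p) k cs ≈ rowWeight bs cs * constantTerm (k ℕ.+ p) (List.map pow cs ++ extras (suc m) k p)
      compare cs bounded eq with row-or-zero bs cs bounded
      ... | inj₁ z   = trans (*-congʳ z) (trans (zeroˡ _) (sym (trans (*-congʳ z) (zeroˡ _))))
      ... | inj₂ row = *-congˡ (solution p k (suc m) cs row eq)

-- Lists of rows and products over lists.

lastRow-∷ʳ : ∀ G b → lastRow (G ∷ʳ b) ≡ b
lastRow-∷ʳ []          b = ≡.refl
lastRow-∷ʳ (x ∷ [])    b = ≡.refl
lastRow-∷ʳ (x ∷ y ∷ G) b = lastRow-∷ʳ (y ∷ G) b

all-choices : ∀ {A : Set} (xss : List (List A)) → All (λ xs → LPW.Pointwise _∈_ xs xss) (choices xss)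
all-choices []         = [] ∷ []
all-choices (xs ∷ xss) = Allₚ.concat⁺ (Allₚ.map⁺ (All.tabulate (λ x∈xs → Allₚ.map⁺ (All.map (x∈xs ∷_) (all-choices xss)))))

lastRow-∈ : ∀ {G} xss {ys} → LPW.Pointwise _∈_ G (xss ∷ʳ ys) → lastRow G ∈ ys
lastRow-∈ []            (p ∷ [])      = p
lastRow-∈ (xs ∷ [])     (p ∷ q ∷ ps) = lastRow-∈ [] (q ∷ ps)
lastRow-∈ (xs ∷ _ ∷ xss) (p ∷ q ∷ ps) = lastRow-∈ (_ ∷ xss) (q ∷ ps)

-- Stated with `does`, the comparison of two nonempty rows unfolds to a conjunction, which
-- `∑-rows-pick` uses entry by entry.
sameRow : List ℕ → List ℕ → Bool
sameRow xs ys = does (Listₚ.≡-dec ℕ._≟_ xs ys)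

sameRow-sym : ∀ xs ys → sameRow xs ys ≡ sameRow ys xs
sameRow-sym xs ys with Listₚ.≡-dec ℕ._≟_ xs ys
... | yes p = ≡.sym (dec-true (Listₚ.≡-dec ℕ._≟_ ys xs) (≡.sym p))
... | no ¬p = ≡.sym (dec-false (Listₚ.≡-dec ℕ._≟_ ys xs) (¬p ∘ ≡.sym))

data Lengths : (ℕ → ℕ) → List (List ℕ) → Set where
  []  : ∀ {L} → Lengths L []
  _∷_ : ∀ {L x G} → length x ≡ L 0 → Lengths (L ∘ suc) G → Lengths L (x ∷ G)

module ListProducts (A : Ring₀) where
  open CommutativeRing A hiding (zero)
  open IntegerSolver A using (solve; _:=_; _:+_; _:*_; _:-_; :-_; con; :1)
  private module V = Products A

  private variable
    I J : Set

  ∏ : List I → (I → Carrier) → Carrier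
  ∏ []       f = 1#
  ∏ (x ∷ xs) f = f x * ∏ xs f

  ∏-cong : ∀ (xs : List I) {f g : I → Carrier} → (∀ x → f x ≈ g x) → ∏ xs f ≈ ∏ xs g
  ∏-cong []       p = refl
  ∏-cong (x ∷ xs) p = *-cong (p x) (∏-cong xs p)

  ∏-++ : ∀ (xs ys : List I) (f : I → Carrier) → ∏ (xs ++ ys) f ≈ ∏ xs f * ∏ ys f
  ∏-++ []       ys f = sym (*-identityˡ _)
  ∏-++ (x ∷ xs) ys f = trans (*-congˡ (∏-++ xs ys f)) (sym (*-assoc _ _ _))

  ∏-map : ∀ (h : I → J) (xs : List I) (f : J → Carrier) → ∏ (List.map h xs) f ≈ ∏ xs (f ∘ h)
  ∏-map h []       f = refl
  ∏-map h (x ∷ xs) f = *-congˡ (∏-map h xs f)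

  ∏-concatMap : ∀ (h : I → List J) (xs : List I) (f : J → Carrier) → ∏ (List.concatMap h xs) f ≈ ∏ xs (λ x → ∏ (h x) f)
  ∏-concatMap h []       f = refl
  ∏-concatMap h (x ∷ xs) f = trans (∏-++ (h x) _ f) (*-congˡ (∏-concatMap h xs f))

  ∏-* : ∀ (xs : List I) (f g : I → Carrier) → ∏ xs (λ x → f x * g x) ≈ ∏ xs f * ∏ xs g
  ∏-* []       f g = sym (*-identityˡ 1#)
  ∏-* (x ∷ xs) f g = trans (*-congˡ (∏-* xs f g))
    (solve 4 (λ a b c d → (a :* b) :* (c :* d) := (a :* c) :* (b :* d)) refl _ _ _ _)

  ∏-applyUpTo : ∀ n (e : ℕ → ℕ) (F : ℕ → Carrier) → ∏ (applyUpTo e n) F ≈ ∏ (upTo n) (F ∘ e)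
  ∏-applyUpTo n e F = trans (reflexive (≡.cong (λ xs → ∏ xs F) (≡.sym (Listₚ.map-applyUpTo id e n)))) (∏-map e (upTo n) F)

  ∏-allFin-suc : ∀ n (F : Fin (suc n) → Carrier) → ∏ (allFin (suc n)) F ≈ F zero * ∏ (allFin n) (F ∘ suc)
  ∏-allFin-suc n F = *-congˡ (trans (reflexive (≡.cong (λ xs → ∏ xs F) (≡.sym (Listₚ.map-tabulate id suc)))) (∏-map suc (allFin n) F))

  ∏-lookup : ∀ {n} (f : Carrier → Carrier) (xs : Vec Carrier n) → ∏ (allFin n) (λ j → f (lookup xs j)) ≈ V.∏ f xs
  ∏-lookup f []       = refl
  ∏-lookup {suc n} f (x ∷ xs) = trans (∏-allFin-suc n _) (*-congˡ (∏-lookup f xs))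

  private
    above : Bool → Carrier → Carrier
    above c y = if c then y else 1#

    upper : ∀ {n} (f : Carrier → Carrier → Carrier) → Vec Carrier n → Fin n → Fin n → Carrier
    upper f xs i j = above (toℕ i ℕ.<ᵇ toℕ j) (f (lookup xs i) (lookup xs j))

    ∏-upper : ∀ {n} f (xs : Vec Carrier n) → ∏ (allFin n) (λ i → ∏ (allFin n) (upper f xs i)) ≈ V.pairProduct f xs
    ∏-upper f []       = refl
    ∏-upper {suc n} f (x ∷ xs) = trans (∏-allFin-suc n _) (*-cong
      (trans (∏-allFin-suc n (upper f (x ∷ xs) zero)) (trans (*-identityˡ _) (∏-lookup (f x) xs)))
      (trans (∏-cong (allFin n) (λ i → trans (∏-allFin-suc n (upper f (x ∷ xs) (suc i))) (*-identityˡ _))) (∏-upper f xs)))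

  ∏-pairs : ∀ {n} f (xs : Vec Carrier n) → ∏ (pairs n) (λ { (i , j) → f (lookup xs i) (lookup xs j) }) ≈ V.pairProduct f xs
  ∏-pairs {n} f xs = trans (∏-concatMap _ (allFin n) _) (trans (∏-cong (allFin n) (λ i →
    trans (∏-concatMap _ (allFin n) _) (∏-cong (allFin n) (λ j → go (toℕ i ℕ.<ᵇ toℕ j) i j)))) (∏-upper f xs))
    where
    go : ∀ c i j → ∏ (if c then (i , j) ∷ [] else []) (λ { (i , j) → f (lookup xs i) (lookup xs j) }) ≈ above c (f (lookup xs i) (lookup xs j))
    go true  i j = *-identityʳ _
    go false i j = refl

-- Gog trapezoids sorted by their last rows.

module GogRecursion (K : Ring₀) (u v : CommutativeRing.Carrier K) (powers : InversePowers K u v) where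
  open CommutativeRing K hiding (zero)
  open IntegerSolver K using (solve; _:=_; _:+_; _:*_; _:-_; :-_; con; :1)
  open Relation.Binary.Reasoning.Setoid setoid
  open Sums K
  open Products K using (_^_)
  open Recursion K u v powers public

  open ListProducts K public

  private variable
    I J : Set

  indicator-∧ : ∀ a b → indicator (a ∧ b) ≈ indicator a * indicator b
  indicator-∧ true  b = sym (*-identityˡ _)
  indicator-∧ false b = sym (zeroˡ _)

  indicator-idem : ∀ a → indicator a * indicator a ≈ indicator a
  indicator-idem true  = *-identityˡ _
  indicator-idem false = zeroˡ _

  indicator-allB : ∀ (p : I → Bool) xs → indicator (allB p xs) ≈ ∏ xs (indicator ∘ p)
  indicator-allB p []       = refl
  indicator-allB p (x ∷ xs) = trans (indicator-∧ (p x) _) (*-congˡ (indicator-allB p xs))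

  ^-countB : ∀ t (p : I → Bool) xs → t ^ countB p xs ≈ ∏ xs (mark t ∘ p)
  ^-countB t p []       = refl
  ^-countB t p (x ∷ xs) with p x
  ... | true  = *-congˡ (^-countB t p xs)
  ... | false = trans (^-countB t p xs) (sym (*-identityˡ _))

  gog : (m n k : ℕ) → List ℕ → Carrier
  gog m n k bs = ∑ (arrays m n k) (λ G → indicator (isGogWithBottom n k bs G) * (u ^ inv n k G * v ^ inv′ n k G))

  -- The contribution of the entry x with right neighbour x⁺, above the entries y and y⁺.
  cell : (x x⁺ y y⁺ : Maybe ℕ) → Carrier
  cell x x⁺ y y⁺ = indicator (leM y x ∧ leM x y⁺ ∧ ltM x x⁺) * (mark u (eqM x y⁺) * mark v (eqM x y))

  rowCells : List ℕ → List ℕ → Carrier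
  rowCells []       ys = 1#
  rowCells (x ∷ xs) ys = cell (just x) (at xs 0) (at ys 0) (at ys 1) * rowCells xs (List.drop 1 ys)

  firstRow : List (List ℕ) → List ℕ
  firstRow G = fromMaybe [] (at G 0)

  -- The last row is compared with an empty row, so that only its own increase counts.
  arrayWeight : List (List ℕ) → Carrier
  arrayWeight []      = 1#
  arrayWeight (x ∷ G) = rowCells x (firstRow G) * arrayWeight G

  entry-at : ∀ G r c → entry G r c ≡ at (fromMaybe [] (at G r)) c
  entry-at G r c with at G r
  ... | nothing = ≡.refl
  ... | just x  = ≡.refl

  at-drop : ∀ (ys : List ℕ) c → at ys (suc c) ≡ at (List.drop 1 ys) c
  at-drop []       c = ≡.refl
  at-drop (y ∷ ys) c = ≡.refl

  cells : List ℕ → List ℕ → ℕ → Carrier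
  cells xs ys c = cell (at xs c) (at xs (suc c)) (at ys c) (at ys (suc c))

  cells-suc : ∀ x xs ys c → cells (x ∷ xs) ys (suc c) ≡ cells xs (List.drop 1 ys) c
  cells-suc x xs ys c = ≡.cong₂ (cell (at xs c) (at xs (suc c))) (at-drop ys c) (at-drop ys (suc c))

  ∏-cells : ∀ L xs ys → length xs ≡ L → ∏ (upTo L) (cells xs ys) ≈ rowCells xs ys
  ∏-cells zero    []       ys p = refl
  ∏-cells (suc L) (x ∷ xs) ys p = *-congˡ (trans (∏-applyUpTo L suc (cells (x ∷ xs) ys))
    (trans (∏-cong (upTo L) (λ c → reflexive (cells-suc x xs ys c))) (∏-cells L xs (List.drop 1 ys) (ℕₚ.suc-injective p))))

  ∏-rows : ∀ n L G → length G ≡ n → Lengths L G →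
    ∏ (upTo n) (λ r → ∏ (upTo (L r)) (cells (fromMaybe [] (at G r)) (fromMaybe [] (at G (suc r))))) ≈ arrayWeight G
  ∏-rows zero    L []      p []       = refl
  ∏-rows (suc n) L (x ∷ G) p (q ∷ qs) = *-cong (∏-cells (L 0) x (firstRow G) q)
    (trans (∏-applyUpTo n suc _) (∏-rows n (L ∘ suc) G (ℕₚ.suc-injective p) qs))

  -- Validity, inv and inv′ are products over the same positions. They merge into one product of
  -- cells, which is then regrouped by rows.
  weight-factor : ∀ n k bs G → length G ≡ n → Lengths (rowLen k) G →
    indicator (isGogWithBottom n k bs G) * (u ^ inv n k G * v ^ inv′ n k G) ≈ indicator (sameRow (lastRow G) bs) * arrayWeight G
  weight-factor n k bs G p q = begin
    indicator (isGogWithBottom n k bs G) * (u ^ inv n k G * v ^ inv′ n k G)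
      ≈⟨ *-cong (trans (indicator-∧ (allB valid ps) ⌊ Listₚ.≡-dec ℕ._≟_ (lastRow G) bs ⌋) (*-cong (indicator-allB valid ps)
           (reflexive (≡.cong indicator (isYes≗does (Listₚ.≡-dec ℕ._≟_ (lastRow G) bs))))))
           (*-cong (^-countB u _ ps) (^-countB v _ ps)) ⟩
    (∏ ps _ * B) * (∏ ps _ * ∏ ps _)
      ≈⟨ solve 4 (λ a b c d → (a :* b) :* (c :* d) := b :* (a :* (c :* d))) refl _ B _ _ ⟩
    B * (∏ ps _ * (∏ ps _ * ∏ ps _))
      ≈⟨ *-congˡ (trans (∏-* ps _ _) (*-congˡ (∏-* ps _ _))) ⟨
    B * ∏ ps _
      ≈⟨ *-congˡ (trans (∏-concatMap (λ r → List.map (r ,_) (upTo (rowLen k r))) (upTo n) _) (∏-cong (upTo n) (λ r → ∏-map (r ,_) (upTo (rowLen k r)) _))) ⟩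
    B * ∏ (upTo n) (λ r → ∏ (upTo (rowLen k r)) (λ c → cell (entry G r c) (entry G r (suc c)) (entry G (suc r) c) (entry G (suc r) (suc c))))
      ≈⟨ *-congˡ (∏-cong (upTo n) (λ r → ∏-cong (upTo (rowLen k r)) (λ c → reflexive (entries r c)))) ⟩
    B * ∏ (upTo n) (λ r → ∏ (upTo (rowLen k r)) (cells (fromMaybe [] (at G r)) (fromMaybe [] (at G (suc r)))))
      ≈⟨ *-congˡ (∏-rows n (rowLen k) G p q) ⟩
    B * arrayWeight G ∎
    where
    ps = positions n k
    valid : ℕ × ℕ → Bool
    valid (r , c) = leM (entry G (suc r) c) (entry G r c) ∧ leM (entry G r c) (entry G (suc r) (suc c)) ∧ ltM (entry G r c) (entry G r (suc c))
    B : Carrier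
    B = indicator (sameRow (lastRow G) bs)
    entries : ∀ r c → cell (entry G r c) (entry G r (suc c)) (entry G (suc r) c) (entry G (suc r) (suc c))
            ≡ cells (fromMaybe [] (at G r)) (fromMaybe [] (at G (suc r))) c
    entries r c = ≡.trans (≡.cong₂ (λ x x⁺ → cell x x⁺ (entry G (suc r) c) (entry G (suc r) (suc c))) (entry-at G r c) (entry-at G r (suc c)))
      (≡.cong₂ (cell _ _) (entry-at G (suc r) c) (entry-at G (suc r) (suc c)))

  link-weight : (x y y⁺ : Maybe ℕ) → Carrier
  link-weight x y y⁺ = (indicator (leM y x) * mark v (eqM x y)) * (indicator (leM x y⁺) * mark u (eqM x y⁺))

  interlacing : List ℕ → List ℕ → Carrier
  interlacing []       ys = 1#
  interlacing (x ∷ xs) ys = link-weight (just x) (at ys 0) (at ys 1) * interlacing xs (List.drop 1 ys)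

  -- Against an empty next row all interlacing conditions hold and no equality is marked, so only
  -- the comparisons inside xs remain.
  increasing : List ℕ → Carrier
  increasing xs = rowCells xs []

  cell-split : ∀ x x⁺ y y⁺ → cell (just x) x⁺ y y⁺ ≈ cell (just x) x⁺ nothing nothing * link-weight (just x) y y⁺
  cell-split x x⁺ y y⁺ = trans (*-congʳ (trans (indicator-∧ (leM y (just x)) _) (*-congˡ (indicator-∧ (leM (just x) y⁺) _))))
    (solve 5 (λ a b c d e → (a :* (b :* c)) :* (d :* e) := (c :* (:1 :* :1)) :* ((a :* e) :* (b :* d))) refl
      (indicator (leM y (just x))) (indicator (leM (just x) y⁺)) (indicator (ltM (just x) x⁺)) (mark u (eqM (just x) y⁺)) (mark v (eqM (just x) y)))

  rowCells-split : ∀ xs ys → rowCells xs ys ≈ increasing xs * interlacing xs ys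
  rowCells-split []       ys = sym (*-identityˡ 1#)
  rowCells-split (x ∷ xs) ys = trans (*-cong (cell-split x (at xs 0) (at ys 0) (at ys 1)) (rowCells-split xs (List.drop 1 ys)))
    (solve 4 (λ a b c d → (a :* b) :* (c :* d) := (a :* c) :* (b :* d)) refl _ _ _ _)

  increasing-cons : ∀ x xs → increasing (x ∷ xs) ≈ indicator (ltM (just x) (at xs 0)) * increasing xs
  increasing-cons x xs = *-congʳ (trans (*-congˡ (*-identityˡ 1#)) (*-identityʳ _))

  -- A product of indicators. Both `rowWeight` and `arrayWeight` test the increase of the row they
  -- share, and this reconciles the two.
  increasing-idem : ∀ xs → increasing xs * increasing xs ≈ increasing xs
  increasing-idem []       = *-identityˡ 1#
  increasing-idem (x ∷ xs) = begin
    increasing (x ∷ xs) * increasing (x ∷ xs) ≈⟨ *-cong (increasing-cons x xs) (increasing-cons x xs) ⟩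
    (i * increasing xs) * (i * increasing xs) ≈⟨ solve 2 (λ i s → (i :* s) :* (i :* s) := (i :* i) :* (s :* s)) refl i (increasing xs) ⟩
    (i * i) * (increasing xs * increasing xs) ≈⟨ *-cong (indicator-idem (ltM (just x) (at xs 0))) (increasing-idem xs) ⟩
    i * increasing xs ≈⟨ increasing-cons x xs ⟨
    increasing (x ∷ xs) ∎
    where
    i : Carrier
    i = indicator (ltM (just x) (at xs 0))

  increasing-row : ∀ {a bs} → Row a bs → increasing bs ≈ 1#
  increasing-row []                               = refl
  increasing-row (cons {b = b} {bs} _ _ before row) = trans (increasing-cons b bs) (trans (*-cong (go before) (increasing-row row)) (*-identityˡ 1#))
    where
    go : ∀ {c m} → Before c m → indicator (ltM (just c) m) ≈ 1#
    go none     = refl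
    go (some p) = ascent-true p

  -- The length condition excludes a nonempty cs over an exhausted bs, where `rowWeight` is 0 but
  -- `interlacing` imposes no condition.
  rowWeight-split : ∀ bs cs → length cs ℕ.≤ length bs → rowWeight bs cs ≈ increasing cs * interlacing cs bs
  rowWeight-split bs       []       _           = sym (*-identityˡ 1#)
  rowWeight-split (b ∷ bs) (c ∷ cs) (ℕ.s≤s len) = trans (*-congˡ (*-congˡ (rowWeight-split bs cs len)))
    (trans (solve 4 (λ w a s t → w :* (a :* (s :* t)) := (a :* s) :* (w :* t)) refl (entryWeight b (at bs 0) c) (ascent c (at cs 0)) _ _)
      (*-congʳ (sym (increasing-cons c cs))))

  -- A new bottom row affects only the cells of the former last row, which had no row below.
  arrayWeight-∷ʳ : ∀ G b → arrayWeight (G ∷ʳ b) ≈ arrayWeight G * (interlacing (lastRow G) b * increasing b)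
  arrayWeight-∷ʳ []          b = solve 1 (λ s → s :* :1 := :1 :* (:1 :* s)) refl (increasing b)
  arrayWeight-∷ʳ (x ∷ [])    b = trans (*-congʳ (rowCells-split x b))
    (solve 3 (λ s i t → (s :* i) :* (t :* :1) := (s :* :1) :* (i :* t)) refl (increasing x) (interlacing x b) (increasing b))
  arrayWeight-∷ʳ (x ∷ y ∷ G) b = trans (*-congˡ (arrayWeight-∷ʳ (y ∷ G) b)) (sym (*-assoc _ _ _))

  increasing-lastRow : ∀ G → increasing (lastRow G) * arrayWeight G ≈ arrayWeight G
  increasing-lastRow []          = *-identityˡ 1#
  increasing-lastRow (x ∷ [])    = trans (sym (*-assoc _ _ _)) (*-congʳ (increasing-idem x))
  increasing-lastRow (x ∷ y ∷ G) = trans (solve 3 (λ a b c → a :* (b :* c) := b :* (a :* c)) refl _ _ _) (*-congˡ (increasing-lastRow (y ∷ G)))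

  ∑-choices-∷ʳ : ∀ (xss : List (List I)) ys (F : List I → Carrier) →
    ∑ (choices (xss ∷ʳ ys)) F ≈ ∑ (choices xss) (λ G → ∑ ys (λ y → F (G ∷ʳ y)))
  ∑-choices-∷ʳ []         ys F = trans (∑-choices ys [] F) (trans (∑-cong ys (λ y → ∑-choices-[] (λ G → F (y ∷ G))))
    (sym (∑-choices-[] (λ G → ∑ ys (λ y → F (G ∷ʳ y))))))
  ∑-choices-∷ʳ (xs ∷ xss) ys F = trans (∑-choices xs (xss ∷ʳ ys) F) (trans (∑-cong xs (λ x → ∑-choices-∷ʳ xss ys (λ G → F (x ∷ G))))
    (sym (∑-choices xs xss (λ G → ∑ ys (λ y → F (G ∷ʳ y))))))

  map-range-bounds : ∀ a n (f : ℕ → List ℕ) → (∀ c → f c ≡ range (a ℕ.+ c)) → applyUpTo f n ≡ List.map range (bounds a n)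
  map-range-bounds a zero    f p = ≡.refl
  map-range-bounds a (suc n) f p = ≡.cong₂ _∷_ (≡.trans (p 0) (≡.cong range (ℕₚ.+-identityʳ a)))
    (map-range-bounds (suc a) n (f ∘ suc) (λ c → ≡.trans (p (suc c)) (≡.cong range (ℕₚ.+-suc a c))))

  rowCands-rows : ∀ m n k r → rowCands m n k r ≡ rows (m ℕ.+ n ℕ.∸ r) (rowLen k r)
  rowCands-rows m n k r = ≡.cong choices (≡.trans (Listₚ.map-upTo _ (rowLen k r))
    (map-range-bounds (m ℕ.+ n ℕ.∸ r) (rowLen k r) _ (λ c → ≡.refl)))

  -- The bounds depend only on m + n and the position, so the rows above the last one are those of
  -- an array for m + 1 and n.
  arrays-suc : ∀ m n k → arrays m (suc n) k ≡ choices (List.map (rowCands (suc m) n k) (upTo n) ∷ʳ rows (suc m) (rowLen k n))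
  arrays-suc m n k = ≡.cong choices (≡.trans (≡.cong (List.map (rowCands m (suc n) k)) (≡.sym (Listₚ.upTo-∷ʳ n)))
    (≡.trans (Listₚ.map-++ (rowCands m (suc n) k) (upTo n) (n ∷ []))
      (≡.cong₂ _∷ʳ_ (Listₚ.map-cong (λ r → ≡.cong (λ a → choices (List.map (λ c → range (a ℕ.∸ r ℕ.+ c)) (upTo (rowLen k r)))) (ℕₚ.+-suc m n)) (upTo n))
        (≡.trans (rowCands-rows m (suc n) k n) (≡.cong (λ a → rows a (rowLen k n))
          (≡.trans (≡.cong (ℕ._∸ n) (ℕₚ.+-suc m n)) (ℕₚ.m+n∸n≡m (suc m) n)))))))

  range-bounds : ∀ a → All (λ c → 1 ℕ.≤ c × c ℕ.≤ a) (range a)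
  range-bounds a = Allₚ.map⁺ (Allₚ.applyUpTo⁺₁ id a (λ i<a → ℕ.s≤s ℕ.z≤n , i<a))

  pointwise-bounded : ∀ a k {cs} → LPW.Pointwise _∈_ cs (List.map range (bounds a k)) → Bounded a cs × length cs ≡ k
  pointwise-bounded a zero    []       = [] , ≡.refl
  pointwise-bounded a (suc k) (p ∷ ps) with pointwise-bounded (suc a) k ps | All.lookup (range-bounds a) p
  ... | bounded , eq | lower , upper = cons lower upper bounded , ≡.cong suc eq

  rows-bounded : ∀ a k → All (λ cs → Bounded a cs × length cs ≡ k) (rows a k)
  rows-bounded a k = All.map (pointwise-bounded a k) (all-choices (List.map range (bounds a k)))

  arrays-lengths : ∀ m n k → All (λ G → length G ≡ n × Lengths (rowLen k) G) (arrays m n k)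
  arrays-lengths m n k = All.map (λ p → go n id p) (all-choices (List.map (rowCands m n k) (upTo n)))
    where
    go : ∀ j e {G} → LPW.Pointwise _∈_ G (List.map (rowCands m n k) (applyUpTo e j)) → length G ≡ j × Lengths (rowLen k ∘ e) G
    go zero    e []       = ≡.refl , []
    go (suc j) e (p ∷ ps) with go j (e ∘ suc) ps
    ... | eq , lens = ≡.cong suc eq , proj₂ (All.lookup (≡.subst (All _) (≡.sym (rowCands-rows m n k (e 0))) (rows-bounded (m ℕ.+ n ℕ.∸ e 0) (rowLen k (e 0)))) p) ∷ lens

  lastRow-bounded : ∀ m n k → All (λ G → Bounded (suc m) (lastRow G) × length (lastRow G) ≡ n ℕ.⊓ k) (arrays m n k)
  lastRow-bounded m zero    k = ([] , ≡.refl) ∷ []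
  lastRow-bounded m (suc n) k = ≡.subst (All _) (≡.sym (arrays-suc m n k))
    (All.map (λ p → All.lookup (rows-bounded (suc m) (rowLen k n)) (lastRow-∈ (List.map (rowCands (suc m) n k) (upTo n)) p))
      (all-choices (List.map (rowCands (suc m) n k) (upTo n) ∷ʳ rows (suc m) (rowLen k n))))

  ∑-rows-pick : ∀ a k xs (F : List ℕ → Carrier) → Bounded a xs → length xs ≡ k → ∑ (rows a k) (λ cs → indicator (sameRow cs xs) * F cs) ≈ F xs
  ∑-rows-pick a zero    []       F _                     _  = trans (∑-choices-[] {ℕ} (λ cs → indicator (sameRow cs []) * F cs)) (*-identityˡ _)
  ∑-rows-pick a (suc k) (x ∷ xs) F (cons 1≤x x≤a bounded) eq = begin
    ∑ (rows a (suc k)) (λ cs → indicator (sameRow cs (x ∷ xs)) * F cs)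
      ≈⟨ ∑-choices (range a) (List.map range (bounds (suc a) k)) _ ⟩
    ∑ (range a) (λ c → ∑ (rows (suc a) k) (λ cs → indicator ((c ℕ.≡ᵇ x) ∧ sameRow cs xs) * F (c ∷ cs)))
      ≈⟨ ∑-cong (range a) (λ c → trans (∑-cong (rows (suc a) k) (λ cs → trans (*-congʳ (indicator-∧ (c ℕ.≡ᵇ x) _)) (*-assoc _ _ _)))
           (trans (∑-*ˡ (rows (suc a) k) _ _) (*-congˡ (∑-rows-pick (suc a) k xs (λ cs → F (c ∷ cs)) bounded (ℕₚ.suc-injective eq))))) ⟩
    ∑ (range a) (λ c → indicator (c ℕ.≡ᵇ x) * F (c ∷ xs))
      ≈⟨ ∑-range-pick a x (λ c → F (c ∷ xs)) 1≤x x≤a ⟩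
    F (x ∷ xs) ∎

  gog-factor : ∀ m n k bs → gog m n k bs ≈ ∑ (arrays m n k) (λ G → indicator (sameRow (lastRow G) bs) * arrayWeight G)
  gog-factor m n k bs = ∑-cong-All (All.map (λ {G} (p , q) → weight-factor n k bs G p q) (arrays-lengths m n k))

  gog-zero : ∀ m k → gog m 0 k [] ≈ 1#
  gog-zero m k = trans (gog-factor m 0 k []) (trans (+-identityʳ _) (*-identityˡ 1#))

  row-bounded : ∀ {a bs} → Row a bs → Bounded a bs
  row-bounded []                = []
  row-bounded (cons p q _ row) = cons p q (row-bounded row)

  -- The prescribed bottom row removes the sum over the last row. The rest of the array is then
  -- classified by its own last row cs, the only part that interacts with bs.
  gog-suc : ∀ m n k bs → Row (suc m) bs → length bs ≡ suc n ℕ.⊓ k →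
    gog m (suc n) k bs ≈ ∑ (rows (suc (suc m)) (n ℕ.⊓ k)) (λ cs → rowWeight bs cs * gog (suc m) n k cs)
  gog-suc m n k bs row eq = begin
    gog m (suc n) k bs
      ≈⟨ gog-factor m (suc n) k bs ⟩
    ∑ (arrays m (suc n) k) (λ G → indicator (sameRow (lastRow G) bs) * arrayWeight G)
      ≡⟨ ≡.cong (λ xs → ∑ xs (λ G → indicator (sameRow (lastRow G) bs) * arrayWeight G)) (arrays-suc m n k) ⟩
    ∑ (choices (List.map (rowCands (suc m) n k) (upTo n) ∷ʳ ys)) (λ G → indicator (sameRow (lastRow G) bs) * arrayWeight G)
      ≈⟨ ∑-choices-∷ʳ (List.map (rowCands (suc m) n k) (upTo n)) ys _ ⟩
    ∑ (arrays (suc m) n k) (λ G → ∑ ys (λ y → indicator (sameRow (lastRow (G ∷ʳ y)) bs) * arrayWeight (G ∷ʳ y)))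
      ≈⟨ ∑-cong (arrays (suc m) n k) (λ G → trans (∑-cong ys (λ y → *-congʳ (reflexive (≡.cong (λ x → indicator (sameRow x bs)) (lastRow-∷ʳ G y)))))
           (∑-rows-pick (suc m) (rowLen k n) bs (λ y → arrayWeight (G ∷ʳ y)) (row-bounded row) eq)) ⟩
    ∑ (arrays (suc m) n k) (λ G → arrayWeight (G ∷ʳ bs))
      ≈⟨ ∑-cong-All (All.map (λ {G} (p , q) → last-weight G p q) (lastRow-bounded (suc m) n k)) ⟩
    ∑ (arrays (suc m) n k) (λ G → ∑ cands (λ cs → rowWeight bs cs * (indicator (sameRow (lastRow G) cs) * arrayWeight G)))
      ≈⟨ ∑-swap (arrays (suc m) n k) cands _ ⟩
    ∑ cands (λ cs → ∑ (arrays (suc m) n k) (λ G → rowWeight bs cs * (indicator (sameRow (lastRow G) cs) * arrayWeight G)))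
      ≈⟨ ∑-cong cands (λ cs → trans (∑-*ˡ (arrays (suc m) n k) (rowWeight bs cs) _) (*-congˡ (sym (gog-factor (suc m) n k cs)))) ⟩
    ∑ cands (λ cs → rowWeight bs cs * gog (suc m) n k cs) ∎
    where
    ys = rows (suc m) (rowLen k n)
    cands = rows (suc (suc m)) (n ℕ.⊓ k)
    last-weight : ∀ G → Bounded (suc (suc m)) (lastRow G) → length (lastRow G) ≡ n ℕ.⊓ k →
      arrayWeight (G ∷ʳ bs) ≈ ∑ cands (λ cs → rowWeight bs cs * (indicator (sameRow (lastRow G) cs) * arrayWeight G))
    last-weight G bounded len = begin
      arrayWeight (G ∷ʳ bs)
        ≈⟨ arrayWeight-∷ʳ G bs ⟩
      arrayWeight G * (interlacing (lastRow G) bs * increasing bs)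
        ≈⟨ *-cong (sym (increasing-lastRow G)) (trans (*-congˡ (increasing-row row)) (*-identityʳ _)) ⟩
      (increasing (lastRow G) * arrayWeight G) * interlacing (lastRow G) bs
        ≈⟨ solve 3 (λ s a i → (s :* a) :* i := (s :* i) :* a) refl _ _ _ ⟩
      (increasing (lastRow G) * interlacing (lastRow G) bs) * arrayWeight G
        ≈⟨ *-congʳ (rowWeight-split bs (lastRow G) (ℕₚ.≤-trans (ℕₚ.≤-reflexive len)
             (ℕₚ.≤-trans (ℕₚ.⊓-monoˡ-≤ k (ℕₚ.n≤1+n n)) (ℕₚ.≤-reflexive (≡.sym eq))))) ⟨
      rowWeight bs (lastRow G) * arrayWeight G
        -- Read backwards: the last row of G is replaced by a sum over all candidates with an
        -- indicator, so that the sums over cs and G can be exchanged.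
        ≈⟨ ∑-rows-pick (suc (suc m)) (n ℕ.⊓ k) (lastRow G) (λ cs → rowWeight bs cs * arrayWeight G) bounded len ⟨
      ∑ cands (λ cs → indicator (sameRow cs (lastRow G)) * (rowWeight bs cs * arrayWeight G))
        ≈⟨ ∑-cong cands (λ cs → trans (solve 3 (λ i w a → i :* (w :* a) := w :* (i :* a)) refl _ _ _)
             (*-congˡ (*-congʳ (reflexive (≡.cong indicator (sameRow-sym cs (lastRow G))))))) ⟩
      ∑ cands (λ cs → rowWeight bs cs * (indicator (sameRow (lastRow G) cs) * arrayWeight G)) ∎

  gog-constantTerm : ∀ m k p bs → Row (suc m) bs → length bs ≡ k →
    gog m (k ℕ.+ p) k bs ≈ constantTerm (k ℕ.+ p) (List.map pow bs ++ extras m k p)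
  gog-constantTerm m k p bs = solution gog gog-zero gog-suc p k m bs

-- Translation of the Laurent polynomials in the statement.

module Expanded (A : Ring₀) (u v : CommutativeRing.Carrier A) where
  open CommutativeRing A hiding (zero)
  open IntegerSolver A using (solve; _:=_; _:+_; _:*_; _:-_; :-_; con; :1)
  open PairFactors A u v

  -- The left side has the summands in the order and bracketing of the lists concatenated in
  -- `pairFactor`.
  expanded : ∀ x y → 1# + (x + (- (v * x) + (u * y + (u * x) * y))) ≈ q x y
  expanded = solve 4 (λ u v x y → :1 :+ (x :+ (:- (v :* x) :+ (u :* y :+ (u :* x) :* y))) := :1 :+ (:1 :- v) :* x :+ u :* (y :+ x :* y)) refl u v

-- All that the translation requires of ℤ[u, v]: its signed monomials multiply as expected.
record Monomials (K : Ring₀) (u v : CommutativeRing.Carrier K) : Set where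
  open CommutativeRing K
  field
    -- τ c p q stands for c u^p v^q.
    τ     : ℤ → ℕ → ℕ → Carrier
    τ-*   : ∀ c p q c′ p′ q′ → τ (c ℤ.* c′) (p ℕ.+ p′) (q ℕ.+ q′) ≈ τ c p q * τ c′ p′ q′
    τ-1   : τ 1ℤ 0 0 ≈ 1#
    τ-neg : τ -1ℤ 0 0 ≈ - 1#
    τ-u   : τ 1ℤ 1 0 ≈ u
    τ-v   : τ 1ℤ 0 1 ≈ v

module Interpretation (K : Ring₀) (u v : CommutativeRing.Carrier K) (monomials : Monomials K u v) where
  open CommutativeRing K hiding (zero)
  open Monomials monomials
  open IntegerSolver K using (solve; _:=_; _:+_; _:*_; _:-_; :-_; con; :1)
  open Relation.Binary.Reasoning.Setoid setoid
  open Sums K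
  private
    module R = RowTheorem K u v
    module Power = Products K

  ⟦_⟧ᵗ : ∀ {n} → Term n → Carrier
  ⟦ t ⟧ᵗ = τ (coeff t) (uexp t) (vexp t)

  ρ : ∀ {n} → LPoly n → (Vec ℤ n → Carrier) → Carrier
  ρ P ψ = ∑ P (λ t → ⟦ t ⟧ᵗ * ψ (xexp t))

  κ : UV → Carrier
  κ P = ∑ P ⟦_⟧ᵗ

  ρ-cong : ∀ {n} (P : LPoly n) {ψ χ : Vec ℤ n → Carrier} → (∀ e → ψ e ≈ χ e) → ρ P ψ ≈ ρ P χ
  ρ-cong P p = ∑-cong P (λ t → *-congˡ (p (xexp t)))

  ρ-⊗ : ∀ {n} (P Q : LPoly n) ψ → ρ (P ⊗ Q) ψ ≈ ρ P (λ e → ρ Q (λ e′ → ψ (zipWith ℤ._+_ e e′)))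
  ρ-⊗ P Q ψ = trans (∑-concatMap (λ s → List.map (mulTerm s) Q) P _) (∑-cong P (λ s → trans (∑-map (mulTerm s) Q _)
    (trans (∑-cong Q (λ t → trans (*-congʳ (τ-* (coeff s) (uexp s) (vexp s) (coeff t) (uexp t) (vexp t))) (*-assoc _ _ _)))
      (∑-*ˡ Q ⟦ s ⟧ᵗ _))))

  ρ-swap : ∀ {n n′} (P : LPoly n) (Q : LPoly n′) (ψ : Vec ℤ n → Vec ℤ n′ → Carrier) →
    ρ P (λ e → ρ Q (ψ e)) ≈ ρ Q (λ e′ → ρ P (λ e → ψ e e′))
  ρ-swap P Q ψ = begin
    ∑ P (λ s → ⟦ s ⟧ᵗ * ∑ Q (λ t → ⟦ t ⟧ᵗ * ψ (xexp s) (xexp t)))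
      ≈⟨ ∑-cong P (λ s → ∑-*ˡ Q ⟦ s ⟧ᵗ _) ⟨
    ∑ P (λ s → ∑ Q (λ t → ⟦ s ⟧ᵗ * (⟦ t ⟧ᵗ * ψ (xexp s) (xexp t))))
      ≈⟨ ∑-swap P Q _ ⟩
    ∑ Q (λ t → ∑ P (λ s → ⟦ s ⟧ᵗ * (⟦ t ⟧ᵗ * ψ (xexp s) (xexp t))))
      ≈⟨ ∑-cong Q (λ t → trans (∑-cong P (λ s → solve 3 (λ a b c → a :* (b :* c) := b :* (a :* c)) refl _ _ _)) (∑-*ˡ P ⟦ t ⟧ᵗ _)) ⟩
    ∑ Q (λ t → ⟦ t ⟧ᵗ * ∑ P (λ s → ⟦ s ⟧ᵗ * ψ (xexp s) (xexp t))) ∎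

  κ-⊗ : ∀ P Q → κ (P ⊗ Q) ≈ κ P * κ Q
  κ-⊗ P Q = trans (∑-concatMap (λ s → List.map (mulTerm s) Q) P _) (trans (∑-cong P (λ s → trans (∑-map (mulTerm s) Q _)
    (trans (∑-cong Q (λ t → τ-* (coeff s) (uexp s) (vexp s) (coeff t) (uexp t) (vexp t))) (trans (∑-*ˡ Q ⟦ s ⟧ᵗ _) (*-comm _ _)))))
    (trans (∑-*ˡ P (κ Q) _) (*-comm _ _)))

  κ-one : κ oneP ≈ 1#
  κ-one = trans (+-identityʳ _) τ-1

  τ-power : ∀ p q → τ 1ℤ p q ≈ u Power.^ p * v Power.^ q
  τ-power zero    zero    = trans τ-1 (sym (*-identityˡ 1#))
  τ-power zero    (suc q) = trans (τ-* 1ℤ 0 1 1ℤ 0 q) (trans (*-cong τ-v (trans (τ-power 0 q) (*-identityˡ _))) (sym (*-identityˡ _)))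
  τ-power (suc p) q       = trans (τ-* 1ℤ 1 0 1ℤ p q) (trans (*-cong τ-u (τ-power p q)) (sym (*-assoc _ _ _)))

  κ-inv : ℕ → Carrier
  κ-inv j = κ (invOnePlusUX j)

  κ-inv-zero : κ-inv 0 ≈ 1#
  κ-inv-zero = trans (+-identityʳ _) τ-1

  κ-inv-suc : ∀ j → κ-inv (suc j) ≈ - u * κ-inv j
  κ-inv-suc j = trans (+-identityʳ _) (trans (τ-* -1ℤ 1 0 (-1ℤ ℤ.^ j) j 0)
    (*-cong (trans (τ-* -1ℤ 0 0 1ℤ 1 0) (trans (*-cong τ-neg τ-u) (solve 1 (λ u → (:- :1) :* u := :- u) refl u))) (sym (+-identityʳ _))))

  inverseSeries : ℕ → R.PowerSeries
  inverseSeries j k = κ (invOnePlusUXPow j k)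

  inverseSeries-zero : ∀ k → inverseSeries 0 k ≈ R.δ k
  inverseSeries-zero zero    = κ-one
  inverseSeries-zero (suc k) = refl

  private
    κ-⋆ : ∀ S T k → κ ((S ⋆ T) k) ≈ ∑ (upTo (suc k)) (λ j → κ (S j) * κ (T (k ℕ.∸ j)))
    κ-⋆ S T k = trans (∑-concatMap (λ j → S j ⊗ T (k ℕ.∸ j)) (upTo (suc k)) _) (∑-cong (upTo (suc k)) (λ j → κ-⊗ (S j) (T (k ℕ.∸ j))))

  -- The coefficients of 1 / (1 + u x) satisfy c (j + 1) = - u c j. In the convolution every term
  -- but the first therefore cancels against u times the preceding coefficient.
  inverseSeries-suc : ∀ j k → R.r (inverseSeries (suc j)) k ≈ inverseSeries j k
  inverseSeries-suc j zero = trans (+-cong (κ-⋆ invOnePlusUX (invOnePlusUXPow j) 0) (zeroʳ u))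
    (trans (solve 2 (λ a b → (a :* b :+ con 0ℤ) :+ con 0ℤ := a :* b) refl _ _) (trans (*-congʳ κ-inv-zero) (*-identityˡ _)))
  inverseSeries-suc j (suc k) = begin
    inverseSeries (suc j) (suc k) + u * inverseSeries (suc j) k
      ≈⟨ +-cong (κ-⋆ invOnePlusUX T (suc k)) (*-congˡ (κ-⋆ invOnePlusUX T k)) ⟩
    (κ-inv 0 * κ (T (suc k)) + ∑ (applyUpTo suc (suc k)) (λ i → κ-inv i * κ (T (suc k ℕ.∸ i)))) + u * C
      ≈⟨ +-congʳ (+-cong (trans (*-congʳ κ-inv-zero) (*-identityˡ _)) (trans (R.∑-applyUpTo (suc k) suc _)
           (trans (∑-cong (upTo (suc k)) (λ i → trans (*-congʳ (κ-inv-suc i)) (*-assoc _ _ _))) (∑-*ˡ (upTo (suc k)) (- u) _)))) ⟩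
    (κ (T (suc k)) + (- u) * C) + u * C
      ≈⟨ solve 3 (λ t u c → (t :+ (:- u) :* c) :+ u :* c := t) refl _ u C ⟩
    κ (T (suc k)) ∎
    where
    T = invOnePlusUXPow j
    C : Carrier
    C = ∑ (upTo (suc k)) (λ i → κ-inv i * κ (T (k ℕ.∸ i)))

  inversePowers : InversePowers K u v
  inversePowers = record { inverse = inverseSeries ; inverse-zero = inverseSeries-zero ; inverse-suc = inverseSeries-suc }

  open GogRecursion K u v inversePowers

  κ-gogGF : ∀ m n k (b : Vec ℕ k) → κ (gogGF m n k b) ≈ gog m n k (toList b)
  κ-gogGF m n k b = trans (∑-concatMap (λ G → if isGogWithBottom n k (toList b) G then term 1ℤ (inv n k G) (inv′ n k G) [] ∷ [] else []) (arrays m n k) ⟦_⟧ᵗ)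
    (∑-cong (arrays m n k) (λ G → go (isGogWithBottom n k (toList b) G) (inv n k G) (inv′ n k G)))
    where
    go : ∀ c p q → κ (if c then term 1ℤ p q [] ∷ [] else []) ≈ indicator c * (u Power.^ p * v Power.^ q)
    go true  p q = trans (+-identityʳ _) (trans (τ-power p q) (sym (*-identityˡ _)))
    go false p q = sym (zeroˡ _)

  -- The coefficient of x^(-z).
  atNeg : PowerSeries → ℤ → Carrier
  atNeg g (+ zero)    = g 0
  atNeg g (+ suc _)   = 0#
  atNeg g -[1+ l ]    = g (suc l)

  κ-coeffAtNeg : ∀ S z → κ (coeffAtNeg S z) ≈ atNeg (λ l → κ (S l)) z
  κ-coeffAtNeg S (+ zero)  = refl
  κ-coeffAtNeg S (+ suc _) = refl
  κ-coeffAtNeg S -[1+ l ]  = refl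

  slotwise : ∀ {n} → (Fin n → ℤ → Carrier) → Vec ℤ n → Carrier
  slotwise {n} h e = ∏ (allFin n) (λ i → h i (lookup e i))

  κ-constTerm : ∀ {n} (P : LPoly n) (S : Fin n → Series) → κ (constTerm P S) ≈ ρ P (slotwise (λ i → atNeg (λ l → κ (S i l))))
  κ-constTerm {n} P S = trans (∑-concatMap _ P ⟦_⟧ᵗ) (∑-cong P (λ t →
    trans (κ-⊗ (term (coeff t) (uexp t) (vexp t) [] ∷ []) (slots (xexp t) (allFin n))) (*-cong (+-identityʳ _) (go (xexp t) (allFin n)))))
    where
    slots : Vec ℤ n → List (Fin n) → UV
    slots e is = prodP (List.map (λ i → coeffAtNeg (S i) (lookup e i)) is)
    go : ∀ e is → κ (slots e is) ≈ ∏ is (λ i → atNeg (λ l → κ (S i l)) (lookup e i))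
    go e []       = κ-one
    go e (i ∷ is) = trans (κ-⊗ (coeffAtNeg (S i) (lookup e i)) (slots e is)) (*-cong (κ-coeffAtNeg (S i) (lookup e i)) (go e is))

  infix 4 _∼_
  -- The bridge from integer to natural exponents, applied to the pair factors, in which no negative
  -- powers occur.
  record _∼_ {n} (P : LPoly n) (Q : Comb n) : Set where
    constructor represents
    field apply : ∀ χ → ρ P χ ≈ ⟨ Q , (λ m → χ (Vec.map +_ m)) ⟩
  open _∼_

  ∼-≋ : ∀ {n} {P : LPoly n} {Q Q′} → P ∼ Q → Q ≋ Q′ → P ∼ Q′
  ∼-≋ p q = represents (λ χ → trans (apply p χ) (pair q _))

  ∼-++ : ∀ {n} {P P′ : LPoly n} {Q Q′} → P ∼ Q → P′ ∼ Q′ → P ++ P′ ∼ Q +′ Q′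
  ∼-++ {P = P} {P′} {Q} {Q′} p q = represents (λ χ → trans (∑-++ P P′ _) (trans (+-cong (apply p χ) (apply q χ)) (sym (⟨⟩-⊞ Q Q′ _))))

  map-zipWith-+ : ∀ {n} (a b : Vec ℕ n) → zipWith ℤ._+_ (Vec.map +_ a) (Vec.map +_ b) ≡ Vec.map +_ (a +ᵉ b)
  map-zipWith-+ []      []      = ≡.refl
  map-zipWith-+ (x ∷ a) (y ∷ b) = ≡.cong (_ ∷_) (map-zipWith-+ a b)

  ∼-⊗ : ∀ {n} {P P′ : LPoly n} {Q Q′} → P ∼ Q → P′ ∼ Q′ → P ⊗ P′ ∼ Q *′ Q′
  ∼-⊗ {P = P} {P′} {Q} {Q′} p q = represents (λ χ → begin
    ρ (P ⊗ P′) χ ≈⟨ ρ-⊗ P P′ χ ⟩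
    ρ P (λ e → ρ P′ (λ e′ → χ (zipWith ℤ._+_ e e′))) ≈⟨ apply p _ ⟩
    ⟨ Q , (λ a → ρ P′ (λ e′ → χ (zipWith ℤ._+_ (Vec.map +_ a) e′))) ⟩ ≈⟨ ⟨⟩-cong Q (λ a → trans (apply q _)
            (⟨⟩-cong Q′ (λ b → reflexive (≡.cong χ (map-zipWith-+ a b))))) ⟩
    ⟨ Q , (λ a → ⟨ Q′ , (λ b → χ (Vec.map +_ (a +ᵉ b))) ⟩) ⟩ ≈⟨ ⟨⟩-⊠ Q Q′ _ ⟨
    ⟨ Q *′ Q′ , (λ m → χ (Vec.map +_ m)) ⟩ ∎)

  ∼-one : ∀ {n} → oneP {n} ∼ 1′
  ∼-one {n} = represents (λ χ → trans (+-identityʳ _) (trans (*-cong τ-1 (reflexive (≡.cong χ (≡.sym (Vecₚ.map-replicate +_ 0 n)))))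
    (sym (⟨⟩-monomial 1# (replicate n 0) _))))

  unit : ∀ {n} → Fin n → Vec ℕ n
  unit {suc n} zero    = 1 ∷ replicate n 0
  unit         (suc i) = 0 ∷ unit i

  lookup-vars : ∀ {n} (i : Fin n) → lookup (vars n) i ≋ monomial 1# (unit i)
  lookup-vars {suc n} zero    = ≋-refl
  lookup-vars {suc n} (suc i) = ≋-trans (P.reflexive (Vecₚ.lookup-map i lift (vars n)))
    (≋-trans (AlgebraHom.cong liftHom (lookup-vars i)) (≋-trans (transport-monomial one (0 ∷_) 1# (unit i)) (monomial-cong (*-identityʳ _) ≡.refl)))

  xvec-unit : ∀ {n} (i : Fin n) → xvec i 1ℤ ≡ Vec.map +_ (unit i)
  xvec-unit {suc n} zero    = ≡.cong (1ℤ ∷_) (≡.trans (go n) (≡.sym (Vecₚ.map-replicate +_ 0 n)))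
    where
    go : ∀ n → Vec.tabulate {n = n} (λ _ → 0ℤ) ≡ replicate n 0ℤ
    go zero    = ≡.refl
    go (suc n) = ≡.cong (0ℤ ∷_) (go n)
  xvec-unit {suc n} (suc i) = ≡.cong (0ℤ ∷_) (≡.trans (Vecₚ.tabulate-cong (λ j → ≡.cong (λ c → if c then 1ℤ else 0ℤ) (go j))) (xvec-unit i))
    where
    go : ∀ j → ⌊ suc j Fin.≟ suc i ⌋ ≡ ⌊ j Fin.≟ i ⌋
    go j with j Fin.≟ i
    ... | yes _ = ≡.refl
    ... | no _  = ≡.refl

  ∼-mono : ∀ {n} c p q (i : Fin n) → mono c p q i 1ℤ ∼ const (τ c p q) *′ lookup (vars n) i
  ∼-mono {n} c p q i = represents (λ χ → begin
    τ c p q * χ (xvec i 1ℤ) + 0# ≈⟨ +-identityʳ _ ⟩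
    τ c p q * χ (xvec i 1ℤ) ≡⟨ ≡.cong (λ e → τ c p q * χ e) (xvec-unit i) ⟩
    τ c p q * χ (Vec.map +_ (unit i)) ≈⟨ *-congˡ (⟨⟩-unit (unit i) (λ m → χ (Vec.map +_ m))) ⟨
    τ c p q * ⟨ monomial 1# (unit i) , (λ m → χ (Vec.map +_ m)) ⟩ ≈⟨ *-congˡ (pair (lookup-vars i) _) ⟨
    τ c p q * ⟨ lookup (vars n) i , (λ m → χ (Vec.map +_ m)) ⟩ ≈⟨ const-* (τ c p q) (lookup (vars n) i) _ ⟨
    ⟨ const (τ c p q) *′ lookup (vars n) i , (λ m → χ (Vec.map +_ m)) ⟩ ∎)

  module _ {n : ℕ} where
    private
      x : Fin n → Comb n
      x = lookup (vars n)

    const-cong : ∀ {c c′} → c ≈ c′ → const {n} c ≋ const c′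
    const-cong p = monomial-cong p ≡.refl

    const-one-* : ∀ {c} (P : Comb n) → c ≈ 1# → const c *′ P ≋ P
    const-one-* P p = ≋-trans (*′-congʳ {x = P} (const-cong p)) (*′-identityˡ P)

    const-neg-* : ∀ {c d} (P : Comb n) → c ≈ - d → const c *′ P ≋ -′ (const d *′ P)
    const-neg-* {c} {d} P p = pairing≈ (λ ψ → begin
      ⟨ const c *′ P , ψ ⟩ ≈⟨ const-* c P ψ ⟩
      c * ⟨ P , ψ ⟩ ≈⟨ *-congʳ p ⟩
      - d * ⟨ P , ψ ⟩ ≈⟨ solve 2 (λ d a → (:- d) :* a := (:- :1) :* (d :* a)) refl d _ ⟩
      - 1# * (d * ⟨ P , ψ ⟩) ≈⟨ *-congˡ (const-* d P ψ) ⟨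
      - 1# * ⟨ const d *′ P , ψ ⟩ ≈⟨ ⟨⟩-scale (- 1#) (const d *′ P) ψ ⟨
      ⟨ -′ (const d *′ P) , ψ ⟩ ∎)

    ∼-x : ∀ i → mono 1ℤ 0 0 i 1ℤ ∼ x i
    ∼-x i = ∼-≋ (∼-mono 1ℤ 0 0 i) (const-one-* (x i) τ-1)

    ∼-neg-x : ∀ i → mono -1ℤ 0 0 i 1ℤ ∼ -′ x i
    ∼-neg-x i = ∼-≋ (∼-mono -1ℤ 0 0 i) (≋-trans (const-neg-* (x i) τ-neg) (-′-cong (*′-identityˡ (x i))))

    ∼-neg-vx : ∀ i → mono -1ℤ 0 1 i 1ℤ ∼ -′ (const v *′ x i)
    ∼-neg-vx i = ∼-≋ (∼-mono -1ℤ 0 1 i) (const-neg-* (x i) (trans (τ-* -1ℤ 0 0 1ℤ 0 1)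
      (trans (*-cong τ-neg τ-v) (solve 1 (λ v → (:- :1) :* v := :- v) refl v))))

    ∼-ux : ∀ i → mono 1ℤ 1 0 i 1ℤ ∼ const u *′ x i
    ∼-ux i = ∼-≋ (∼-mono 1ℤ 1 0 i) (*′-congʳ {x = x i} (const-cong τ-u))

    ∼-pairFactor : ∀ i j → pairFactor i j ∼ F.pairFactor′ (x i) (x j)
    ∼-pairFactor i j = ∼-≋
      (∼-⊗ (∼-++ (∼-x i) (∼-neg-x j)) (∼-++ ∼-one (∼-++ (∼-x i) (∼-++ (∼-neg-vx i) (∼-++ (∼-ux j) (∼-⊗ (∼-ux i) (∼-x j)))))))
      (*′-congˡ {x = x i -′ x j} (Expanded.expanded (Poly n) (const u) (const v) (x i) (x j)))

  module _ {n : ℕ} where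
    module PL = ListProducts (Poly n)

    ∼-prodP : ∀ {I : Set} (f : I → LPoly n) (g : I → Comb n) is → (∀ i → f i ∼ g i) → prodP (List.map f is) ∼ PL.∏ is g
    ∼-prodP f g []       p = ∼-one
    ∼-prodP f g (i ∷ is) p = ∼-⊗ (p i) (∼-prodP f g is p)

    ∼-pairs : prodP (List.map (λ { (i , j) → pairFactor i j }) (pairs n)) ∼ V n
    ∼-pairs = ∼-≋ (∼-prodP _ (λ { (i , j) → F.pairFactor′ (lookup (vars n) i) (lookup (vars n) j) }) (pairs n) (λ { (i , j) → ∼-pairFactor i j }))
      (PL.∏-pairs F.pairFactor′ (vars n))

  -- A product is additive in one factor when the others are fixed; thus 1 + xᵢ acts on slot i
  -- alone.
  ∏-slot-+ : ∀ {n} (i : Fin n) (f g h : Fin n → Carrier) → h i ≈ f i + g i →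
    (∀ j → j ≢ i → f j ≈ h j) → (∀ j → j ≢ i → g j ≈ h j) → ∏ (allFin n) h ≈ ∏ (allFin n) f + ∏ (allFin n) g
  ∏-slot-+ {suc n} zero f g h p q s = begin
    ∏ (allFin (suc n)) h ≈⟨ ∏-allFin-suc n h ⟩
    h zero * rest h ≈⟨ trans (*-congʳ p) (distribʳ _ _ _) ⟩
    f zero * rest h + g zero * rest h
      ≈⟨ +-cong (*-congˡ (∏-cong (allFin n) (λ j → q (suc j) (λ ())))) (*-congˡ (∏-cong (allFin n) (λ j → s (suc j) (λ ())))) ⟨
    f zero * rest f + g zero * rest g ≈⟨ +-cong (∏-allFin-suc n f) (∏-allFin-suc n g) ⟨
    ∏ (allFin (suc n)) f + ∏ (allFin (suc n)) g ∎
    where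
    rest : (Fin (suc n) → Carrier) → Carrier
    rest h = ∏ (allFin n) (h ∘ suc)
  ∏-slot-+ {suc n} (suc i) f g h p q s = begin
    ∏ (allFin (suc n)) h ≈⟨ ∏-allFin-suc n h ⟩
    h zero * rest h ≈⟨ *-congˡ (∏-slot-+ i (f ∘ suc) (g ∘ suc) (h ∘ suc) p
            (λ j ne → q (suc j) (ne ∘ Finₚ.suc-injective)) (λ j ne → s (suc j) (ne ∘ Finₚ.suc-injective))) ⟩
    h zero * (rest f + rest g) ≈⟨ distribˡ _ _ _ ⟩
    h zero * rest f + h zero * rest g ≈⟨ +-cong (*-congʳ (q zero (λ ()))) (*-congʳ (s zero (λ ()))) ⟨
    f zero * rest f + g zero * rest g ≈⟨ +-cong (∏-allFin-suc n f) (∏-allFin-suc n g) ⟨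
    ∏ (allFin (suc n)) f + ∏ (allFin (suc n)) g ∎
    where
    rest : (Fin (suc n) → Carrier) → Carrier
    rest h = ∏ (allFin n) (h ∘ suc)

  infixl 6 _+ᶻ_
  _+ᶻ_ : ∀ {n} → Vec ℤ n → Vec ℤ n → Vec ℤ n
  _+ᶻ_ = zipWith ℤ._+_

  -- Laurent polynomials act on functions of the exponents by translation.
  act : ∀ {n} → LPoly n → (Vec ℤ n → Carrier) → Vec ℤ n → Carrier
  act P ψ e′ = ρ P (λ e → ψ (e +ᶻ e′))

  act-cong : ∀ {n} (P : LPoly n) {ψ χ} → (∀ e → ψ e ≈ χ e) → ∀ e → act P ψ e ≈ act P χ e
  act-cong P p e = ρ-cong P (λ _ → p _)

  act-⊗ : ∀ {n} (P Q : LPoly n) ψ e → act (P ⊗ Q) ψ e ≈ act P (act Q ψ) e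
  act-⊗ P Q ψ e = trans (ρ-⊗ P Q _) (ρ-cong P (λ e₁ → ρ-cong Q (λ e₂ → reflexive (≡.cong ψ
    (≡.trans (≡.cong (_+ᶻ e) (Vecₚ.zipWith-comm ℤₚ.+-comm e₁ e₂)) (Vecₚ.zipWith-assoc ℤₚ.+-assoc e₂ e₁ e))))))

  Coefficient : Set
  Coefficient = ℤ → Carrier

  update : ∀ {n} → Fin n → (Coefficient → Coefficient) → (Fin n → Coefficient) → Fin n → Coefficient
  update i T h j = if does (j Fin.≟ i) then T (h j) else h j

  update-same : ∀ {n} (i : Fin n) T h → update i T h i ≡ T (h i)
  update-same i T h rewrite dec-true (i Fin.≟ i) ≡.refl = ≡.refl

  update-other : ∀ {n} {i j : Fin n} T h → j ≢ i → update i T h j ≡ h j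
  update-other {i = i} {j} T h ne rewrite dec-false (j Fin.≟ i) ne = ≡.refl

  slotwise-cong : ∀ {n} {h h′ : Fin n → Coefficient} → (∀ i z → h i z ≈ h′ i z) → ∀ e → slotwise h e ≈ slotwise h′ e
  slotwise-cong {n} p e = ∏-cong (allFin n) (λ i → p i (lookup e i))

  translate : ℤ → Coefficient → Coefficient
  translate s h z = h (s ℤ.+ z)

  -- The action of (1 + x) ^ a on one slot. Slots are functions of the exponent, so by duality a
  -- factor x shifts the argument up by 1.
  times-1+x : ℕ → Coefficient → Coefficient
  times-1+x zero    h z = h z
  times-1+x (suc a) h z = times-1+x a h z + times-1+x a h (1ℤ ℤ.+ z)

  act-mono : ∀ {n} (i : Fin n) s h e → act (mono 1ℤ 0 0 i s) (slotwise h) e ≈ slotwise (update i (translate s) h) e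
  act-mono {n} i s h e = trans (+-identityʳ _) (trans (*-congʳ τ-1) (trans (*-identityˡ _) (∏-cong (allFin n) (λ j → reflexive (go j)))))
    where
    go : ∀ j → h j (lookup (xvec i s +ᶻ e) j) ≡ update i (translate s) h j (lookup e j)
    go j rewrite Vecₚ.lookup-zipWith ℤ._+_ j (xvec i s) e | Vecₚ.lookup∘tabulate (λ j → if ⌊ j Fin.≟ i ⌋ then s else 0ℤ) j | isYes≗does (j Fin.≟ i) with does (j Fin.≟ i)
    ... | true  = ≡.refl
    ... | false = ≡.cong (h j) (ℤₚ.+-identityˡ (lookup e j))

  act-onePlusX : ∀ {n} (i : Fin n) h e → act (onePlusX i) (slotwise h) e ≈ slotwise (update i (times-1+x 1) h) e
  act-onePlusX {n} i h e = begin
    act (onePlusX i) (slotwise h) e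
      ≈⟨ ∑-++ oneP (mono 1ℤ 0 0 i 1ℤ) (λ t → ⟦ t ⟧ᵗ * slotwise h (xexp t +ᶻ e)) ⟩
    act oneP (slotwise h) e + act (mono 1ℤ 0 0 i 1ℤ) (slotwise h) e
      ≈⟨ +-cong (trans (+-identityʳ _) (trans (*-congʳ τ-1) (trans (*-identityˡ _)
           (reflexive (≡.cong (slotwise h) (Vecₚ.zipWith-identityˡ ℤₚ.+-identityˡ e)))))) (act-mono i 1ℤ h e) ⟩
    slotwise h e + slotwise (update i (translate 1ℤ) h) e
      ≈⟨ ∏-slot-+ i (λ j → h j (lookup e j)) (λ j → update i (translate 1ℤ) h j (lookup e j)) (λ j → update i (times-1+x 1) h j (lookup e j))
           (trans (reflexive (≡.cong (λ f → f (lookup e i)) (update-same i (times-1+x 1) h)))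
             (+-congˡ (reflexive (≡.sym (≡.cong (λ f → f (lookup e i)) (update-same i (translate 1ℤ) h))))))
           (λ j ne → reflexive (≡.sym (≡.cong (λ f → f (lookup e j)) (update-other (times-1+x 1) h ne))))
           (λ j ne → reflexive (≡.cong (λ f → f (lookup e j)) (≡.trans (update-other (translate 1ℤ) h ne) (≡.sym (update-other (times-1+x 1) h ne))))) ⟨
    slotwise (update i (times-1+x 1) h) e ∎

  update-∘ : ∀ {n} (i : Fin n) T T′ h j → update i T (update i T′ h) j ≡ update i (T ∘ T′) h j
  update-∘ i T T′ h j with does (j Fin.≟ i)
  ... | true  = ≡.refl
  ... | false = ≡.refl

  act-powP : ∀ {n} (i : Fin n) a h e → act (powP (onePlusX i) a) (slotwise h) e ≈ slotwise (update i (times-1+x a) h) e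
  act-powP i zero h e = trans (+-identityʳ _) (trans (*-congʳ τ-1) (trans (*-identityˡ _)
    (trans (reflexive (≡.cong (slotwise h) (Vecₚ.zipWith-identityˡ ℤₚ.+-identityˡ e))) (slotwise-cong go e))))
    where
    go : ∀ j z → h j z ≈ update i (times-1+x 0) h j z
    go j z with does (j Fin.≟ i)
    ... | true  = refl
    ... | false = refl
  act-powP i (suc a) h e = begin
    act (onePlusX i ⊗ powP (onePlusX i) a) (slotwise h) e
      ≈⟨ act-⊗ (onePlusX i) (powP (onePlusX i) a) (slotwise h) e ⟩
    act (onePlusX i) (act (powP (onePlusX i) a) (slotwise h)) e ≈⟨ act-cong (onePlusX i) (act-powP i a h) e ⟩
    act (onePlusX i) (slotwise (update i (times-1+x a) h)) e ≈⟨ act-onePlusX i (update i (times-1+x a) h) e ⟩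
    slotwise (update i (times-1+x 1) (update i (times-1+x a) h)) e
      ≈⟨ slotwise-cong (λ j z → reflexive (≡.cong (λ f → f z) (update-∘ i (times-1+x 1) (times-1+x a) h j))) e ⟩
    slotwise (update i (times-1+x (suc a)) h) e ∎

  act-single : ∀ {n} (i : Fin n) a s h e → act (powP (onePlusX i) a ⊗ mono 1ℤ 0 0 i s) (slotwise h) e ≈ slotwise (update i (times-1+x a ∘ translate s) h) e
  act-single i a s h e = trans (act-⊗ (powP (onePlusX i) a) (mono 1ℤ 0 0 i s) (slotwise h) e)
    (trans (act-cong (powP (onePlusX i) a) (act-mono i s h) e) (trans (act-powP i a (update i (translate s) h) e)
      (slotwise-cong (λ j z → reflexive (≡.cong (λ f → f z) (update-∘ i (times-1+x a) (translate s) h j))) e)))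

  module _ {n : ℕ} (single : Fin n → LPoly n) (T : Fin n → Coefficient → Coefficient)
           (act-T : ∀ i h e → act (single i) (slotwise h) e ≈ slotwise (update i (T i) h) e) where
    updates : (Fin n → Coefficient) → List (Fin n) → Fin n → Coefficient
    updates h = List.foldr (λ i h → update i (T i) h) h

    act-prodP : ∀ is h e → act (prodP (List.map single is)) (slotwise h) e ≈ slotwise (updates h is) e
    act-prodP []       h e = trans (+-identityʳ _) (trans (*-congʳ τ-1) (trans (*-identityˡ _)
      (reflexive (≡.cong (slotwise h) (Vecₚ.zipWith-identityˡ ℤₚ.+-identityˡ e)))))
    act-prodP (i ∷ is) h e = trans (act-⊗ (single i) _ (slotwise h) e)
      (trans (act-cong (single i) (act-prodP is h) e) (act-T i (updates h is) e))

    updates-other : ∀ {m} h (f : Fin m → Fin n) j → (∀ i → j ≢ f i) → updates h (tabulate f) j ≡ h j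
    updates-other {zero}  h f j ne = ≡.refl
    updates-other {suc m} h f j ne = ≡.trans (update-other (T (f zero)) (updates h (tabulate (f ∘ suc))) (ne zero)) (updates-other h (f ∘ suc) j (ne ∘ suc))

    updates-tabulate : ∀ {m} h (f : Fin m → Fin n) → (∀ {i j} → f i ≡ f j → i ≡ j) → ∀ j → updates h (tabulate f) (f j) ≡ T (f j) (h (f j))
    updates-tabulate h f inj zero = ≡.trans (update-same (f zero) (T (f zero)) (updates h (tabulate (f ∘ suc))))
      (≡.cong (T (f zero)) (updates-other h (f ∘ suc) (f zero) (λ i eq → Finₚ.0≢1+n (inj eq))))
    updates-tabulate h f inj (suc j) = ≡.trans (update-other (T (f zero)) (updates h (tabulate (f ∘ suc))) (λ eq → Finₚ.0≢1+n (≡.sym (inj eq))))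
      (updates-tabulate h (f ∘ suc) (λ eq → Finₚ.suc-injective (inj eq)) j)

    -- Every index occurs exactly once in `allFin n`, so slot i is changed by T i only.
    act-all : ∀ h e → act (prodP (List.map single (allFin n))) (slotwise h) e ≈ slotwise (λ i → T i (h i)) e
    act-all h e = trans (act-prodP (allFin n) h e)
      (slotwise-cong (λ i z → reflexive (≡.cong (λ f → f z) (updates-tabulate h id id i))) e)

  -- The factors in a single variable, with their negative powers, leave the polynomial and act on
  -- the functional instead. Only the pair factors remain, and they are represented by `V n`.
  ρ-integrand : ∀ {n} (P Q : LPoly n) ψ → ρ (P ⊗ Q) ψ ≈ ρ Q (act P ψ)
  ρ-integrand P Q ψ = trans (ρ-⊗ P Q ψ) (ρ-swap P Q (λ e e′ → ψ (e +ᶻ e′)))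

  atNeg-1+x : ∀ g z → atNeg g z + atNeg g (1ℤ ℤ.+ z) ≈ atNeg (1+ 1# x g) z
  atNeg-1+x g (+ zero)       = +-congˡ (sym (zeroʳ 1#))
  atNeg-1+x g (+ suc z)      = +-identityˡ 0#
  atNeg-1+x g -[1+ zero ]    = +-congˡ (sym (*-identityˡ _))
  atNeg-1+x g -[1+ suc z ]   = +-congˡ (sym (*-identityˡ _))

  atNeg-X : ∀ g z → atNeg g (1ℤ ℤ.+ z) ≈ atNeg (X g) z
  atNeg-X g (+ zero)     = refl
  atNeg-X g (+ suc z)    = refl
  atNeg-X g -[1+ zero ]  = refl
  atNeg-X g -[1+ suc z ] = refl

  atNeg-shift : ∀ j g z → atNeg g (+ j ℤ.+ z) ≈ atNeg (shift j g) z
  atNeg-shift zero    g z = reflexive (≡.cong (atNeg g) (ℤₚ.+-identityˡ z))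
  atNeg-shift (suc j) g z = trans (reflexive (≡.cong (atNeg g) index)) (trans (atNeg-shift j g (1ℤ ℤ.+ z)) (atNeg-X (shift j g) z))
    where
    index : + suc j ℤ.+ z ≡ + j ℤ.+ (1ℤ ℤ.+ z)
    index = ≡.trans (≡.cong (ℤ._+ z) (ℤₚ.+-comm 1ℤ (+ j))) (ℤₚ.+-assoc (+ j) 1ℤ z)

  times-1+x-atNeg : ∀ a s g z → times-1+x a (translate s (atNeg g)) z ≈ atNeg (binomials a g) (s ℤ.+ z)
  times-1+x-atNeg zero    s g z = refl
  times-1+x-atNeg (suc a) s g z = trans (+-cong (times-1+x-atNeg a s g z) (trans (times-1+x-atNeg a s g (1ℤ ℤ.+ z))
    (reflexive (≡.cong (atNeg (binomials a g)) (≡.trans (≡.sym (ℤₚ.+-assoc s 1ℤ z)) (≡.trans (≡.cong (ℤ._+ z) (ℤₚ.+-comm s 1ℤ)) (ℤₚ.+-assoc 1ℤ s z)))))))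
    (atNeg-1+x (binomials a g) (s ℤ.+ z))

  atNeg-coefficient : ∀ N g e → atNeg g (e ℤ.⊖ N) ≈ coefficient N g e
  atNeg-coefficient zero    g zero    = refl
  atNeg-coefficient zero    g (suc e) = refl
  atNeg-coefficient (suc N) g zero    = refl
  atNeg-coefficient (suc N) g (suc e) = trans (reflexive (≡.cong (atNeg g) (ℤₚ.[1+m]⊖[1+n]≡m⊖n e N))) (atNeg-coefficient N g e)

  slotwise-coefficients : ∀ {n} N (h : Fin n → Coefficient) (G : Fin n → PowerSeries) m →
    (∀ i e → h i (+ e) ≈ coefficient N (G i) e) → slotwise h (Vec.map +_ m) ≈ coefficients N (Vec.tabulate G) m
  slotwise-coefficients N h G []      p = refl
  slotwise-coefficients {suc n} N h G (e ∷ m) p = trans (∏-allFin-suc n (λ i → h i (lookup (Vec.map +_ (e ∷ m)) i)))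
    (*-cong (p zero e) (slotwise-coefficients N (h ∘ suc) (G ∘ suc) m (λ i → p (suc i))))

  module _ (m n k : ℕ) (b : Vec ℕ k) where
    factorBinomial : Fin n → ℕ
    factorBinomial i = if toℕ i ℕ.<ᵇ k then bAt b (toℕ i) else m ℕ.+ suc (toℕ i) ℕ.+ 1

    factorShift : Fin n → ℤ
    factorShift i = if toℕ i ℕ.<ᵇ k then 1ℤ ℤ.- + n else (ℤ.- (+ n)) ℤ.+ + suc (toℕ i) ℤ.- + k

    factorSeries : Fin n → PowerSeries
    factorSeries i = if toℕ i ℕ.<ᵇ k then pow (bAt b (toℕ i)) else shift (toℕ i ℕ.∸ k) (binomials (m ℕ.+ suc (toℕ i) ℕ.+ 1) (inverse (suc (toℕ i) ℕ.∸ k)))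

    T : Fin n → Coefficient → Coefficient
    T i = times-1+x (factorBinomial i) ∘ translate (factorShift i)

    act-singleFactor : ∀ i h e → act (singleFactor m n k b i) (slotwise h) e ≈ slotwise (update i (T i) h) e
    act-singleFactor i h e with toℕ i ℕ.<ᵇ k
    ... | true  = act-single i (bAt b (toℕ i)) (1ℤ ℤ.- + n) h e
    ... | false = act-single i (m ℕ.+ suc (toℕ i) ℕ.+ 1) ((ℤ.- (+ n)) ℤ.+ + suc (toℕ i) ℤ.- + k) h e

    initial : Fin n → Coefficient
    initial i = atNeg (λ l → κ (integrandSeries n k i l))

    T-initial : ∀ i e → T i (initial i) (+ e) ≈ coefficient (ℕ.pred n) (factorSeries i) e
    T-initial i e with toℕ i ℕ.<ᵇ k in eq
    ... | true = begin
      times-1+x a (translate s (atNeg (λ l → κ (oneS l)))) (+ e)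
        ≈⟨ times-1+x-atNeg a s (λ l → κ (oneS l)) (+ e) ⟩
      atNeg (binomials a (λ l → κ (oneS l))) (s ℤ.+ + e)
        ≡⟨ ≡.cong (atNeg (binomials a (λ l → κ (oneS l)))) (index i) ⟩
      atNeg (binomials a (λ l → κ (oneS l))) (e ℤ.⊖ ℕ.pred n)
        ≈⟨ atNeg-coefficient (ℕ.pred n) (binomials a (λ l → κ (oneS l))) e ⟩
      coefficient (ℕ.pred n) (binomials a (λ l → κ (oneS l))) e
        ≈⟨ coefficient-≐ (ℕ.pred n) e (≐-trans (binomials-cong a inverse-zero) (λ l → sym (pow-binomials a l))) ⟩
      coefficient (ℕ.pred n) (pow a) e ∎
      where
      a = bAt b (toℕ i)
      s = 1ℤ ℤ.- + n
      -- The existence of an index forces n = suc N, so `ℕ.pred n` is really n - 1 here.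
      index : ∀ {n} → Fin n → (1ℤ ℤ.- + n) ℤ.+ + e ≡ e ℤ.⊖ ℕ.pred n
      index {suc N} _ = ≡.trans (ℤS.solve 2 (λ N e → (ℤS.:1 ℤS.:- (ℤS.:1 ℤS.:+ N)) ℤS.:+ e ℤS.:= e ℤS.:- N) ≡.refl (+ N) (+ e)) (ℤₚ.m-n≡m⊖n e N)
        where module ℤS = IntegerSolver ℤₚ.+-*-commutativeRing
    ... | false = begin
      times-1+x a (translate s (atNeg g)) (+ e) ≈⟨ times-1+x-atNeg a s g (+ e) ⟩
      atNeg (binomials a g) (s ℤ.+ + e) ≡⟨ ≡.cong (atNeg (binomials a g)) (index i k≤i) ⟩
      atNeg (binomials a g) (+ j ℤ.+ (e ℤ.⊖ ℕ.pred n)) ≈⟨ atNeg-shift j (binomials a g) (e ℤ.⊖ ℕ.pred n) ⟩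
      atNeg (shift j (binomials a g)) (e ℤ.⊖ ℕ.pred n)
        ≈⟨ atNeg-coefficient (ℕ.pred n) (shift j (binomials a g)) e ⟩
      coefficient (ℕ.pred n) (shift j (binomials a g)) e ∎
      where
      a = m ℕ.+ suc (toℕ i) ℕ.+ 1
      s = (ℤ.- (+ n)) ℤ.+ + suc (toℕ i) ℤ.- + k
      -- As `toℕ i` counts from 0, this is i - k - 1 for the index i of the statement: the power of
      -- x beyond the common x^(1 - n).
      j = toℕ i ℕ.∸ k
      g = inverse (suc (toℕ i) ℕ.∸ k)
      k≤i : k ℕ.≤ toℕ i
      k≤i with k ℕ.≤? toℕ i
      ... | yes p = p
      ... | no ¬p = contradiction (≡.trans (≡.sym eq) (≤ᵇ-true (ℕₚ.≰⇒> ¬p))) (λ ())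
      index : ∀ {n} (i : Fin n) → k ℕ.≤ toℕ i → ((ℤ.- (+ n)) ℤ.+ + suc (toℕ i) ℤ.- + k) ℤ.+ + e ≡ + (toℕ i ℕ.∸ k) ℤ.+ (e ℤ.⊖ ℕ.pred n)
      index {suc N} i k≤i = ≡.trans (≡.cong (λ t → ((ℤ.- (+ suc N)) ℤ.+ + suc t ℤ.- + k) ℤ.+ + e) (≡.sym (ℕₚ.m+[n∸m]≡n k≤i)))
        (≡.trans (ℤS.solve 4 (λ N k j e → (((ℤS.:- (ℤS.:1 ℤS.:+ N)) ℤS.:+ (ℤS.:1 ℤS.:+ (k ℤS.:+ j))) ℤS.:- k) ℤS.:+ e ℤS.:= j ℤS.:+ (e ℤS.:- N))
            ≡.refl (+ N) (+ k) (+ (toℕ i ℕ.∸ k)) (+ e))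
          (≡.cong (λ z → + (toℕ i ℕ.∸ k) ℤ.+ z) (ℤₚ.m-n≡m⊖n e N)))
        where module ℤS = IntegerSolver ℤₚ.+-*-commutativeRing

    κ-integrand : κ (constTerm (integrandPoly m n k b) (integrandSeries n k)) ≈ Λ (ℕ.pred n) (Vec.tabulate factorSeries) (V n)
    κ-integrand = begin
      κ (constTerm (integrandPoly m n k b) (integrandSeries n k))
        ≈⟨ κ-constTerm (integrandPoly m n k b) (integrandSeries n k) ⟩
      ρ (singles ⊗ pairFactors) (slotwise initial) ≈⟨ ρ-integrand singles pairFactors (slotwise initial) ⟩
      ρ pairFactors (act singles (slotwise initial))
        ≈⟨ ρ-cong pairFactors (act-all (singleFactor m n k b) T act-singleFactor initial) ⟩
      ρ pairFactors (slotwise (λ i → T i (initial i))) ≈⟨ _∼_.apply ∼-pairs _ ⟩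
      ⟨ V n , (λ e → slotwise (λ i → T i (initial i)) (Vec.map +_ e)) ⟩
        ≈⟨ ⟨⟩-cong (V n) (λ e → slotwise-coefficients (ℕ.pred n) (λ i → T i (initial i)) factorSeries e T-initial) ⟩
      Λ (ℕ.pred n) (Vec.tabulate factorSeries) (V n) ∎
      where
      singles pairFactors : LPoly n
      singles = prodP (List.map (singleFactor m n k b) (allFin n))
      pairFactors = prodP (List.map (λ { (i , j) → pairFactor i j }) (pairs n))

  pad-lookup : ∀ n (G : Fin n → PowerSeries) gs → (∀ i → at gs (toℕ i) ≡ just (G i)) → Vec.tabulate G ≡ pad n gs
  pad-lookup zero    G gs       p = ≡.refl
  pad-lookup (suc n) G []       p = contradiction (p zero) (λ ())
  pad-lookup (suc n) G (g ∷ gs) p with p zero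
  ... | ≡.refl = ≡.cong (G zero ∷_) (pad-lookup n (G ∘ suc) gs (λ i → p (suc i)))

  at-map-++ˡ : ∀ {A B : Set} (f : A → B) xs ys t {a} → at xs t ≡ just a → at (List.map f xs ++ ys) t ≡ just (f a)
  at-map-++ˡ f (x ∷ xs) ys zero    ≡.refl = ≡.refl
  at-map-++ˡ f (x ∷ xs) ys (suc t) p      = at-map-++ˡ f xs ys t p

  at-++ʳ : ∀ {A : Set} (xs ys : List A) t → at (xs ++ ys) (length xs ℕ.+ t) ≡ at ys t
  at-++ʳ []       ys t = ≡.refl
  at-++ʳ (x ∷ xs) ys t = at-++ʳ xs ys t

  at-applyUpTo : ∀ {A : Set} (f : ℕ → A) n t → t ℕ.< n → at (applyUpTo f n) t ≡ just (f t)
  at-applyUpTo f (suc n) zero    _           = ≡.refl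
  at-applyUpTo f (suc n) (suc t) (ℕ.s≤s t<n) = at-applyUpTo (f ∘ suc) n t t<n

  at-toList : ∀ {k} (b : Vec ℕ k) t → t ℕ.< k → at (toList b) t ≡ just (bAt b t)
  at-toList b t t<k with at (toList b) t | defined b t t<k
    where
    defined : ∀ {k} (b : Vec ℕ k) t → t ℕ.< k → ∃ λ a → at (toList b) t ≡ just a
    defined (a ∷ b) zero    _           = a , ≡.refl
    defined (a ∷ b) (suc t) (ℕ.s≤s t<k) = defined b t t<k
  ... | just a | _ = ≡.refl

  factorSeries-at : ∀ m k p (b : Vec ℕ k) i → at (List.map pow (toList b) ++ extras m k p) (toℕ i) ≡ just (factorSeries m (k ℕ.+ p) k b i)
  factorSeries-at m k p b i with toℕ i ℕ.<? k
  ... | yes i<k rewrite ≤ᵇ-true i<k = at-map-++ˡ pow (toList b) (extras m k p) (toℕ i) (at-toList b (toℕ i) i<k)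
  ... | no  i≮k rewrite ≤ᵇ-false (ℕ.s≤s (ℕₚ.≮⇒≥ i≮k)) = go (toℕ i) (ℕₚ.m+[n∸m]≡n (ℕₚ.≮⇒≥ i≮k)) (Finₚ.toℕ<n i)
    where
    go : ∀ t → k ℕ.+ (t ℕ.∸ k) ≡ t → t ℕ.< k ℕ.+ p → at (List.map pow (toList b) ++ extras m k p) t ≡
         just (shift (t ℕ.∸ k) (binomials (m ℕ.+ suc t ℕ.+ 1) (inverse (suc t ℕ.∸ k))))
    go t eq t<n = ≡.trans (≡.cong (at gs) (≡.trans (≡.sym eq) (≡.cong (ℕ._+ j) (≡.sym (≡.trans (Listₚ.length-map pow (toList b)) (Vecₚ.length-toList b))))))
      (≡.trans (at-++ʳ (List.map pow (toList b)) (extras m k p) j) (≡.trans (at-applyUpTo (extra m k) p j j<p)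
        (≡.cong just (≡.cong₂ (λ x y → shift j (binomials (m ℕ.+ suc x ℕ.+ 1) (inverse y))) eq (≡.trans (≡.cong suc ≡.refl) (≡.sym suc∸))))))
      where
      gs = List.map pow (toList b) ++ extras m k p
      j = t ℕ.∸ k
      k≤t : k ℕ.≤ t
      k≤t = ≡.subst (k ℕ.≤_) eq (ℕₚ.m≤m+n k j)
      suc∸ : suc t ℕ.∸ k ≡ suc j
      suc∸ = ℕₚ.+-∸-assoc 1 k≤t
      j<p : j ℕ.< p
      j<p = ℕₚ.+-cancelˡ-< k j p (≡.subst (ℕ._< k ℕ.+ p) (≡.sym eq) t<n)

  -- Only the last entry is bounded by hypothesis. The strict increase passes the bound to the left,
  -- one less at each step.
  toList-row : ∀ {k} a (b : Vec ℕ k) → (∀ i → 1 ℕ.≤ lookup b i) → (∀ i j → i Fin.< j → lookup b i ℕ.< lookup b j) →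
    (∀ i → suc (toℕ i) ≡ k → lookup b i ℕ.< a ℕ.+ k) → Row a (toList b)
  toList-row a []           _ _ _ = []
  toList-row a (b ∷ [])     pos inc bound = cons (pos zero) (ℕₚ.≤-pred (≡.subst (b ℕ.<_) (ℕₚ.+-comm a 1) (bound zero ≡.refl))) none []
  toList-row {suc (suc k)} a (b ∷ b′ ∷ bs) pos inc bound with toList-row (suc a) (b′ ∷ bs) (pos ∘ suc) (λ i j i<j → inc (suc i) (suc j) (ℕ.s≤s i<j))
      (λ i eq → ≡.subst (lookup (b′ ∷ bs) i ℕ.<_) (ℕₚ.+-suc a (suc k)) (bound (suc i) (≡.cong suc eq)))
  ... | row@(cons _ b′≤ _ _) = cons (pos zero) (ℕₚ.≤-pred (ℕₚ.≤-trans b<b′ b′≤)) (some b<b′) row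
    where
    b<b′ : b ℕ.< b′
    b<b′ = inc zero (suc zero) (ℕ.s≤s ℕ.z≤n)

  κ-identity : ∀ m n k → k ℕ.≤ n → (b : Vec ℕ k) → (∀ i → 1 ℕ.≤ lookup b i) → (∀ i j → i Fin.< j → lookup b i ℕ.< lookup b j) →
    (∀ i → suc (toℕ i) ≡ k → lookup b i ℕ.≤ m ℕ.+ k) →
    κ (gogGF m n k b) ≈ κ (constTerm (integrandPoly m n k b) (integrandSeries n k))
  κ-identity m n k k≤n b pos inc bound = ≡.subst (λ n → κ (gogGF m n k b) ≈ κ (constTerm (integrandPoly m n k b) (integrandSeries n k)))
    (ℕₚ.m+[n∸m]≡n k≤n) (begin
      κ (gogGF m (k ℕ.+ p) k b)
        ≈⟨ κ-gogGF m (k ℕ.+ p) k b ⟩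
      gog m (k ℕ.+ p) k (toList b)
        ≈⟨ gog-constantTerm m k p (toList b) (toList-row (suc m) b pos inc (λ i eq → ℕ.s≤s (bound i eq))) (Vecₚ.length-toList b) ⟩
      constantTerm (k ℕ.+ p) (List.map pow (toList b) ++ extras m k p)
        ≡⟨ ≡.cong (λ gs → Λ (ℕ.pred (k ℕ.+ p)) gs (V (k ℕ.+ p))) (pad-lookup (k ℕ.+ p) _ _ (factorSeries-at m k p b)) ⟨
      Λ (ℕ.pred (k ℕ.+ p)) (Vec.tabulate (factorSeries m (k ℕ.+ p) k b)) (V (k ℕ.+ p))
        ≈⟨ κ-integrand m (k ℕ.+ p) k b ⟨
      κ (constTerm (integrandPoly m (k ℕ.+ p) k b) (integrandSeries (k ℕ.+ p) k)) ∎)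
    where
    p = n ℕ.∸ k

-- The ring ℤ[u, v] and the comparison of coefficients.

ℤ-ring : Ring₀
ℤ-ring = ℤₚ.+-*-commutativeRing

uvExponents : IsCommutativeMonoid {A = ℕ × ℕ} _≡_ (λ { (p , q) (p′ , q′) → p ℕ.+ p′ , q ℕ.+ q′ }) (0 , 0)
uvExponents = record
  { isMonoid = record
    { isSemigroup = record
      { isMagma = record { isEquivalence = ≡.isEquivalence ; ∙-cong = ≡.cong₂ _ }
      ; assoc = λ { (p , q) (p′ , q′) (p″ , q″) → ≡.cong₂ _,_ (ℕₚ.+-assoc p p′ p″) (ℕₚ.+-assoc q q′ q″) } }
    ; identity = (λ _ → ≡.refl) , (λ { (p , q) → ≡.cong₂ _,_ (ℕₚ.+-identityʳ p) (ℕₚ.+-identityʳ q) }) }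
  ; comm = λ { (p , q) (p′ , q′) → ≡.cong₂ _,_ (ℕₚ.+-comm p p′) (ℕₚ.+-comm q q′) } }

module ℤ[u,v] where
  open Sums ℤ-ring
  open MonoidAlgebra ℤ-ring uvExponents public
  open CommutativeRing algebra using (Carrier; _≈_; _*_; 1#; -_; refl; trans)

  τ : ℤ → ℕ → ℕ → Carrier
  τ c p q = monomial c (p , q)

  τ-* : ∀ c p q c′ p′ q′ → τ (c ℤ.* c′) (p ℕ.+ p′) (q ℕ.+ q′) ≈ τ c p q * τ c′ p′ q′
  τ-* c p q c′ p′ q′ = pairing≈ (λ ψ → begin
    ⟨ τ (c ℤ.* c′) (p ℕ.+ p′) (q ℕ.+ q′) , ψ ⟩ ≡⟨ ⟨⟩-monomial _ _ ψ ⟩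
    c ℤ.* c′ ℤ.* ψ (p ℕ.+ p′ , q ℕ.+ q′) ≡⟨ ℤₚ.*-assoc c c′ _ ⟩
    c ℤ.* (c′ ℤ.* ψ (p ℕ.+ p′ , q ℕ.+ q′))
      ≡⟨ ≡.cong (c ℤ.*_) (⟨⟩-monomial c′ (p′ , q′) (λ { (a , b) → ψ (p ℕ.+ a , q ℕ.+ b) })) ⟨
    c ℤ.* ⟨ τ c′ p′ q′ , (λ { (a , b) → ψ (p ℕ.+ a , q ℕ.+ b) }) ⟩
      ≡⟨ ⟨⟩-monomial c (p , q) (λ { (p , q) → ⟨ τ c′ p′ q′ , (λ { (a , b) → ψ (p ℕ.+ a , q ℕ.+ b) }) ⟩ }) ⟨
    ⟨ τ c p q , _ ⟩ ≡⟨ ⟨⟩-⊠ (τ c p q) (τ c′ p′ q′) ψ ⟨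
    ⟨ τ c p q * τ c′ p′ q′ , ψ ⟩ ∎)
    where open ≡.≡-Reasoning

  τ-neg : τ -1ℤ 0 0 ≈ - 1#
  τ-neg = pairing≈ (λ ψ → ≡.trans (⟨⟩-monomial -1ℤ (0 , 0) ψ)
    (≡.sym (≡.trans (⟨⟩-scale -1ℤ 1# ψ) (≡.cong (-1ℤ ℤ.*_) (⟨⟩-unit (0 , 0) ψ)))))

  monomials : Monomials algebra (τ 1ℤ 1 0) (τ 1ℤ 0 1)
  monomials = record { τ = τ ; τ-* = τ-* ; τ-1 = refl ; τ-neg = τ-neg ; τ-u = refl ; τ-v = refl }

  open Interpretation algebra (τ 1ℤ 1 0) (τ 1ℤ 0 1) monomials public

  -- Equality in the algebra allows every function of the exponents as a test; this one reads off a
  -- single coefficient.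
  atExponents : ℕ → ℕ → ℕ × ℕ → ℤ
  atExponents a b (p , q) = if (p ℕ.≡ᵇ a) ∧ (q ℕ.≡ᵇ b) then 1ℤ else 0ℤ

  coeffUV-κ : ∀ a b P → coeffUV a b P ≡ ⟨ κ P , atExponents a b ⟩
  coeffUV-κ a b []      = ≡.sym (⟨⟩-none _)
  coeffUV-κ a b (t ∷ P) = begin
    (if c then coeff t ℤ.+ coeffUV a b P else coeffUV a b P) ≡⟨ go c ⟩
    coeff t ℤ.* (if c then 1ℤ else 0ℤ) ℤ.+ coeffUV a b P
      ≡⟨ ≡.cong₂ ℤ._+_ (≡.sym (⟨⟩-monomial (coeff t) (uexp t , vexp t) (atExponents a b))) (coeffUV-κ a b P) ⟩
    ⟨ ⟦ t ⟧ᵗ , atExponents a b ⟩ ℤ.+ ⟨ κ P , atExponents a b ⟩ ≡⟨ ⟨⟩-⊞ ⟦ t ⟧ᵗ (κ P) (atExponents a b) ⟨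
    ⟨ κ (t ∷ P) , atExponents a b ⟩ ∎
    where
    open ≡.≡-Reasoning
    c = (uexp t ℕ.≡ᵇ a) ∧ (vexp t ℕ.≡ᵇ b)
    go : ∀ c → (if c then coeff t ℤ.+ coeffUV a b P else coeffUV a b P) ≡ coeff t ℤ.* (if c then 1ℤ else 0ℤ) ℤ.+ coeffUV a b P
    go true  = ≡.cong (ℤ._+ coeffUV a b P) (≡.sym (ℤₚ.*-identityʳ (coeff t)))
    go false = ≡.trans (≡.sym (ℤₚ.+-identityˡ _)) (≡.cong (ℤ._+ coeffUV a b P) (≡.sym (ℤₚ.*-zeroʳ (coeff t))))

open import Data.Nat using (_+_; _≤_; _<_)

theorem3p2 : (m n k : ℕ) → k ≤ n → (b : Vec ℕ k)
    → (∀ (i : Fin k) → 1 ≤ lookup b i)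
    → (∀ (i j : Fin k) → i Fin.< j → lookup b i < lookup b j)
    → (∀ (i : Fin k) → suc (toℕ i) ≡ k → lookup b i ≤ m + k)
    → ∀ (p q : ℕ) → coeffUV p q (gogGF m n k b)
            ≡ coeffUV p q (constTerm (integrandPoly m n k b) (integrandSeries n k))
theorem3p2 m n k k≤n b positive increasing bounded p q = ≡.trans (coeffUV-κ p q (gogGF m n k b))
  (≡.trans (pair (κ-identity m n k k≤n b positive increasing bounded) (atExponents p q))
    (≡.sym (coeffUV-κ p q (constTerm (integrandPoly m n k b) (integrandSeries n k)))))
  where open ℤ[u,v]
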